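{- Let $R$ be an infinite dp-minimal integral domain with maximal ideal $\mathfrak M$. (1) Assume that $R$ is of equicharacteristic $p\geq 0$. Then the following are equivalent: (a) $R$ is a henselian valuation ring; (b) $R$ is integrally closed; (c) $R$ is root-closed; (d) $R$ has an infinite residue field; (e) $R$ has an infinite subring which is a field. (2) Assume that $R$ is of mixed characteristic $(0,p)$. Then the following are equivalent: (i) $R$ is a henselian valuation ring; (ii) either $R$ has an infinite residue field, or $\mathfrak M$ is a principal ideal (and the residue field is finite).
   Context: Rings are commutative with identity; a dp-minimal integral domain is an integral domain $R$ such that the structure $(R;+,\cdot,0,1)$ is dp-minimal; such a ring is local with maximal ideal $\mathfrak M$ and residue field $R/\mathfrak M$. $R$ is of equicharacteristic $p$ if $\mathrm{char}(R)=\mathrm{char}(R/\mathfrak M)=p$, and of mixed characteristic $(0,p)$ if $\mathrm{char}(R)=0$ and $\mathrm{char}(R/\mathfrak M)=p>0$. $R$ is root-closed if whenever $q\in\mathrm{Frac}(R)$ satisfies $q^n\in R$ for some $n\ge 1$, then $q\in R$. -}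

module Defs where

open import Level using (Level; _⊔_; Lift; lift) renaming (suc to lsuc)
open import Algebra.Bundles using (CommutativeRing)
open import Data.Nat as ℕ using (ℕ; zero; suc)
import Data.Nat.Divisibility as ℕD
open import Data.Fin using (Fin)
open import Data.Vec.Functional using () renaming (_∷_ to _∷ᵥ_)
open import Data.List using (List; []; _∷_; length; _++_; [_])
open import Data.Product using (Σ; ∃; _×_; _,_)
open import Data.Sum using (_⊎_)
open import Relation.Nullary using (¬_)
open import Relation.Binary.PropositionalEquality using (_≡_)
open import Function.Bundles using (_⇔_)

-- First-order language of rings (+, ·, 0, 1), formulas with n free
-- variables indexed by Fin n (de Bruijn style: ∃' binds variable zero).

data Term (n : ℕ) : Set where
  var  : Fin n → Term n
  zeroT oneT : Term n
  _⊕_ _⊗_ : Term n → Term n → Term n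

data Formula (n : ℕ) : Set where
  _≐_  : Term n → Term n → Formula n
  ¬'_  : Formula n → Formula n
  _∧'_ : Formula n → Formula n → Formula n
  ∃'   : Formula (suc n) → Formula n

module _ {c ℓ : Level} (R : CommutativeRing c ℓ) where
  open CommutativeRing R

  ⟦_⟧ₜ : ∀ {n} → Term n → (Fin n → Carrier) → Carrier
  ⟦ var i ⟧ₜ ρ = ρ i
  ⟦ zeroT ⟧ₜ ρ = 0#
  ⟦ oneT ⟧ₜ ρ = 1#
  ⟦ s ⊕ t ⟧ₜ ρ = ⟦ s ⟧ₜ ρ + ⟦ t ⟧ₜ ρ
  ⟦ s ⊗ t ⟧ₜ ρ = ⟦ s ⟧ₜ ρ * ⟦ t ⟧ₜ ρ

  Sat : ∀ {n} → Formula n → (Fin n → Carrier) → Set (c ⊔ ℓ)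
  Sat (s ≐ t) ρ = Lift c (⟦ s ⟧ₜ ρ ≈ ⟦ t ⟧ₜ ρ)
  Sat (¬' φ) ρ = ¬ Sat φ ρ
  Sat (φ ∧' ψ) ρ = Sat φ ρ × Sat ψ ρ
  Sat (∃' φ) ρ = Σ Carrier λ x → Sat φ (x ∷ᵥ ρ)

  ICTPattern : ∀ {k l} → Formula (suc k) → Formula (suc l) → ℕ → Set (c ⊔ ℓ)
  ICTPattern {k} {l} φ ψ N =
    Σ (Fin N → Fin k → Carrier) λ a →
    Σ (Fin N → Fin l → Carrier) λ b →
    ∀ (i j : Fin N) → Σ Carrier λ x →
      (∀ i′ → Sat φ (x ∷ᵥ a i′) ⇔ (i′ ≡ i)) ×
      (∀ j′ → Sat ψ (x ∷ᵥ b j′) ⇔ (j′ ≡ j))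

  -- dp-minimality of the structure (R;+,·,0,1): Th(R) has no ICT pattern
  -- of depth 2 in one variable; by compactness this is: for every pair of
  -- formulas there is a finite bound N on the size of such patterns in R.
  DPMinimal : Set (c ⊔ ℓ)
  DPMinimal = ∀ {k l} (φ : Formula (suc k)) (ψ : Formula (suc l)) →
    ∃ λ (N : ℕ) → ¬ ICTPattern φ ψ N

  _∣_ : Carrier → Carrier → Set (c ⊔ ℓ)
  a ∣ b = Σ Carrier λ q → b ≈ a * q

  _^_ : Carrier → ℕ → Carrier
  x ^ zero = 1#
  x ^ suc n = x * (x ^ n)

  ι : ℕ → Carrier
  ι zero = 0#
  ι (suc n) = 1# + ι n

  IntegralDomain : Set (c ⊔ ℓ)
  IntegralDomain = (¬ (1# ≈ 0#)) × (∀ x y → x * y ≈ 0# → (x ≈ 0#) ⊎ (y ≈ 0#))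

  IsUnit : Carrier → Set (c ⊔ ℓ)
  IsUnit x = Σ Carrier λ y → x * y ≈ 1#

  -- the maximal ideal 𝔐 of the local ring R: the non-units
  _∈𝔐 : Carrier → Set (c ⊔ ℓ)
  x ∈𝔐 = ¬ IsUnit x

  FiniteRing : Set (c ⊔ ℓ)
  FiniteRing = Σ ℕ λ n → Σ (Fin n → Carrier) λ f → ∀ x → Σ (Fin n) λ i → f i ≈ x

  InfiniteRing : Set (c ⊔ ℓ)
  InfiniteRing = ¬ FiniteRing

  FiniteResidueField : Set (c ⊔ ℓ)
  FiniteResidueField = Σ ℕ λ n → Σ (Fin n → Carrier) λ f →
    ∀ x → Σ (Fin n) λ i → (f i - x) ∈𝔐

  InfiniteResidueField : Set (c ⊔ ℓ)
  InfiniteResidueField = ¬ FiniteResidueField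

  HasChar : ℕ → Set ℓ
  HasChar p = ∀ n → (ι n ≈ 0#) ⇔ (p ℕD.∣ n)

  ResidueHasChar : ℕ → Set (c ⊔ ℓ)
  ResidueHasChar p = ∀ n → (ι n ∈𝔐) ⇔ (p ℕD.∣ n)

  -- Polynomials as coefficient lists (constant term first)

  eval : List Carrier → Carrier → Carrier
  eval [] x = 0#
  eval (a ∷ as) x = a + x * eval as x

  private
    derivAux : ℕ → List Carrier → List Carrier
    derivAux k [] = []
    derivAux k (b ∷ bs) = (ι k * b) ∷ derivAux (suc k) bs

  deriv : List Carrier → List Carrier
  deriv [] = []
  deriv (a ∷ as) = derivAux 1 as

  monic : List Carrier → List Carrier
  monic cs = cs ++ [ 1# ]

  -- homogenised evaluation: for p of degree d, Σ p_i a^i b^(d-i)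
  -- (= b^d · p(a/b) in Frac R)
  homEval : List Carrier → Carrier → Carrier → Carrier
  homEval [] a b = 0#
  homEval (p ∷ ps) a b = p * (b ^ length ps) + a * homEval ps a b

  -- Properties of R from the theorem.  A fraction q ∈ Frac R is written
  -- a/b with b ≠ 0; q ∈ R iff b ∣ a.

  ValuationRing : Set (c ⊔ ℓ)
  ValuationRing = ∀ a b → (a ∣ b) ⊎ (b ∣ a)

  Henselian : Set (c ⊔ ℓ)
  Henselian = ∀ (cs : List Carrier) (a : Carrier) →
    eval (monic cs) a ∈𝔐 → ¬ (eval (deriv (monic cs)) a ∈𝔐) →
    Σ Carrier λ b → (eval (monic cs) b ≈ 0#) × ((b - a) ∈𝔐)

  HenselianValuationRing : Set (c ⊔ ℓ)
  HenselianValuationRing = ValuationRing × Henselian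

  IntegrallyClosed : Set (c ⊔ ℓ)
  IntegrallyClosed = ∀ (cs : List Carrier) (a b : Carrier) → ¬ (b ≈ 0#) →
    homEval (monic cs) a b ≈ 0# → b ∣ a

  RootClosed : Set (c ⊔ ℓ)
  RootClosed = ∀ (n : ℕ) (a b : Carrier) → ¬ (b ≈ 0#) →
    (b ^ suc n) ∣ (a ^ suc n) → b ∣ a

  record IsSubfield (S : Carrier → Set (c ⊔ ℓ)) : Set (c ⊔ ℓ) where
    field
      resp  : ∀ {x y} → x ≈ y → S x → S y
      has0  : S 0#
      has1  : S 1#
      close+ : ∀ {x y} → S x → S y → S (x + y)
      close- : ∀ {x} → S x → S (- x)
      close* : ∀ {x y} → S x → S y → S (x * y)
      inv   : ∀ {x} → S x → ¬ (x ≈ 0#) → Σ Carrier λ y → S y × (x * y ≈ 1#)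

  InfiniteSubset : (Carrier → Set (c ⊔ ℓ)) → Set (c ⊔ ℓ)
  InfiniteSubset S = ¬ (Σ ℕ λ n → Σ (Fin n → Carrier) λ f →
    ∀ x → S x → Σ (Fin n) λ i → f i ≈ x)

  HasInfiniteSubfield : Set (lsuc (c ⊔ ℓ))
  HasInfiniteSubfield = Σ (Carrier → Set (c ⊔ ℓ)) λ S → IsSubfield S × InfiniteSubset S

  MaximalIdealPrincipal : Set (c ⊔ ℓ)
  MaximalIdealPrincipal = Σ Carrier λ m → ∀ x → (x ∈𝔐) ⇔ (m ∣ x)

{-# OPTIONS --safe #-}
module Submission where

-- Dp-minimality bounds the configurations in which the cosets or balls of one definable family are crossed with the
-- members of another. Crossing the multiples of a with those of b shows that R is a valuation ring as soon as it has
-- infinitely many elements with unit differences, or a principal maximal ideal.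
--
-- A dp-minimal valuation ring is henselian. A definable set has finitely many germs, hence contains or avoids a ball
-- inside every ball; so definable sets without interior are finite, and every map of the form identity plus
-- contraction on 𝔐ⁿ has a box in its image. A simple root modulo 𝔐 of a monic polynomial P gives an idempotent of
-- R[x]/(P) modulo 𝔐. By Newton's method the z modulo which it does not lift form a definable prime ideal; modulo this
-- ideal approximate lifts are arbitrarily good, and they become exact because z ↦ z + z² is open at 0.
--
-- In characteristic p the groups of all t with t/b of the form y^p − y in the fraction field have bounded index, so
-- by Baldwin–Saxl they share a nonzero element: y^p − y = a is solvable for every unit a. If R is root-closed, iterated
-- solutions starting from a = 1 lie in R and generate an infinite field. In mixed characteristic, with finite residue
-- field and 𝔐 not principal, the same argument truncated at some κ with κ^(2p) ∣ p makes y ↦ y^p − y surjective on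
-- the residue field, which is absurd.

-- Dp-minimality enters only as a finite bound on grids in `R` itself. There is no saturated
-- extension to work in, so compactness arguments become uniform bounds `K` or pigeonholes over
-- finitely many codes. The open image theorem yields a box somewhere in the image, at a centre that
-- cannot be prescribed. This is the obstacle to lifting a root of a general polynomial directly.
-- For z + z² it disappears: 1 + 4(z + z²) is the square (1 + 2z)², and the resulting law on values
-- carries a box at any value to a box at 0. Idempotents can be corrected by solving such an
-- equation, which is why the proof passes to R[x]/(P) although a single root is wanted. The box at
-- 0 has an unknown radius δ, while a root modulo 𝔐 controls the error only modulo 𝔐. Newton steps
-- square the error, so the obstruction to reaching δ is a prime ideal; its definability keeps the
-- quotient dp-minimal.

open import Defs hiding (_∣_; _^_)
import Defs
open import Level using (Level; Lift; lift; lower; _⊔_) renaming (suc to lsuc)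
open import Algebra.Bundles using (CommutativeRing; RawRing)
open import Algebra.Solver.Ring.AlmostCommutativeRing using (AlmostCommutativeRing; fromCommutativeRing; _-Raw-AlmostCommutative⟶_)
open import Axiom.ExcludedMiddle using (ExcludedMiddle)
open import Data.Empty using (⊥; ⊥-elim)
open import Data.Fin using (Fin; zero; suc; toℕ; punchIn; punchOut)
import Data.Fin as Fin
import Data.Fin.Properties as Finₚ
open import Data.Integer using (ℤ; +_; -[1+_]; _⊖_)
import Data.Integer as ℤ
import Data.Integer.Properties as ℤₚ
open import Data.List using (List; []; _∷_; length; _++_)
open import Data.List.Membership.Propositional using (_∈_)
open import Data.List.Membership.Propositional.Properties using (∈-++⁺ˡ; ∈-++⁺ʳ)
open import Data.List.Relation.Unary.Any using (here; there; index)
import Data.List.Relation.Unary.Any.Properties as Anyₚ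
import Data.List as List
open import Data.Maybe using (Maybe; just; nothing)
open import Data.Nat using (ℕ; zero; suc; z≤n; s≤s)
import Data.Nat as ℕ
import Data.Nat.Properties as ℕₚ
import Data.Nat.Divisibility as ℕD
open import Data.Product using (Σ; ∃; _×_; _,_; proj₁; proj₂)
open import Data.Sum using (_⊎_; inj₁; inj₂; [_,_]′)
open import Data.Unit.Polymorphic using (⊤; tt)
open import Data.Vec using (Vec; []; _∷_; lookup; tabulate)
import Data.Vec as Vec
import Data.Vec.Properties as Vecₚ
open import Data.Vec.Relation.Binary.Pointwise.Inductive as Pointwise using (Pointwise; []; _∷_)
open import Data.Vec.Functional using () renaming (_∷_ to _∷ᵥ_)
open import Function using (_∘_; id; case_of_)
open import Function.Bundles using (_⇔_; mk⇔; Equivalence)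
open import Relation.Nullary using (¬_; Dec; yes; no; contradiction)
open import Relation.Binary.Definitions using (tri<; tri≈; tri>)
open import Relation.Binary.PropositionalEquality as ≡ using (_≡_; _≢_)

-- The ring solver with integer coefficients, so that cancellation works in rings without decidable equality.
module IntegerSolver {c ℓ} (R : CommutativeRing c ℓ) where
  open CommutativeRing R hiding (zero) renaming (refl to ≈refl; sym to ≈sym; trans to ≈trans)
  open import Algebra.Properties.Ring ring using (-‿distribˡ-*; -‿distribʳ-*; -‿involutive; -‿+-comm; -0#≈0#)
  open import Algebra.Properties.Semiring.Mult.TCOptimised semiring using () renaming (_×_ to _×ₙ_; ×-homo-+ to ×ₙ-homo-+; ×1-homo-* to ×ₙ1-homo-*; 1+× to 1+×ₙ)
  open import Relation.Binary.Reasoning.Setoid setoid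

  fromℤ : ℤ → Carrier
  fromℤ (+ n) = n ×ₙ 1#
  fromℤ -[1+ n ] = - (suc n ×ₙ 1#)

  private
    cancel : ∀ x y z → (x + y) - (x + z) ≈ y - z
    cancel x y z = begin
      (x + y) - (x + z)         ≈⟨ +-congˡ (-‿+-comm x z) ⟨
      (x + y) + (- x - z)       ≈⟨ +-congʳ (+-comm x y) ⟩
      (y + x) + (- x - z)       ≈⟨ +-assoc y x _ ⟩
      y + (x + (- x - z))       ≈⟨ +-congˡ (+-assoc x (- x) (- z)) ⟨
      y + ((x - x) - z)         ≈⟨ +-congˡ (+-congʳ (-‿inverseʳ x)) ⟩
      y + (0# - z)              ≈⟨ +-congˡ (+-identityˡ _) ⟩
      y - z                     ∎

    ⊖-homo : ∀ m n → fromℤ (m ⊖ n) ≈ (m ×ₙ 1#) - (n ×ₙ 1#)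
    ⊖-homo zero zero = ≈sym (-‿inverseʳ 0#)
    ⊖-homo zero (suc n) = ≈sym (+-identityˡ _)
    ⊖-homo (suc m) zero = ≈sym (≈trans (+-congˡ -0#≈0#) (+-identityʳ _))
    ⊖-homo (suc m) (suc n) = begin
      fromℤ (suc m ⊖ suc n)            ≡⟨ ≡.cong fromℤ (ℤₚ.[1+m]⊖[1+n]≡m⊖n m n) ⟩
      fromℤ (m ⊖ n)                    ≈⟨ ⊖-homo m n ⟩
      (m ×ₙ 1#) - (n ×ₙ 1#)              ≈⟨ cancel 1# _ _ ⟨
      (1# + m ×ₙ 1#) - (1# + n ×ₙ 1#)    ≈⟨ +-cong (1+×ₙ m 1#) (-‿cong (1+×ₙ n 1#)) ⟨
      (suc m ×ₙ 1#) - (suc n ×ₙ 1#)      ∎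

    neg-homo : ∀ i → fromℤ (ℤ.- i) ≈ - fromℤ i
    neg-homo (+ zero) = ≈sym -0#≈0#
    neg-homo (+ suc n) = ≈refl
    neg-homo -[1+ n ] = ≈sym (-‿involutive _)

    +-homo : ∀ i j → fromℤ (i ℤ.+ j) ≈ fromℤ i + fromℤ j
    +-homo (+ m) (+ n) = ×ₙ-homo-+ 1# m n
    +-homo (+ m) -[1+ n ] = ⊖-homo m (suc n)
    +-homo -[1+ m ] (+ n) = ≈trans (⊖-homo n (suc m)) (+-comm _ _)
    +-homo -[1+ m ] -[1+ n ] = begin
      - (suc (suc (m ℕ.+ n)) ×ₙ 1#)        ≡⟨ ≡.cong (λ k → - (suc k ×ₙ 1#)) (ℕₚ.+-suc m n) ⟨
      - ((suc m ℕ.+ suc n) ×ₙ 1#)          ≈⟨ -‿cong (×ₙ-homo-+ 1# (suc m) (suc n)) ⟩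
      - (suc m ×ₙ 1# + suc n ×ₙ 1#)         ≈⟨ -‿+-comm _ _ ⟨
      - (suc m ×ₙ 1#) - (suc n ×ₙ 1#)       ∎

    *-homo⁺ : ∀ m n → fromℤ (+ m ℤ.* + n) ≈ fromℤ (+ m) * fromℤ (+ n)
    *-homo⁺ m n = ≈trans (reflexive (≡.cong fromℤ (≡.sym (ℤₚ.pos-* m n)))) (×ₙ1-homo-* m n)

    *-homoˡ : ∀ m j → fromℤ (+ m ℤ.* j) ≈ fromℤ (+ m) * fromℤ j
    *-homoˡ m (+ n) = *-homo⁺ m n
    *-homoˡ m -[1+ n ] = begin
      fromℤ (+ m ℤ.* (ℤ.- (+ suc n)))  ≡⟨ ≡.cong fromℤ (≡.sym (ℤₚ.neg-distribʳ-* (+ m) (+ suc n))) ⟩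
      fromℤ (ℤ.- (+ m ℤ.* + suc n))    ≈⟨ neg-homo (+ m ℤ.* + suc n) ⟩
      - fromℤ (+ m ℤ.* + suc n)        ≈⟨ -‿cong (*-homo⁺ m (suc n)) ⟩
      - (fromℤ (+ m) * fromℤ (+ suc n)) ≈⟨ -‿distribʳ-* _ _ ⟩
      fromℤ (+ m) * fromℤ -[1+ n ]     ∎

    *-homo : ∀ i j → fromℤ (i ℤ.* j) ≈ fromℤ i * fromℤ j
    *-homo (+ m) j = *-homoˡ m j
    *-homo -[1+ m ] j = begin
      fromℤ ((ℤ.- (+ suc m)) ℤ.* j)    ≡⟨ ≡.cong fromℤ (≡.sym (ℤₚ.neg-distribˡ-* (+ suc m) j)) ⟩
      fromℤ (ℤ.- (+ suc m ℤ.* j))      ≈⟨ neg-homo (+ suc m ℤ.* j) ⟩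
      - fromℤ (+ suc m ℤ.* j)          ≈⟨ -‿cong (*-homoˡ (suc m) j) ⟩
      - (fromℤ (+ suc m) * fromℤ j)    ≈⟨ -‿distribˡ-* _ _ ⟩
      fromℤ -[1+ m ] * fromℤ j         ∎

    ℤ-rawRing : RawRing _ _
    ℤ-rawRing = record { Carrier = ℤ ; _≈_ = _≡_ ; _+_ = ℤ._+_ ; _*_ = ℤ._*_ ; -_ = ℤ.-_ ; 0# = + 0 ; 1# = + 1 }

    acr : AlmostCommutativeRing c ℓ
    acr = fromCommutativeRing R

    morphism : ℤ-rawRing -Raw-AlmostCommutative⟶ acr
    morphism = record { ⟦_⟧ = fromℤ ; +-homo = +-homo ; *-homo = *-homo ; -‿homo = neg-homo ; 0-homo = ≈refl ; 1-homo = ≈refl }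

    weak≟ : ∀ i j → Maybe (fromℤ i ≈ fromℤ j)
    weak≟ i j with i ℤₚ.≟ j
    ... | yes eq = just (reflexive (≡.cong fromℤ eq))
    ... | no _ = nothing

  open import Algebra.Solver.Ring ℤ-rawRing acr morphism weak≟ public using (solve; _:=_; _:+_; _:*_; :-_; _:-_; con)

-- Classical logic and finite combinatorics

module _ {p x : Level} (em : ExcludedMiddle (x ⊔ p)) where

  em-lower : ExcludedMiddle p
  em-lower {P} with em {Lift x P}
  ... | yes (lift h) = yes h
  ... | no h = no (h ∘ lift)

  ¬∀⇒∃¬ : {X : Set x} {P : X → Set p} → ¬ (∀ y → P y) → Σ X λ y → ¬ P y
  ¬∀⇒∃¬ {X} {P} h with em {Σ X λ y → ¬ P y}
  ... | yes w = w
  ... | no w = contradiction all h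
    where
    all : ∀ y → P y
    all y with em-lower {P y}
    ... | yes q = q
    ... | no q = contradiction (y , q) w

stable : ∀ {p} → ExcludedMiddle p → {P : Set p} → ¬ ¬ P → P
stable em {P} h with em {P}
... | yes q = q
... | no q = contradiction q h

bit : ∀ {p} {P : Set p} → Dec P → Fin 2
bit (yes _) = zero
bit (no _) = suc zero

bit-sound : ∀ {p} {P Q : Set p} (a : Dec P) (b : Dec Q) → bit a ≡ bit b → (P → Q) × (Q → P)
bit-sound (yes p) (yes q) _ = (λ _ → q) , (λ _ → p)
bit-sound (no p) (no q) _ = (λ x → contradiction x p) , (λ x → contradiction x q)

bit-complete : ∀ {p} {P Q : Set p} (a : Dec P) (b : Dec Q) → (P → Q) × (Q → P) → bit a ≡ bit b
bit-complete (yes p) (yes q) _ = ≡.refl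
bit-complete (no p) (no q) _ = ≡.refl
bit-complete (yes p) (no q) (h , g) = contradiction (h p) q
bit-complete (no p) (yes q) (h , g) = contradiction (g q) p

Apart : ∀ {x r n} {X : Set x} → (X → X → Set r) → (Fin n → X) → Set r
Apart E f = ∀ i j → i ≢ j → ¬ E (f i) (f j)

module _ {x r : Level} {X : Set x} (E : X → X → Set r) (E-sym : ∀ {y z} → E y z → E z y) where

  apart-∷ : ∀ {n} (f : Fin n → X) y → Apart E f → (∀ i → ¬ E (f i) y) → Apart E (y ∷ᵥ f)
  apart-∷ f y af new zero zero ne = contradiction ≡.refl ne
  apart-∷ f y af new zero (suc j) ne = new j ∘ E-sym
  apart-∷ f y af new (suc i) zero ne = new i
  apart-∷ f y af new (suc i) (suc j) ne = af i j (ne ∘ ≡.cong suc)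

  module _ (em : ExcludedMiddle (x ⊔ r)) where

    apart-of-infinite : (∀ n (f : Fin n → X) → ¬ (∀ y → ∃ λ i → E (f i) y)) →
      ∀ n → Σ (Fin n → X) (Apart E)
    apart-of-infinite inf zero = (λ ()) , λ ()
    apart-of-infinite inf (suc n) with apart-of-infinite inf n
    ... | f , af with ¬∀⇒∃¬ em (inf n f)
    ... | y , h = y ∷ᵥ f , apart-∷ f y af (λ i e → h (i , e))

    -- A longest apart family is maximal, so no element is apart from all its members and the family
    -- covers. Its length is found by lowering the bound until a family of that length exists.
    representatives : ∀ m → (∀ (f : Fin (suc m) → X) → ¬ Apart E f) →
      Σ ℕ λ k → k ℕ.≤ m × Σ (Fin k → X) λ f → Apart E f × (∀ y → ∃ λ i → E (f i) y)
    representatives m bound with em {Σ (Fin m → X) (Apart E)}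
    ... | yes (f , af) = m , ℕₚ.≤-refl , f , af , cover
      where
      cover : ∀ y → ∃ λ i → E (f i) y
      cover y with em-lower {p = r} {x = x} em {∃ λ i → E (f i) y}
      ... | yes w = w
      ... | no w = contradiction (apart-∷ f y af (λ i e → w (i , e))) (bound _)
    representatives zero bound | no none = contradiction ((λ ()) , λ ()) none
    representatives (suc m) bound | no none with representatives m (λ f af → none (f , af))
    ... | k , k≤m , rest = k , ℕₚ.m≤n⇒m≤1+n k≤m , rest

    module _ (E-trans : ∀ {y z w} → E y z → E z w → E y w) where

      -- The index of a representative serves as the colour. A fixed codomain lets `Bondy` count
      -- colour vectors with the same number of colours for every member of a family of relations.
      colouring : ∀ m → (∀ (f : Fin (suc m) → X) → ¬ Apart E f) →
        Σ (X → Fin m) λ col → (∀ {y z} → col y ≡ col z → E y z) × (∀ {y z} → E y z → col y ≡ col z)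
      colouring m bound with representatives m bound
      ... | k , k≤m , f , af , cover = col , same , same⁻¹
        where
        col : X → Fin m
        col y = Fin.inject≤ (proj₁ (cover y)) k≤m
        same : ∀ {y z} → col y ≡ col z → E y z
        same {y} {z} eq = E-trans (E-sym (proj₂ (cover y)))
          (≡.subst (λ i → E (f i) z) (≡.sym (Finₚ.inject≤-injective k≤m k≤m _ _ eq)) (proj₂ (cover z)))
        same⁻¹ : ∀ {y z} → E y z → col y ≡ col z
        same⁻¹ {y} {z} e with proj₁ (cover y) Fin.≟ proj₁ (cover z)
        ... | yes eq = ≡.cong (λ i → Fin.inject≤ i k≤m) eq
        ... | no ne = contradiction (E-trans (proj₂ (cover y)) (E-trans e (E-sym (proj₂ (cover z))))) (af _ _ ne)

-- A form of Bondy's theorem: a minimal separating family is irredundant, and it is large when there are many points.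
module Bondy {t : Level} (em : ExcludedMiddle t) {T : Set t} (m N : ℕ) (col : T → Fin N → Fin (suc m)) where

  Separating : ∀ {n} → (Fin n → T) → Set
  Separating s = ∀ j k → j ≢ k → ∃ λ i → col (s i) j ≢ col (s i) k

  private
    em₀ : ExcludedMiddle Level.zero
    em₀ = em-lower {p = Level.zero} {x = t} em

    Minimal : ∀ {n} → (Fin (suc n) → T) → Set
    Minimal s = ∀ i → ¬ Separating (s ∘ punchIn i)

    minimise : ∀ n (s : Fin (suc n) → T) → Separating s →
      Σ ℕ λ n′ → Σ (Fin (suc n′) → T) λ s′ → Separating s′ × (Minimal s′ ⊎ n′ ≡ 0)
    minimise n s sep with em₀ {∃ λ i → Separating (s ∘ punchIn i)}
    minimise n s sep | no none = n , s , sep , inj₁ (λ i h → none (i , h))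
    minimise zero s sep | yes _ = zero , s , sep , inj₂ ≡.refl
    minimise (suc n) s sep | yes (i , h) = minimise n (s ∘ punchIn i) h

    -- A separating family of n tests embeds the N points into the (m + 1)^n colour vectors, so many
    -- points force many tests.
    large : ∀ K → suc m ℕ.^ K ℕ.< N → ∀ {n} (s : Fin n → T) → Separating s → K ℕ.< n
    large K big {n} s sep with K ℕₚ.<? n
    ... | yes h = h
    ... | no h = contradiction same none
      where
      small : suc m ℕ.^ n ℕ.< N
      small = ℕₚ.≤-<-trans (ℕₚ.^-monoʳ-≤ (suc m) (ℕₚ.≮⇒≥ h)) big
      code : Fin N → Fin (suc m ℕ.^ n)
      code j = Fin.funToFin {n} {suc m} (λ i → col (s i) j)
      hole = Finₚ.pigeonhole small code
      j = proj₁ hole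
      k = proj₁ (proj₂ hole)
      same : ∀ i → col (s i) j ≡ col (s i) k
      same i = ≡.trans (≡.sym (Finₚ.finToFun-funToFin {n} {suc m} (λ i → col (s i) j) i))
        (≡.trans (≡.cong (λ w → Fin.finToFun {suc m} {n} w i) (proj₂ (proj₂ (proj₂ hole))))
          (Finₚ.finToFun-funToFin {n} {suc m} (λ i → col (s i) k) i))
      none : ¬ (∀ i → col (s i) j ≡ col (s i) k)
      none eq with sep j k (Finₚ.<⇒≢ (proj₁ (proj₂ (proj₂ hole))))
      ... | i , ne = ne (eq i)

  -- Tests and pairs are matched: each pair is told apart by its own test and by no other. One side
  -- of the matching later supplies parameters of a pattern, the other side its points.
  Irredundant : ∀ K → Set t
  Irredundant K = Σ (Fin K → T) λ s → Σ (Fin K → Fin N) λ π₁ → Σ (Fin K → Fin N) λ π₂ →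
    ∀ i l → (col (s i) (π₁ l) ≢ col (s i) (π₂ l)) ⇔ (i ≡ l)

  abstract
    bondy : ∀ K → suc m ℕ.^ suc K ℕ.< N → (∀ j k → j ≢ k → ∃ λ u → col u j ≢ col u k) → Irredundant (suc K)
    bondy K big sep = pick N×N.n′ N×N.s′ N×N.sep′ N×N.min
      where
      two : 2 ℕ.≤ N
      two = ℕₚ.≤-trans (s≤s (ℕₚ.m^n>0 (suc m) (suc K))) big
      -- Any pair provides an inhabitant of `T`. It fills the diagonal of the table of tests and
      -- makes the family nonempty, as `minimise` requires.
      default : T
      default = proj₁ (sep (Fin.fromℕ< {0} (ℕₚ.≤-trans (s≤s z≤n) two)) (Fin.fromℕ< {1} two)
        (λ eq → ℕₚ.0≢1+n (≡.trans (≡.sym (Finₚ.toℕ-fromℕ< _)) (≡.trans (≡.cong toℕ eq) (Finₚ.toℕ-fromℕ< two)))))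
      choose : Fin N → Fin N → T
      choose j k with j Fin.≟ k
      ... | yes _ = default
      ... | no ne = proj₁ (sep j k ne)
      choose-sep : ∀ j k → j ≢ k → col (choose j k) j ≢ col (choose j k) k
      choose-sep j k ne with j Fin.≟ k
      ... | yes eq = contradiction eq ne
      ... | no ne′ = proj₂ (sep j k ne′)
      all : Fin (suc (N ℕ.* N)) → T
      all zero = default
      all (suc i) = choose (proj₁ (Fin.remQuot {N} N i)) (proj₂ (Fin.remQuot {N} N i))
      all-sep : Separating all
      all-sep j k ne = suc (Fin.combine j k) , (λ eq → choose-sep j k ne
        (≡.subst (λ q → col (choose (proj₁ q) (proj₂ q)) j ≡ col (choose (proj₁ q) (proj₂ q)) k) (Finₚ.remQuot-combine {N} {N} j k) eq))
      module N×N where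
        result = minimise _ all all-sep
        n′ = proj₁ result
        s′ = proj₁ (proj₂ result)
        sep′ = proj₁ (proj₂ (proj₂ result))
        min = proj₂ (proj₂ (proj₂ result))
      pick : ∀ n (s : Fin (suc n) → T) → Separating s → Minimal s ⊎ n ≡ 0 → Irredundant (suc K)
      -- The minimisation may stop at a single test, but `large` demands more than K + 1 of them.
      pick n s sp (inj₂ ≡.refl) = contradiction (large (suc K) big s sp) (λ { (s≤s ()) })
      pick n s sp (inj₁ mn) = s ∘ emb , (λ l → proj₁ (pair (emb l))) , (λ l → proj₁ (proj₂ (pair (emb l)))) ,
          λ i l → mk⇔ (λ ne → Finₚ.inject≤-injective _ _ _ _ (only (emb i) (emb l) ne)) (λ { ≡.refl → does (emb i) })
        where
        emb : Fin (suc K) → Fin (suc n)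
        emb i = Fin.inject≤ i (ℕₚ.<⇒≤ (large (suc K) big s sp))
        -- Dropping test i merges some pair of points, so test i is the only one that separates this
        -- pair.
        pair : ∀ i → Σ (Fin N) λ j → Σ (Fin N) λ k → j ≢ k × (∀ l → col (s (punchIn i l)) j ≡ col (s (punchIn i l)) k)
        pair i with ¬∀⇒∃¬ em₀ (mn i)
        ... | j , h with ¬∀⇒∃¬ em₀ h
        ... | k , h′ with ¬∀⇒∃¬ em₀ h′
        ... | ne , h″ = j , k , ne , λ l → stable em₀ (λ d → h″ (l , d))
        only : ∀ i l → col (s i) (proj₁ (pair l)) ≢ col (s i) (proj₁ (proj₂ (pair l))) → i ≡ l
        only i l ne with l Fin.≟ i
        ... | yes eq = ≡.sym eq
        ... | no l≢i = contradiction (≡.subst (λ w → col (s w) (proj₁ (pair l)) ≡ col (s w) (proj₁ (proj₂ (pair l))))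
                (Finₚ.punchIn-punchOut l≢i) (proj₂ (proj₂ (proj₂ (pair l))) (punchOut l≢i))) ne
        does : ∀ i → col (s i) (proj₁ (pair i)) ≢ col (s i) (proj₁ (proj₂ (pair i)))
        does i with sp _ _ (proj₁ (proj₂ (proj₂ (pair i))))
        ... | l , ne = ≡.subst (λ w → col (s w) (proj₁ (pair i)) ≢ col (s w) (proj₁ (proj₂ (pair i)))) (only l i ne) ne

-- Definable sets

-- Formulas with parameters, with all connectives and with previously defined sets as atoms;
-- their semantics computes to the expected type.
module DefinableSets {c ℓ} (R : CommutativeRing c ℓ) where
  open CommutativeRing R hiding (zero) renaming (refl to ≈refl; sym to ≈sym; trans to ≈trans)
  open import Algebra.Properties.Ring ring using (-1*x≈-x)

  data Tm (n : ℕ) : Set c where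
    var : Fin n → Tm n
    cst : Carrier → Tm n
    _⊞_ _⊠_ : Tm n → Tm n → Tm n
    ⊟_ : Tm n → Tm n

  data Fm : ℕ → Set c where
    _≋_ _divides_ : ∀ {n} → Tm n → Tm n → Fm n
    ∼_ : ∀ {n} → Fm n → Fm n
    _⩓_ _⩔_ _⟹_ : ∀ {n} → Fm n → Fm n → Fm n
    All Ex : ∀ {n} → Fm (suc n) → Fm n
    atom : ∀ {m n} → Fm m → Vec (Tm n) m → Fm n
    -- The terms replace the first m variables; the last k variables of the context are passed on
    -- unchanged. Parameter tuples of arbitrary length thus need not be listed as terms.
    atom↓ : ∀ {m} j {k} → Fm (m ℕ.+ k) → Vec (Tm (j ℕ.+ k)) m → Fm (j ℕ.+ k)

  infixl 7 _⊠_
  infixl 6 _⊞_ _⊟′_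
  infix 5 _≋_ _divides_
  infixr 4 _⩓_ _⩔_
  infixr 3 _⟹_

  _⊟′_ : ∀ {n} → Tm n → Tm n → Tm n
  s ⊟′ t = s ⊞ (⊟ t)

  v₀ : ∀ {n} → Tm (1 ℕ.+ n)
  v₀ = var zero
  v₁ : ∀ {n} → Tm (2 ℕ.+ n)
  v₁ = var (suc zero)
  v₂ : ∀ {n} → Tm (3 ℕ.+ n)
  v₂ = var (suc (suc zero))
  v₃ : ∀ {n} → Tm (4 ℕ.+ n)
  v₃ = var (suc (suc (suc zero)))

  ⟦_⟧ᵗ : ∀ {n} → Tm n → Vec Carrier n → Carrier
  ⟦ var i ⟧ᵗ ρ = lookup ρ i
  ⟦ cst a ⟧ᵗ ρ = a
  ⟦ s ⊞ t ⟧ᵗ ρ = ⟦ s ⟧ᵗ ρ + ⟦ t ⟧ᵗ ρ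
  ⟦ s ⊠ t ⟧ᵗ ρ = ⟦ s ⟧ᵗ ρ * ⟦ t ⟧ᵗ ρ
  ⟦ ⊟ t ⟧ᵗ ρ = - ⟦ t ⟧ᵗ ρ

  ⟦_⟧ᵗˢ : ∀ {n m} → Vec (Tm n) m → Vec Carrier n → Vec Carrier m
  ⟦ [] ⟧ᵗˢ ρ = []
  ⟦ t ∷ ts ⟧ᵗˢ ρ = ⟦ t ⟧ᵗ ρ ∷ ⟦ ts ⟧ᵗˢ ρ

  dropᵛ : ∀ j {k} → Vec Carrier (j ℕ.+ k) → Vec Carrier k
  dropᵛ zero ρ = ρ
  dropᵛ (suc j) (x ∷ ρ) = dropᵛ j ρ

  ⟦_⟧ : ∀ {n} → Fm n → Vec Carrier n → Set (c ⊔ ℓ)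
  ⟦ s ≋ t ⟧ ρ = Lift c (⟦ s ⟧ᵗ ρ ≈ ⟦ t ⟧ᵗ ρ)
  ⟦ s divides t ⟧ ρ = Defs._∣_ R (⟦ s ⟧ᵗ ρ) (⟦ t ⟧ᵗ ρ)
  ⟦ ∼ φ ⟧ ρ = ¬ ⟦ φ ⟧ ρ
  ⟦ φ ⩓ ψ ⟧ ρ = ⟦ φ ⟧ ρ × ⟦ ψ ⟧ ρ
  ⟦ φ ⩔ ψ ⟧ ρ = ⟦ φ ⟧ ρ ⊎ ⟦ ψ ⟧ ρ
  ⟦ φ ⟹ ψ ⟧ ρ = ⟦ φ ⟧ ρ → ⟦ ψ ⟧ ρ
  ⟦ All φ ⟧ ρ = ∀ x → ⟦ φ ⟧ (x ∷ ρ)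
  ⟦ Ex φ ⟧ ρ = Σ Carrier λ x → ⟦ φ ⟧ (x ∷ ρ)
  ⟦ atom φ ts ⟧ ρ = ⟦ φ ⟧ (⟦ ts ⟧ᵗˢ ρ)
  ⟦ atom↓ j φ ts ⟧ ρ = ⟦ φ ⟧ (⟦ ts ⟧ᵗˢ ρ Vec.++ dropᵛ j ρ)

  exs : ∀ m {n} → Fm (m ℕ.+ n) → Fm n
  exs zero φ = φ
  exs (suc m) φ = exs m (Ex φ)

  exs-intro : ∀ m {n} (φ : Fm (m ℕ.+ n)) {ρ} v → ⟦ φ ⟧ (v Vec.++ ρ) → ⟦ exs m φ ⟧ ρ
  exs-intro zero φ [] h = h
  exs-intro (suc m) φ (x ∷ v) h = exs-intro m (Ex φ) v (x , h)

  exs-elim : ∀ m {n} (φ : Fm (m ℕ.+ n)) {ρ} → ⟦ exs m φ ⟧ ρ → Σ (Vec Carrier m) λ v → ⟦ φ ⟧ (v Vec.++ ρ)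
  exs-elim zero φ h = [] , h
  exs-elim (suc m) φ h with exs-elim m (Ex φ) h
  ... | v , x , h′ = x ∷ v , h′

  ⋀ : ∀ {n m} → (Fin m → Fm n) → Fm n
  ⋀ {m = zero} φ = cst 0# ≋ cst 0#
  ⋀ {m = suc m} φ = φ zero ⩓ ⋀ (φ ∘ suc)

  ⋀-intro : ∀ {n m} (φ : Fin m → Fm n) {ρ} → (∀ i → ⟦ φ i ⟧ ρ) → ⟦ ⋀ φ ⟧ ρ
  ⋀-intro {m = zero} φ h = lift ≈refl
  ⋀-intro {m = suc m} φ h = h zero , ⋀-intro (φ ∘ suc) (h ∘ suc)

  ⋀-elim : ∀ {n m} (φ : Fin m → Fm n) {ρ} → ⟦ ⋀ φ ⟧ ρ → ∀ i → ⟦ φ i ⟧ ρ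
  ⋀-elim {m = suc m} φ (h , _) zero = h
  ⋀-elim {m = suc m} φ (_ , h) (suc i) = ⋀-elim (φ ∘ suc) h i

  ⋁ : ∀ {n m} → (Fin m → Fm n) → Fm n
  ⋁ {m = zero} φ = ∼ (cst 0# ≋ cst 0#)
  ⋁ {m = suc m} φ = φ zero ⩔ ⋁ (φ ∘ suc)

  ⋁-intro : ∀ {n m} (φ : Fin m → Fm n) {ρ} i → ⟦ φ i ⟧ ρ → ⟦ ⋁ φ ⟧ ρ
  ⋁-intro {m = suc m} φ zero h = inj₁ h
  ⋁-intro {m = suc m} φ (suc i) h = inj₂ (⋁-intro (φ ∘ suc) i h)

  ⋁-elim : ∀ {n m} (φ : Fin m → Fm n) {ρ} → ⟦ ⋁ φ ⟧ ρ → ∃ λ i → ⟦ φ i ⟧ ρ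
  ⋁-elim {m = zero} φ h = contradiction (lift ≈refl) h
  ⋁-elim {m = suc m} φ (inj₁ h) = zero , h
  ⋁-elim {m = suc m} φ (inj₂ h) with ⋁-elim (φ ∘ suc) h
  ... | i , h′ = suc i , h′

  -- Translation into formulas of the language of rings

  private
    Env : ℕ → Set c
    Env n = Fin n → Carrier

    _≗≈_ : ∀ {n} → Env n → Env n → Set ℓ
    ρ ≗≈ ρ′ = ∀ i → ρ i ≈ ρ′ i

    term-cong : ∀ {n} (t : Term n) {ρ ρ′ : Env n} → ρ ≗≈ ρ′ → ⟦_⟧ₜ R t ρ ≈ ⟦_⟧ₜ R t ρ′
    term-cong (var i) h = h i
    term-cong zeroT h = ≈refl
    term-cong oneT h = ≈refl
    term-cong (s ⊕ t) h = +-cong (term-cong s h) (term-cong t h)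
    term-cong (s ⊗ t) h = *-cong (term-cong s h) (term-cong t h)

    ∷-cong : ∀ {n} {ρ ρ′ : Env n} x → ρ ≗≈ ρ′ → (x ∷ᵥ ρ) ≗≈ (x ∷ᵥ ρ′)
    ∷-cong x h zero = ≈refl
    ∷-cong x h (suc i) = h i

    Sat-cong : ∀ {n} (φ : Formula n) {ρ ρ′ : Env n} → ρ ≗≈ ρ′ → Sat R φ ρ → Sat R φ ρ′
    Sat-cong (s ≐ t) h (lift e) = lift (≈trans (≈sym (term-cong s h)) (≈trans e (term-cong t h)))
    Sat-cong (¬' φ) h p q = p (Sat-cong φ (≈sym ∘ h) q)
    Sat-cong (φ ∧' ψ) h (p , q) = Sat-cong φ h p , Sat-cong ψ h q
    Sat-cong (∃' φ) h (x , p) = x , Sat-cong φ (∷-cong x h) p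

    subT : ∀ {a b} → Term a → (Fin a → Term b) → Term b
    subT (var i) σ = σ i
    subT zeroT σ = zeroT
    subT oneT σ = oneT
    subT (s ⊕ t) σ = subT s σ ⊕ subT t σ
    subT (s ⊗ t) σ = subT s σ ⊗ subT t σ

    subT-sem : ∀ {a b} (t : Term a) (σ : Fin a → Term b) ρ → ⟦_⟧ₜ R (subT t σ) ρ ≈ ⟦_⟧ₜ R t (λ i → ⟦_⟧ₜ R (σ i) ρ)
    subT-sem (var i) σ ρ = ≈refl
    subT-sem zeroT σ ρ = ≈refl
    subT-sem oneT σ ρ = ≈refl
    subT-sem (s ⊕ t) σ ρ = +-cong (subT-sem s σ ρ) (subT-sem t σ ρ)
    subT-sem (s ⊗ t) σ ρ = *-cong (subT-sem s σ ρ) (subT-sem t σ ρ)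

    shift : ∀ {b} → Fin b → Term (suc b)
    shift i = var (suc i)

    liftσ : ∀ {a b} → (Fin a → Term b) → Fin (suc a) → Term (suc b)
    liftσ σ zero = var zero
    liftσ σ (suc i) = subT (σ i) shift

    liftσ-sem : ∀ {a b} (σ : Fin a → Term b) x (ρ : Env b) → (λ i → ⟦_⟧ₜ R (liftσ σ i) (x ∷ᵥ ρ)) ≗≈ (x ∷ᵥ (λ i → ⟦_⟧ₜ R (σ i) ρ))
    liftσ-sem σ x ρ zero = ≈refl
    liftσ-sem σ x ρ (suc i) = subT-sem (σ i) shift (x ∷ᵥ ρ)

    subF : ∀ {a b} → Formula a → (Fin a → Term b) → Formula b
    subF (s ≐ t) σ = subT s σ ≐ subT t σ
    subF (¬' φ) σ = ¬' subF φ σ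
    subF (φ ∧' ψ) σ = subF φ σ ∧' subF ψ σ
    subF (∃' φ) σ = ∃' (subF φ (liftσ σ))

    subF-sem : ∀ {a b} (φ : Formula a) (σ : Fin a → Term b) ρ →
      (Sat R (subF φ σ) ρ → Sat R φ (λ i → ⟦_⟧ₜ R (σ i) ρ)) × (Sat R φ (λ i → ⟦_⟧ₜ R (σ i) ρ) → Sat R (subF φ σ) ρ)
    subF-sem (s ≐ t) σ ρ = (λ { (lift e) → lift (≈trans (≈sym (subT-sem s σ ρ)) (≈trans e (subT-sem t σ ρ))) })
      , (λ { (lift e) → lift (≈trans (subT-sem s σ ρ) (≈trans e (≈sym (subT-sem t σ ρ)))) })
    subF-sem (¬' φ) σ ρ = (λ p q → p (proj₂ (subF-sem φ σ ρ) q)) , (λ p q → p (proj₁ (subF-sem φ σ ρ) q))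
    subF-sem (φ ∧' ψ) σ ρ = (λ { (p , q) → proj₁ (subF-sem φ σ ρ) p , proj₁ (subF-sem ψ σ ρ) q })
      , (λ { (p , q) → proj₂ (subF-sem φ σ ρ) p , proj₂ (subF-sem ψ σ ρ) q })
    subF-sem (∃' φ) σ ρ = (λ { (x , p) → x , Sat-cong φ (liftσ-sem σ x ρ) (proj₁ (subF-sem φ (liftσ σ) (x ∷ᵥ ρ)) p) })
      , (λ { (x , p) → x , proj₂ (subF-sem φ (liftσ σ) (x ∷ᵥ ρ)) (Sat-cong φ (≈sym ∘ liftσ-sem σ x ρ) p) })

    -- All constants of the term lie in `L`, which becomes a tuple of parameters. The language has
    -- no subtraction, so negation is multiplication by a parameter equal to -1.
    ParT : List Carrier → ∀ {n} → Tm n → Set c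
    ParT L (var i) = ⊤
    ParT L (cst a) = a ∈ L
    ParT L (s ⊞ t) = ParT L s × ParT L t
    ParT L (s ⊠ t) = ParT L s × ParT L t
    ParT L (⊟ t) = (- 1# ∈ L) × ParT L t

    ParTs : List Carrier → ∀ {n m} → Vec (Tm n) m → Set c
    ParTs L [] = ⊤
    ParTs L (t ∷ ts) = ParT L t × ParTs L ts

    Par : List Carrier → ∀ {n} → Fm n → Set c
    Par L (s ≋ t) = ParT L s × ParT L t
    Par L (s divides t) = ParT L s × ParT L t
    Par L (∼ φ) = Par L φ
    Par L (φ ⩓ ψ) = Par L φ × Par L ψ
    Par L (φ ⩔ ψ) = Par L φ × Par L ψ
    Par L (φ ⟹ ψ) = Par L φ × Par L ψ
    Par L (All φ) = Par L φ
    Par L (Ex φ) = Par L φ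
    Par L (atom φ ts) = Par L φ × ParTs L ts
    Par L (atom↓ j φ ts) = Par L φ × ParTs L ts

    _⊆_ : List Carrier → List Carrier → Set c
    L ⊆ L′ = ∀ {a} → a ∈ L → a ∈ L′

    ParT-mono : ∀ {L L′} → L ⊆ L′ → ∀ {n} (t : Tm n) → ParT L t → ParT L′ t
    ParT-mono s (var i) h = tt
    ParT-mono s (cst a) h = s h
    ParT-mono s (t ⊞ u) (h , h′) = ParT-mono s t h , ParT-mono s u h′
    ParT-mono s (t ⊠ u) (h , h′) = ParT-mono s t h , ParT-mono s u h′
    ParT-mono s (⊟ t) (h , h′) = s h , ParT-mono s t h′

    ParTs-mono : ∀ {L L′} → L ⊆ L′ → ∀ {n m} (ts : Vec (Tm n) m) → ParTs L ts → ParTs L′ ts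
    ParTs-mono s [] h = tt
    ParTs-mono s (t ∷ ts) (h , h′) = ParT-mono s t h , ParTs-mono s ts h′

    Par-mono : ∀ {L L′} → L ⊆ L′ → ∀ {n} (φ : Fm n) → Par L φ → Par L′ φ
    Par-mono s (t ≋ u) (h , h′) = ParT-mono s t h , ParT-mono s u h′
    Par-mono s (t divides u) (h , h′) = ParT-mono s t h , ParT-mono s u h′
    Par-mono s (∼ φ) h = Par-mono s φ h
    Par-mono s (φ ⩓ ψ) (h , h′) = Par-mono s φ h , Par-mono s ψ h′
    Par-mono s (φ ⩔ ψ) (h , h′) = Par-mono s φ h , Par-mono s ψ h′
    Par-mono s (φ ⟹ ψ) (h , h′) = Par-mono s φ h , Par-mono s ψ h′
    Par-mono s (All φ) h = Par-mono s φ h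
    Par-mono s (Ex φ) h = Par-mono s φ h
    Par-mono s (atom φ ts) (h , h′) = Par-mono s φ h , ParTs-mono s ts h′
    Par-mono s (atom↓ j φ ts) (h , h′) = Par-mono s φ h , ParTs-mono s ts h′

    merge : ∀ {P Q : List Carrier → Set c} → (∀ {L L′} → L ⊆ L′ → P L → P L′) → (∀ {L L′} → L ⊆ L′ → Q L → Q L′) →
      Σ (List Carrier) P → Σ (List Carrier) Q → Σ (List Carrier) λ L → P L × Q L
    merge mP mQ (L , p) (L′ , q) = L ++ L′ , mP ∈-++⁺ˡ p , mQ (∈-++⁺ʳ L) q

    parT : ∀ {n} (t : Tm n) → Σ (List Carrier) λ L → ParT L t
    parT (var i) = [] , tt
    parT (cst a) = a ∷ [] , here ≡.refl
    parT (s ⊞ t) = merge (λ i → ParT-mono i s) (λ i → ParT-mono i t) (parT s) (parT t)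
    parT (s ⊠ t) = merge (λ i → ParT-mono i s) (λ i → ParT-mono i t) (parT s) (parT t)
    parT (⊟ t) with parT t
    ... | L , h = - 1# ∷ L , here ≡.refl , ParT-mono there t h

    parTs : ∀ {n m} (ts : Vec (Tm n) m) → Σ (List Carrier) λ L → ParTs L ts
    parTs [] = [] , tt
    parTs (t ∷ ts) = merge (λ i → ParT-mono i t) (λ i → ParTs-mono i ts) (parT t) (parTs ts)

    par : ∀ {n} (φ : Fm n) → Σ (List Carrier) λ L → Par L φ
    par (s ≋ t) = merge (λ i → ParT-mono i s) (λ i → ParT-mono i t) (parT s) (parT t)
    par (s divides t) = merge (λ i → ParT-mono i s) (λ i → ParT-mono i t) (parT s) (parT t)
    par (∼ φ) = par φ
    par (φ ⩓ ψ) = merge (λ i → Par-mono i φ) (λ i → Par-mono i ψ) (par φ) (par ψ)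
    par (φ ⩔ ψ) = merge (λ i → Par-mono i φ) (λ i → Par-mono i ψ) (par φ) (par ψ)
    par (φ ⟹ ψ) = merge (λ i → Par-mono i φ) (λ i → Par-mono i ψ) (par φ) (par ψ)
    par (All φ) = par φ
    par (Ex φ) = par φ
    par (atom φ ts) = merge (λ i → Par-mono i φ) (λ i → ParTs-mono i ts) (par φ) (parTs ts)
    par (atom↓ j φ ts) = merge (λ i → Par-mono i φ) (λ i → ParTs-mono i ts) (par φ) (parTs ts)

    module Translation (L : List Carrier) where

      k = length L

      env : ∀ {n} → Vec Carrier n → Env (n ℕ.+ k)
      env [] i = List.lookup L i
      env (x ∷ ρ) = x ∷ᵥ env ρ

      inl : ∀ {n} → Fin n → Fin (n ℕ.+ k)
      inl i = i Fin.↑ˡ k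

      inr : ∀ n → Fin k → Fin (n ℕ.+ k)
      inr n i = n Fin.↑ʳ i

      env-inl : ∀ {n} (ρ : Vec Carrier n) i → env ρ (inl i) ≡ lookup ρ i
      env-inl (x ∷ ρ) zero = ≡.refl
      env-inl (x ∷ ρ) (suc i) = env-inl ρ i

      env-inr : ∀ {n} (ρ : Vec Carrier n) i → env ρ (inr n i) ≡ List.lookup L i
      env-inr [] i = ≡.refl
      env-inr (x ∷ ρ) i = env-inr ρ i

      param : ∀ {n a} → a ∈ L → Term (n ℕ.+ k)
      param {n} h = var (inr n (index h))

      param-sem : ∀ {n a} (h : a ∈ L) (ρ : Vec Carrier n) → env ρ (inr n (index h)) ≡ a
      param-sem h ρ = ≡.trans (env-inr ρ (index h)) (≡.sym (Anyₚ.lookup-index h))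

      trT : ∀ {n} (t : Tm n) → ParT L t → Term (n ℕ.+ k)
      trT (var i) h = var (inl i)
      trT (cst a) h = param h
      trT (s ⊞ t) (h , h′) = trT s h ⊕ trT t h′
      trT (s ⊠ t) (h , h′) = trT s h ⊗ trT t h′
      trT (⊟ t) (h , h′) = param h ⊗ trT t h′

      trT-sem : ∀ {n} (t : Tm n) (h : ParT L t) ρ → ⟦_⟧ₜ R (trT t h) (env ρ) ≈ ⟦ t ⟧ᵗ ρ
      trT-sem (var i) h ρ = reflexive (env-inl ρ i)
      trT-sem (cst a) h ρ = reflexive (param-sem h ρ)
      trT-sem (s ⊞ t) (h , h′) ρ = +-cong (trT-sem s h ρ) (trT-sem t h′ ρ)
      trT-sem (s ⊠ t) (h , h′) ρ = *-cong (trT-sem s h ρ) (trT-sem t h′ ρ)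
      trT-sem (⊟ t) (h , h′) ρ = ≈trans (*-cong (reflexive (param-sem h ρ)) (trT-sem t h′ ρ)) (-1*x≈-x _)

      substitution : ∀ {n m} (ts : Vec (Tm n) m) → ParTs L ts → Fin (m ℕ.+ k) → Term (n ℕ.+ k)
      substitution {n} [] h i = var (inr n i)
      substitution (t ∷ ts) (h , h′) zero = trT t h
      substitution (t ∷ ts) (h , h′) (suc i) = substitution ts h′ i

      substitution-sem : ∀ {n m} (ts : Vec (Tm n) m) (h : ParTs L ts) ρ →
        (λ i → ⟦_⟧ₜ R (substitution ts h i) (env ρ)) ≗≈ env (⟦ ts ⟧ᵗˢ ρ)
      substitution-sem [] h ρ i = reflexive (env-inr ρ i)
      substitution-sem (t ∷ ts) (h , h′) ρ zero = trT-sem t h ρ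
      substitution-sem (t ∷ ts) (h , h′) ρ (suc i) = substitution-sem ts h′ ρ i

      shiftBy : ∀ j {k′} → Fin (k′ ℕ.+ k) → Fin ((j ℕ.+ k′) ℕ.+ k)
      shiftBy zero i = i
      shiftBy (suc j) i = suc (shiftBy j i)

      env-shiftBy : ∀ j {k′} (ρ : Vec Carrier (j ℕ.+ k′)) i → env ρ (shiftBy j i) ≡ env (dropᵛ j ρ) i
      env-shiftBy zero ρ i = ≡.refl
      env-shiftBy (suc j) (x ∷ ρ) i = env-shiftBy j ρ i

      substitution↓ : ∀ j {k′ m} (ts : Vec (Tm (j ℕ.+ k′)) m) → ParTs L ts → Fin ((m ℕ.+ k′) ℕ.+ k) → Term ((j ℕ.+ k′) ℕ.+ k)
      substitution↓ j [] h i = var (shiftBy j i)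
      substitution↓ j (t ∷ ts) (h , h′) zero = trT t h
      substitution↓ j (t ∷ ts) (h , h′) (suc i) = substitution↓ j ts h′ i

      substitution↓-sem : ∀ j {k′ m} (ts : Vec (Tm (j ℕ.+ k′)) m) (h : ParTs L ts) ρ →
        (λ i → ⟦_⟧ₜ R (substitution↓ j ts h i) (env ρ)) ≗≈ env (⟦ ts ⟧ᵗˢ ρ Vec.++ dropᵛ j ρ)
      substitution↓-sem j [] h ρ i = reflexive (env-shiftBy j ρ i)
      substitution↓-sem j (t ∷ ts) (h , h′) ρ zero = trT-sem t h ρ
      substitution↓-sem j (t ∷ ts) (h , h′) ρ (suc i) = substitution↓-sem j ts h′ ρ i

      tr : ∀ {n} (φ : Fm n) → Par L φ → Formula (n ℕ.+ k)
      tr (s ≋ t) (h , h′) = trT s h ≐ trT t h′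
      tr (s divides t) (h , h′) = ∃' (subT (trT t h′) shift ≐ (subT (trT s h) shift ⊗ var zero))
      tr (∼ φ) h = ¬' tr φ h
      tr (φ ⩓ ψ) (h , h′) = tr φ h ∧' tr ψ h′
      tr (φ ⩔ ψ) (h , h′) = ¬' ((¬' tr φ h) ∧' (¬' tr ψ h′))
      tr (φ ⟹ ψ) (h , h′) = ¬' (tr φ h ∧' (¬' tr ψ h′))
      tr (All φ) h = ¬' ∃' (¬' tr φ h)
      tr (Ex φ) h = ∃' (tr φ h)
      tr (atom φ ts) (h , h′) = subF (tr φ h) (substitution ts h′)
      tr (atom↓ j φ ts) (h , h′) = subF (tr φ h) (substitution↓ j ts h′)

      module _ (em : ExcludedMiddle (c ⊔ ℓ)) where

        mutual
          tr-sound : ∀ {n} (φ : Fm n) (h : Par L φ) ρ → Sat R (tr φ h) (env ρ) → ⟦ φ ⟧ ρ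
          tr-sound (s ≋ t) (h , h′) ρ (lift e) = lift (≈trans (≈sym (trT-sem s h ρ)) (≈trans e (trT-sem t h′ ρ)))
          tr-sound (s divides t) (h , h′) ρ (q , lift e) = q ,
            ≈trans (≈sym (≈trans (subT-sem (trT t h′) shift _) (trT-sem t h′ ρ)))
              (≈trans e (*-congʳ (≈trans (subT-sem (trT s h) shift _) (trT-sem s h ρ))))
          tr-sound (∼ φ) h ρ p q = p (tr-complete φ h ρ q)
          tr-sound (φ ⩓ ψ) (h , h′) ρ (p , q) = tr-sound φ h ρ p , tr-sound ψ h′ ρ q
          tr-sound (φ ⩔ ψ) (h , h′) ρ p = stable em (λ n → p ((λ a → n (inj₁ (tr-sound φ h ρ a))) , (λ b → n (inj₂ (tr-sound ψ h′ ρ b)))))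
          tr-sound (φ ⟹ ψ) (h , h′) ρ p q = stable em (λ n → p (tr-complete φ h ρ q , λ b → n (tr-sound ψ h′ ρ b)))
          tr-sound (All φ) h ρ p x = stable em (λ n → p (x , λ a → n (tr-sound φ h (x ∷ ρ) a)))
          tr-sound (Ex φ) h ρ (x , p) = x , tr-sound φ h (x ∷ ρ) p
          tr-sound (atom φ ts) (h , h′) ρ p = tr-sound φ h _
            (Sat-cong (tr φ h) (substitution-sem ts h′ ρ) (proj₁ (subF-sem (tr φ h) (substitution ts h′) (env ρ)) p))
          tr-sound (atom↓ j φ ts) (h , h′) ρ p = tr-sound φ h _
            (Sat-cong (tr φ h) (substitution↓-sem j ts h′ ρ) (proj₁ (subF-sem (tr φ h) (substitution↓ j ts h′) (env ρ)) p))

          tr-complete : ∀ {n} (φ : Fm n) (h : Par L φ) ρ → ⟦ φ ⟧ ρ → Sat R (tr φ h) (env ρ)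
          tr-complete (s ≋ t) (h , h′) ρ (lift e) = lift (≈trans (trT-sem s h ρ) (≈trans e (≈sym (trT-sem t h′ ρ))))
          tr-complete (s divides t) (h , h′) ρ (q , e) = q , lift
            (≈trans (≈trans (subT-sem (trT t h′) shift _) (trT-sem t h′ ρ))
              (≈trans e (*-congʳ (≈sym (≈trans (subT-sem (trT s h) shift _) (trT-sem s h ρ))))))
          tr-complete (∼ φ) h ρ p q = p (tr-sound φ h ρ q)
          tr-complete (φ ⩓ ψ) (h , h′) ρ (p , q) = tr-complete φ h ρ p , tr-complete ψ h′ ρ q
          tr-complete (φ ⩔ ψ) (h , h′) ρ (inj₁ p) (n , _) = n (tr-complete φ h ρ p)
          tr-complete (φ ⩔ ψ) (h , h′) ρ (inj₂ p) (_ , n) = n (tr-complete ψ h′ ρ p)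
          tr-complete (φ ⟹ ψ) (h , h′) ρ p (q , n) = n (tr-complete ψ h′ ρ (p (tr-sound φ h ρ q)))
          tr-complete (All φ) h ρ p (x , n) = n (tr-complete φ h (x ∷ ρ) (p x))
          tr-complete (Ex φ) h ρ (x , p) = x , tr-complete φ h (x ∷ ρ) p
          tr-complete (atom φ ts) (h , h′) ρ p = proj₂ (subF-sem (tr φ h) (substitution ts h′) (env ρ))
            (Sat-cong (tr φ h) (≈sym ∘ substitution-sem ts h′ ρ) (tr-complete φ h _ p))
          tr-complete (atom↓ j φ ts) (h , h′) ρ p = proj₂ (subF-sem (tr φ h) (substitution↓ j ts h′) (env ρ))
            (Sat-cong (tr φ h) (≈sym ∘ substitution↓-sem j ts h′ ρ) (tr-complete φ h _ p))

  module _ (em : ExcludedMiddle (c ⊔ ℓ)) where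

    private
      env-cong : ∀ L {n} {ρ ρ′ : Vec Carrier n} → Pointwise _≈_ ρ ρ′ → Translation.env L ρ ≗≈ Translation.env L ρ′
      env-cong L [] i = ≈refl
      env-cong L (e ∷ h) zero = e
      env-cong L (e ∷ h) (suc i) = env-cong L h i

    abstract
      -- Invariance under ≈ is proved once for all definable sets, through the translated formulas,
      -- whose atoms are equations.
      resp : ∀ {n} (φ : Fm n) {ρ ρ′} → Pointwise _≈_ ρ ρ′ → ⟦ φ ⟧ ρ → ⟦ φ ⟧ ρ′
      resp φ {ρ} {ρ′} e p = tr-sound em φ h ρ′ (Sat-cong (tr φ h) (env-cong L e) (tr-complete em φ h ρ p))
        where
        L : List Carrier
        L = proj₁ (par φ)
        h : Par L φ
        h = proj₂ (par φ)
        open Translation L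

      -- The constants of `φ` and `ψ` are shared by all rows and all columns, so after translation
      -- they only lengthen the parameter tuples. The bound holds uniformly in `a` and `b`.
      no-pattern : DPMinimal R → ∀ {k l} (φ : Fm (suc k)) (ψ : Fm (suc l)) → Σ ℕ λ K →
        (a : Fin K → Vec Carrier k) (b : Fin K → Vec Carrier l) →
        ¬ (∀ i j → Σ Carrier λ x → (∀ i′ → ⟦ φ ⟧ (x ∷ a i′) ⇔ (i′ ≡ i)) × (∀ j′ → ⟦ ψ ⟧ (x ∷ b j′) ⇔ (j′ ≡ j)))
      no-pattern dp φ ψ = proj₁ bound , λ a b pat → proj₂ bound ((λ i → A.env (a i)) , (λ j → B.env (b j)) ,
          λ i j → proj₁ (pat i j) ,
            (λ i′ → mk⇔ (λ s → Equivalence.to (proj₁ (proj₂ (pat i j)) i′) (A.tr-sound em φ h _ s))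
                        (λ e → A.tr-complete em φ h _ (Equivalence.from (proj₁ (proj₂ (pat i j)) i′) e))) ,
            (λ j′ → mk⇔ (λ s → Equivalence.to (proj₂ (proj₂ (pat i j)) j′) (B.tr-sound em ψ g _ s))
                        (λ e → B.tr-complete em ψ g _ (Equivalence.from (proj₂ (proj₂ (pat i j)) j′) e))))
        where
        h : Par (proj₁ (par φ)) φ
        h = proj₂ (par φ)
        g : Par (proj₁ (par ψ)) ψ
        g = proj₂ (par ψ)
        module A = Translation (proj₁ (par φ))
        module B = Translation (proj₁ (par ψ))
        bound : ∃ λ (N : ℕ) → ¬ ICTPattern R (A.tr φ h) (B.tr ψ g) N
        bound = dp (A.tr φ h) (B.tr ψ g)

-- Divisibility in commutative rings and domains

module Divisibility {c ℓ} (R : CommutativeRing c ℓ) where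
  open CommutativeRing R hiding (zero) renaming (Carrier to C; refl to ≈refl; sym to ≈sym; trans to ≈trans) public
  open IntegerSolver R public
  open import Algebra.Properties.Ring ring using (-‿distribˡ-*; -‿distribʳ-*; -0#≈0#; +-cancelˡ; +-cancelʳ; -‿involutive) public

  infix 4 _∣_ _∤_
  infixr 8 _^_

  _∣_ : C → C → Set (c ⊔ ℓ)
  _∣_ = Defs._∣_ R

  _∤_ : C → C → Set (c ⊔ ℓ)
  a ∤ b = ¬ (a ∣ b)

  _^_ : C → ℕ → C
  _^_ = Defs._^_ R

  Unit : C → Set (c ⊔ ℓ)
  Unit = IsUnit R

  -- Equations are derived from equational hypotheses by exhibiting the difference of the two sides
  -- as a combination of the hypotheses; nothing is subtracted, so that the certificate is a ring identity.
  lin₁ : ∀ {x y l r} → l ≈ r → ∀ k → x + k * r ≈ y + k * l → x ≈ y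
  lin₁ {x} {y} {l} {r} h k id = +-cancelʳ (k * r) x y (≈trans id (+-congˡ (*-congˡ h)))

  lin₂ : ∀ {x y l r l′ r′} → l ≈ r → ∀ k → l′ ≈ r′ → ∀ k′ → x + (k * r + k′ * r′) ≈ y + (k * l + k′ * l′) → x ≈ y
  lin₂ h k h′ k′ id = +-cancelʳ _ _ _ (≈trans id (+-congˡ (+-cong (*-congˡ h) (*-congˡ h′))))

  ∣-refl : ∀ {a} → a ∣ a
  ∣-refl = 1# , ≈sym (*-identityʳ _)

  ∣-trans : ∀ {a b d} → a ∣ b → b ∣ d → a ∣ d
  ∣-trans (q , e) (r , f) = q * r , ≈trans f (≈trans (*-congʳ e) (*-assoc _ _ _))

  ∣-resp : ∀ {a a′ b b′} → a ≈ a′ → b ≈ b′ → a ∣ b → a′ ∣ b′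
  ∣-resp e f (q , g) = q , ≈trans (≈sym f) (≈trans g (*-congʳ e))

  ∣-respʳ : ∀ {a b b′} → b ≈ b′ → a ∣ b → a ∣ b′
  ∣-respʳ = ∣-resp ≈refl

  ∣-+ : ∀ {a b d} → a ∣ b → a ∣ d → a ∣ b + d
  ∣-+ (q , e) (r , f) = q + r , ≈trans (+-cong e f) (≈sym (distribˡ _ _ _))

  ∣-neg : ∀ {a b} → a ∣ b → a ∣ - b
  ∣-neg (q , e) = - q , ≈trans (-‿cong e) (-‿distribʳ-* _ _)

  ∣-minus : ∀ {a b d} → a ∣ b → a ∣ d → a ∣ b - d
  ∣-minus h g = ∣-+ h (∣-neg g)

  ∣-*ʳ : ∀ {a b} d → a ∣ b → a ∣ b * d
  ∣-*ʳ d (q , e) = q * d , ≈trans (*-congʳ e) (*-assoc _ _ _)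

  ∣-*ˡ : ∀ {a b} d → a ∣ b → a ∣ d * b
  ∣-*ˡ d h = ∣-respʳ (*-comm _ _) (∣-*ʳ d h)

  a∣a*b : ∀ a b → a ∣ a * b
  a∣a*b a b = b , ≈refl

  a∣b*a : ∀ a b → a ∣ b * a
  a∣b*a a b = b , *-comm _ _

  ∣0 : ∀ a → a ∣ 0#
  ∣0 a = 0# , ≈sym (zeroʳ a)

  1∣ : ∀ a → 1# ∣ a
  1∣ a = a , ≈sym (*-identityˡ a)

  *-mono-∣ : ∀ {a b a′ b′} → a ∣ b → a′ ∣ b′ → a * a′ ∣ b * b′
  *-mono-∣ {a} {b} {a′} {b′} (q , e) (r , f) = q * r , ≈trans (*-cong e f)
    (solve 4 (λ a a′ q r → (a :* q) :* (a′ :* r) := (a :* a′) :* (q :* r)) ≈refl a a′ q r)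

  x-z≈ : ∀ x y z → x - z ≈ (x - y) + (y - z)
  x-z≈ = solve 3 (λ x y z → x :- z := (x :- y) :+ (y :- z)) ≈refl

  neg-swap : ∀ x y → - (x - y) ≈ y - x
  neg-swap = solve 2 (λ x y → :- (x :- y) := y :- x) ≈refl

  x-x≈0 : ∀ x → x - x ≈ 0#
  x-x≈0 = -‿inverseʳ

  minus-cong : ∀ {a b a′ b′} → a ≈ a′ → b ≈ b′ → a - b ≈ a′ - b′
  minus-cong e f = +-cong e (-‿cong f)

  ≈⇒-≈0 : ∀ {x y} → x ≈ y → x - y ≈ 0#
  ≈⇒-≈0 {x} {y} e = ≈trans (minus-cong e ≈refl) (x-x≈0 y)

  -≈0⇒≈ : ∀ {x y} → x - y ≈ 0# → x ≈ y
  -≈0⇒≈ {x} {y} e = lin₁ e 1# (solve 2 (λ x y → x :+ con (+ 1) :* con (+ 0) := y :+ con (+ 1) :* (x :- y)) ≈refl x y)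

  ^-cong : ∀ {x y} n → x ≈ y → x ^ n ≈ y ^ n
  ^-cong zero e = ≈refl
  ^-cong (suc n) e = *-cong e (^-cong n e)

  ^-+ : ∀ x m n → x ^ (m ℕ.+ n) ≈ x ^ m * x ^ n
  ^-+ x zero n = ≈sym (*-identityˡ _)
  ^-+ x (suc m) n = ≈trans (*-congˡ (^-+ x m n)) (≈sym (*-assoc _ _ _))

  ^-*-distrib : ∀ x y n → (x * y) ^ n ≈ x ^ n * y ^ n
  ^-*-distrib x y zero = ≈sym (*-identityˡ _)
  ^-*-distrib x y (suc n) = ≈trans (*-congˡ (^-*-distrib x y n))
    (solve 4 (λ x y p q → (x :* y) :* (p :* q) := (x :* p) :* (y :* q)) ≈refl x y (x ^ n) (y ^ n))

  ^-* : ∀ x m n → x ^ (m ℕ.* n) ≈ (x ^ n) ^ m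
  ^-* x zero n = ≈refl
  ^-* x (suc m) n = ≈trans (^-+ x n (m ℕ.* n)) (*-congˡ (^-* x m n))

  1^ : ∀ n → 1# ^ n ≈ 1#
  1^ zero = ≈refl
  1^ (suc n) = ≈trans (*-identityˡ _) (1^ n)

  ^-mono-∣ : ∀ {x y} n → x ∣ y → x ^ n ∣ y ^ n
  ^-mono-∣ zero h = ∣-refl
  ^-mono-∣ (suc n) h = *-mono-∣ h (^-mono-∣ n h)

  ^-≤-∣ : ∀ x {m n} → m ℕ.≤ n → x ^ m ∣ x ^ n
  ^-≤-∣ x {m} {n} le = x ^ (n ℕ.∸ m) , ≈trans (reflexive (≡.cong (x ^_) (≡.sym (ℕₚ.m+[n∸m]≡n le)))) (^-+ x m _)

  Unit-resp : ∀ {x y} → x ≈ y → Unit x → Unit y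
  Unit-resp e (u , f) = u , ≈trans (*-congʳ (≈sym e)) f

  Unit⇒∣ : ∀ {x} y → Unit x → x ∣ y
  Unit⇒∣ {x} y (u , e) = u * y , ≈trans (≈sym (*-identityˡ y)) (≈trans (*-congʳ (≈sym e)) (*-assoc _ _ _))

  ∣Unit : ∀ {x y} → x ∣ y → Unit y → Unit x
  ∣Unit {x} {y} (q , e) (u , f) = q * u , ≈trans (≈sym (*-assoc _ _ _)) (≈trans (*-congʳ (≈sym e)) f)

  Unit-* : ∀ {x y} → Unit x → Unit y → Unit (x * y)
  Unit-* {x} {y} (u , e) (v , f) = u * v , ≈trans (solve 4 (λ x y u v → (x :* y) :* (u :* v) := (x :* u) :* (y :* v)) ≈refl x y u v)
    (≈trans (*-cong e f) (*-identityˡ _))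

  Unit-1 : Unit 1#
  Unit-1 = 1# , *-identityˡ _

  Unit-neg : ∀ {x} → Unit x → Unit (- x)
  Unit-neg {x} (u , e) = - u , ≈trans (solve 2 (λ x u → (:- x) :* (:- u) := x :* u) ≈refl x u) e

  Mod : (C → Set (c ⊔ ℓ)) → C → C → Set (c ⊔ ℓ)
  Mod P x y = P (x - y)

  record Subgroup (P : C → Set (c ⊔ ℓ)) : Set (c ⊔ ℓ) where
    field
      P-resp : ∀ {x y} → x ≈ y → P x → P y
      P-0 : P 0#
      P-minus : ∀ {x y} → P x → P y → P (x - y)

    P-neg : ∀ {x} → P x → P (- x)
    P-neg p = P-resp (+-identityˡ _) (P-minus P-0 p)

    P-+ : ∀ {x y} → P x → P y → P (x + y)
    P-+ p q = P-resp (+-congˡ (-‿involutive _)) (P-minus p (P-neg q))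

    Mod-sym : ∀ {x y} → Mod P x y → Mod P y x
    Mod-sym p = P-resp (neg-swap _ _) (P-neg p)

    Mod-trans : ∀ {x y z} → Mod P x y → Mod P y z → Mod P x z
    Mod-trans p q = P-resp (≈sym (x-z≈ _ _ _)) (P-+ p q)

  ∣-subgroup : ∀ e → Subgroup (e ∣_)
  ∣-subgroup e = record { P-resp = ∣-respʳ ; P-0 = ∣0 e ; P-minus = ∣-minus }

  module Domain (em : ExcludedMiddle (c ⊔ ℓ)) (dom : IntegralDomain R) where

    _≈?_ : ∀ x y → Dec (x ≈ y)
    x ≈? y = em-lower {p = ℓ} {x = c} em

    1≉0 : 1# ≉ 0#
    1≉0 = proj₁ dom

    *-cancelˡ : ∀ {a x y} → a ≉ 0# → a * x ≈ a * y → x ≈ y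
    *-cancelˡ {a} {x} {y} a≉0 e with proj₂ dom a (x - y)
      (lin₁ e 1# (solve 3 (λ a x y → a :* (x :- y) :+ con (+ 1) :* (a :* y) := con (+ 0) :+ con (+ 1) :* (a :* x)) ≈refl a x y))
    ... | inj₁ h = contradiction h a≉0
    ... | inj₂ h = -≈0⇒≈ h

    *-≉0 : ∀ {a b} → a ≉ 0# → b ≉ 0# → a * b ≉ 0#
    *-≉0 p q e with proj₂ dom _ _ e
    ... | inj₁ h = p h
    ... | inj₂ h = q h

    ^-≉0 : ∀ {a} n → a ≉ 0# → a ^ n ≉ 0#
    ^-≉0 zero p = 1≉0
    ^-≉0 (suc n) p = *-≉0 p (^-≉0 n p)

    ∣-cancelˡ : ∀ {a x y} → a ≉ 0# → a * x ∣ a * y → x ∣ y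
    ∣-cancelˡ a≉0 (q , e) = q , *-cancelˡ a≉0 (≈trans e (*-assoc _ _ _))

    ∣-≉0 : ∀ {a b} → a ∣ b → b ≉ 0# → a ≉ 0#
    ∣-≉0 (q , e) n a0 = n (≈trans e (≈trans (*-congʳ a0) (zeroˡ q)))

    *≉0ˡ : ∀ {a b} → a * b ≉ 0# → a ≉ 0#
    *≉0ˡ n a0 = n (≈trans (*-congʳ a0) (zeroˡ _))

    *≉0ʳ : ∀ {a b} → a * b ≉ 0# → b ≉ 0#
    *≉0ʳ n b0 = n (≈trans (*-congˡ b0) (zeroʳ _))

    Unit-≉0 : ∀ {x} → Unit x → x ≉ 0#
    Unit-≉0 (u , e) x0 = 1≉0 (≈trans (≈sym e) (≈trans (*-congʳ x0) (zeroˡ u)))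

    nonunit-∤1 : ∀ {w} → ¬ Unit w → w ∤ 1#
    nonunit-∤1 n (q , e) = n (q , ≈sym e)

    -- After cancelling w^i, the element w would divide 1 minus a multiple of w, hence 1. Powers of
    -- a nonzero non-unit are the standard supply of elements that are apart.
    powers-∤ : ∀ {w} → w ≉ 0# → ¬ Unit w → ∀ {i j K} → i ℕ.< j → i ℕ.< K → w ^ K ∤ w ^ i - w ^ j
    powers-∤ {w} w≉0 nu {i} {j} {K} lt lt′ h =
      nonunit-∤1 nu (∣-respʳ (solve 2 (λ w p → (con (+ 1) :- w :* p) :+ w :* p := con (+ 1)) ≈refl w (w ^ d))
        (∣-+ (∣-cancelˡ (^-≉0 i w≉0) (∣-resp (*-comm _ _) split (∣-trans (^-≤-∣ w lt′) h))) (a∣a*b w (w ^ d))))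
      where
      d = j ℕ.∸ suc i
      eq : w ^ j ≈ w ^ i * (w * w ^ d)
      eq = ≈trans (reflexive (≡.cong (w ^_) (≡.trans (≡.sym (ℕₚ.m+[n∸m]≡n lt)) (≡.sym (ℕₚ.+-suc i d))))) (^-+ w i (suc d))
      split : w ^ i - w ^ j ≈ w ^ i * (1# - w * w ^ d)
      split = ≈trans (minus-cong ≈refl eq) (solve 2 (λ p q → p :- p :* q := p :* (con (+ 1) :- q)) ≈refl (w ^ i) (w * w ^ d))

    powers-apart : ∀ {w} → w ≉ 0# → ¬ Unit w → ∀ K → Apart (Mod (w ^ K ∣_)) (λ (i : Fin K) → w ^ toℕ i)
    powers-apart {w} w≉0 nu K i j ne h with ℕₚ.<-cmp (toℕ i) (toℕ j)
    ... | tri≈ _ eq _ = ne (Finₚ.toℕ-injective eq)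
    ... | tri< lt _ _ = powers-∤ w≉0 nu lt (Finₚ.toℕ<n i) h
    ... | tri> _ _ gt = powers-∤ w≉0 nu gt (Finₚ.toℕ<n j) (∣-respʳ (neg-swap _ _) (∣-neg h))

-- Definable subgroups of dp-minimal domains

module DPMinimalDomain {c ℓ} (R : CommutativeRing c ℓ) (em : ExcludedMiddle (c ⊔ ℓ))
    (dom : IntegralDomain R) (dp : DPMinimal R) where
  open Divisibility R public
  open Domain em dom public
  open DefinableSets R public

  resp≈ : ∀ {n} (φ : Fm n) {ρ ρ′} → Pointwise _≈_ ρ ρ′ → ⟦ φ ⟧ ρ → ⟦ φ ⟧ ρ′
  resp≈ = resp em

  ≈ᵛ-refl : ∀ {n} {ρ : Vec C n} → Pointwise _≈_ ρ ρ
  ≈ᵛ-refl = Pointwise.refl ≈refl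

  _[_] : ∀ {k} → Fm (suc k) → Vec C k → C → Set (c ⊔ ℓ)
  (φ [ α ]) x = ⟦ φ ⟧ (x ∷ α)

  -- The sum r i + s j lies in the coset of `A` through r i and in the coset of `B` through s j, and
  -- in none of the others. So one of any two definable subgroups has bounded index over their
  -- intersection.
  no-grid : ∀ {k l} (A : Fm (suc k)) (B : Fm (suc l)) → Σ ℕ λ K → ∀ α β → Subgroup (A [ α ]) → Subgroup (B [ β ]) →
    (r s : Fin K → C) → (∀ i → (B [ β ]) (r i)) → Apart (Mod (A [ α ])) r → (∀ j → (A [ α ]) (s j)) → ¬ Apart (Mod (B [ β ])) s
  no-grid {k} {l} A B = proj₁ bound , λ α β SA SB r s rB rA sA sB →
    let module SA = Subgroup SA
        module SB = Subgroup SB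
    in proj₂ bound (λ i → r i ∷ α) (λ j → s j ∷ β) λ i j → r i + s j ,
      (λ i′ → mk⇔ (λ h → row SA r s sA rA i j i′ h)
        (λ { ≡.refl → SA.P-resp (solve 2 (λ x y → y := (x :+ y) :- x) ≈refl (r i) (s j)) (sA j) })) ,
      (λ j′ → mk⇔ (λ h → row SB s r rB sB j i j′ (SB.P-resp (+-congʳ (+-comm _ _)) h))
        (λ { ≡.refl → SB.P-resp (solve 2 (λ x y → x := (x :+ y) :- y) ≈refl (r i) (s j)) (rB i) }))
    where
    coset : ∀ {k} → Fm (suc k) → Fm (2 ℕ.+ k)
    coset φ = atom↓ 2 φ ((v₀ ⊟′ v₁) ∷ [])
    bound = no-pattern em dp (coset A) (coset B)
    row : ∀ {P} → Subgroup P → (r s : Fin (proj₁ bound) → C) → (∀ j → P (s j)) → Apart (Mod P) r →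
      ∀ i j i′ → P ((r i + s j) - r i′) → i′ ≡ i
    row S r s sP rP i j i′ h with i′ Fin.≟ i
    ... | yes eq = eq
    ... | no ne = contradiction (P-resp (solve 3 (λ x y z → y :- ((z :+ y) :- x) := x :- z) ≈refl (r i′) (s j) (r i)) (P-minus (sP j) h)) (rP i′ i ne)
      where open Subgroup S

  BoundedIndex : ℕ → (C → Set (c ⊔ ℓ)) → Set (c ⊔ ℓ)
  BoundedIndex m P = ∀ (f : Fin (suc m) → C) → ¬ Apart (Mod P) f

  -- Keeping n classes after one intersection with a subgroup of index at most m takes m n + 1
  -- classes before it; `large-⋂` iterates this K times.
  required : ℕ → ℕ → ℕ → ℕ
  required m zero n = n
  required m (suc K) n = required m K (suc (m ℕ.* n))

  module _ (e : C) where

    Large : (C → Set (c ⊔ ℓ)) → ℕ → Set (c ⊔ ℓ)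
    Large P n = Σ (Fin n → C) λ f → (∀ i → P (f i)) × Apart (Mod (e ∣_)) f

    -- Each element is coded by its coset of `Q` and by the class modulo e of its difference to the
    -- coset representative, which lies in both groups. If the intersection had no n classes, two of
    -- the m n + 1 elements would share a code and so agree modulo e.
    large-∩ : ∀ {P Q m} → Subgroup P → Subgroup Q → BoundedIndex m Q → ∀ n → Large P (suc (m ℕ.* n)) → Large (λ x → P x × Q x) n
    large-∩ {P} {Q} {m} SP SQ bd n (f , f-P , f-apart) with em {Σ (Fin n → C) λ f → (∀ i → P (f i) × Q (f i)) × Apart (Mod (e ∣_)) f}
    ... | yes w = w
    ... | no w = ⊥-elim (hole-contra (Finₚ.pigeonhole (s≤s (ℕₚ.*-mono-≤ (proj₁ (proj₂ reps′)) (proj₁ (proj₂ reps)))) code))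
      where
      module SP = Subgroup SP
      module SQ = Subgroup SQ
      module Se = Subgroup (∣-subgroup e)
      X = Σ C λ x → P x × Q x
      reps : Σ ℕ λ k → k ℕ.≤ n × Σ (Fin k → X) λ f → _ × (∀ y → ∃ λ i → e ∣ proj₁ (f i) - proj₁ y)
      reps = representatives (λ (x y : X) → e ∣ proj₁ x - proj₁ y) Se.Mod-sym em n
        (λ f af → w ((λ i → proj₁ (f (Fin.inject₁ i))) , (λ i → proj₂ (f (Fin.inject₁ i))) ,
          λ i j ne → af _ _ (ne ∘ Finₚ.inject₁-injective)))
      reps′ : Σ ℕ λ k → k ℕ.≤ m × Σ (Fin k → Σ C P) λ f → _ × (∀ y → ∃ λ i → Q (proj₁ (f i) - proj₁ y))
      reps′ = representatives (λ (x y : Σ C P) → Q (proj₁ x - proj₁ y)) SQ.Mod-sym em m (λ f af → bd (proj₁ ∘ f) af)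
      k = proj₁ reps
      k′ = proj₁ reps′
      g = proj₁ (proj₂ (proj₂ reps))
      g′ = proj₁ (proj₂ (proj₂ reps′))
      N = suc (m ℕ.* n)
      first : Fin N → Fin k′
      first i = proj₁ (proj₂ (proj₂ (proj₂ (proj₂ reps′))) (f i , f-P i))
      first-Q : ∀ i → Q (proj₁ (g′ (first i)) - f i)
      first-Q i = proj₂ (proj₂ (proj₂ (proj₂ (proj₂ reps′))) (f i , f-P i))
      second : ∀ i → Σ (Fin k) λ j → e ∣ proj₁ (g j) - (proj₁ (g′ (first i)) - f i)
      second i = proj₂ (proj₂ (proj₂ (proj₂ reps))) (_ , SP.P-minus (proj₂ (g′ (first i))) (f-P i) , first-Q i)
      code : Fin N → Fin (k′ ℕ.* k)
      code i = Fin.combine {k′} {k} (first i) (proj₁ (second i))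
      hole-contra : ¬ (∃ λ i → ∃ λ j → i Fin.< j × code i ≡ code j)
      hole-contra (i , j , i<j , eq) = f-apart i j (Finₚ.<⇒≢ i<j) (∣-respʳ (lemma _ _ _ _) (∣-minus (proj₂ (second i)) same))
        where
        eqs : first i ≡ first j × proj₁ (second i) ≡ proj₁ (second j)
        eqs = Finₚ.combine-injective {k′} {k} (first i) (proj₁ (second i)) (first j) (proj₁ (second j)) eq
        same : e ∣ proj₁ (g (proj₁ (second i))) - (proj₁ (g′ (first i)) - f j)
        same = ≡.subst₂ (λ a b → e ∣ proj₁ (g a) - (proj₁ (g′ b) - f j)) (≡.sym (proj₂ eqs)) (≡.sym (proj₁ eqs)) (proj₂ (second j))
        lemma : ∀ a b x y → (a - (b - x)) - (a - (b - y)) ≈ x - y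
        lemma = solve 4 (λ a b x y → (a :- (b :- x)) :- (a :- (b :- y)) := x :- y) ≈refl

    large-⋂ : ∀ {m} K (H : Fin K → C → Set (c ⊔ ℓ)) → (∀ i → Subgroup (H i)) → (∀ i → BoundedIndex m (H i)) →
      ∀ n → Σ (Fin (required m K n) → C) (Apart (Mod (e ∣_))) → Large (λ x → ∀ i → H i x) n
    large-⋂ zero H S bd n (f , af) = f , (λ _ ()) , af
    large-⋂ {m} (suc K) H S bd n lg = go (large-∩ S′ (S zero) (bd zero) n (large-⋂ K (H ∘ suc) (S ∘ suc) (bd ∘ suc) (suc (m ℕ.* n)) lg))
      where
      S′ : Subgroup (λ x → ∀ i → H (suc i) x)
      S′ = record { P-resp = λ e p i → Subgroup.P-resp (S (suc i)) e (p i) ; P-0 = λ i → Subgroup.P-0 (S (suc i))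
                  ; P-minus = λ p q i → Subgroup.P-minus (S (suc i)) (p i) (q i) }
      go : Large (λ x → (∀ i → H (suc i) x) × H zero x) n → Large (λ x → ∀ i → H i x) n
      go (f , f-H , f-apart) = f , (λ i → λ { zero → proj₂ (f-H i) ; (suc j) → proj₁ (f-H i) j }) , f-apart

  -- Baldwin–Saxl: by Bondy's lemma an intersection of large index yields K independent members of the family;
  -- after scaling by e these are crossed with the cosets of e R.
  module BaldwinSaxl {k} (H : Fm (suc k)) (m : ℕ) where

    private
      φ : Fm (suc 2)
      φ = v₂ divides (v₀ ⊟′ v₁)
      bound = no-pattern em dp φ (∼ H)
      K = proj₁ bound

    -- The pattern needs K elements apart modulo e inside an intersection of K members of the
    -- family.
    size : ℕ
    size = required (suc m) K K

    module _ (I : Set (c ⊔ ℓ)) (p p′ : I → Vec C k) (e : C)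
        (S : ∀ i → Subgroup (H [ p i ])) (S′ : ∀ i → Subgroup (H [ p′ i ]))
        (bd : ∀ i → BoundedIndex (suc m) (H [ p i ])) (bd′ : ∀ i → BoundedIndex (suc m) (H [ p′ i ]))
        (down : ∀ i t → (H [ p′ i ]) (e * t) → (H [ p i ]) t) (up : ∀ i t → (H [ p i ]) t → (H [ p′ i ]) (e * t))
        (lg : Σ (Fin size → C) (Apart (Mod (e ∣_)))) where

      private
        colour : ∀ ι → Σ (C → Fin (suc m)) λ col → (∀ {y z} → col y ≡ col z → Mod (H [ p ι ]) y z) × (∀ {y z} → Mod (H [ p ι ]) y z → col y ≡ col z)
        colour ι = colouring (Mod (H [ p ι ])) (Subgroup.Mod-sym (S ι)) em (Subgroup.Mod-trans (S ι)) (suc m) (bd ι)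

        pattern′ : ∀ (s : Fin K → I) (d r : Fin K → C) →
          (∀ i j → ¬ (H [ p (s i) ]) (d j) → i ≡ j) → (∀ j → ¬ (H [ p (s j) ]) (d j)) →
          (∀ i j → (H [ p′ (s j) ]) (r i)) → Apart (Mod (e ∣_)) r →
          ∀ i j → Σ C λ x → (∀ i′ → ⟦ φ ⟧ (x ∷ r i′ ∷ e ∷ []) ⇔ (i′ ≡ i)) × (∀ j′ → ⟦ ∼ H ⟧ (x ∷ p′ (s j′)) ⇔ (j′ ≡ j))
        pattern′ s d r indep₁ indep₂ r-H r-apart i j = r i + e * d j ,
            (λ i′ → mk⇔ (row i′) (λ { ≡.refl → d j , solve 3 (λ x e y → (x :+ e :* y) :- x := e :* y) ≈refl (r i) e (d j) })) ,
            (λ j′ → mk⇔ (col₁ j′) (λ { ≡.refl → col₂ }))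
          where
          row : ∀ i′ → e ∣ (r i + e * d j) - r i′ → i′ ≡ i
          row i′ h with i′ Fin.≟ i
          ... | yes eq = eq
          ... | no ne = contradiction (∣-respʳ (solve 3 (λ x y z → y :- ((z :+ y) :- x) := x :- z) ≈refl (r i′) (e * d j) (r i)) (∣-minus (a∣a*b e (d j)) h)) (r-apart i′ i ne)
          col₁ : ∀ j′ → ¬ (H [ p′ (s j′) ]) (r i + e * d j) → j′ ≡ j
          col₁ j′ h = indep₁ j′ j (λ g → h (Subgroup.P-+ (S′ _) (r-H i j′) (up _ _ g)))
          col₂ : ¬ (H [ p′ (s j) ]) (r i + e * d j)
          col₂ h = indep₂ j (down _ _ (Subgroup.P-resp (S′ _)
              (solve 2 (λ x y → (x :+ y) :- x := y) ≈refl (r i) (e * d j)) (Subgroup.P-minus (S′ _) h (r-H i j))))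

        module _ (N : ℕ) (big : suc m ℕ.^ suc K ℕ.< N) (t : Fin N → C)
            (none : ¬ (Σ (Fin N) λ i → Σ (Fin N) λ j → i ≢ j × (∀ ι → (H [ p ι ]) (t i - t j)))) where
          separated : ∀ i j → i ≢ j → ∃ λ ι → proj₁ (colour ι) (t i) ≢ proj₁ (colour ι) (t j)
          separated i j ne = proj₁ w , λ eq → proj₂ w (proj₁ (proj₂ (colour _)) eq)
            where
            w : Σ I λ ι → ¬ (H [ p ι ]) (t i - t j)
            w = ¬∀⇒∃¬ em (λ h → none (i , j , ne , h))

          independent : Σ (Fin K → I) λ s → Σ (Fin K → C) λ d → (∀ i j → ¬ (H [ p (s i) ]) (d j) → i ≡ j) × (∀ j → ¬ (H [ p (s j) ]) (d j))
          independent = go (Bondy.bondy em {I} m N (λ ι i → proj₁ (colour ι) (t i)) K big separated)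
            where
            go : Bondy.Irredundant em {I} m N (λ ι i → proj₁ (colour ι) (t i)) (suc K) → _
            go (s , π₁ , π₂ , indep) = (λ i → s (Fin.inject₁ i)) , (λ j → t (π₁ (Fin.inject₁ j)) - t (π₂ (Fin.inject₁ j))) ,
              (λ i j h → Finₚ.inject₁-injective (Equivalence.to (indep (Fin.inject₁ i) (Fin.inject₁ j)) (λ eq → h (proj₁ (proj₂ (colour _)) eq)))) ,
              (λ j h → Equivalence.from (indep (Fin.inject₁ j) (Fin.inject₁ j)) ≡.refl (proj₂ (proj₂ (colour _)) h))

        contra : ¬ (Σ (Fin K → I) λ s → Σ (Fin K → C) λ d → (∀ i j → ¬ (H [ p (s i) ]) (d j) → i ≡ j) × (∀ j → ¬ (H [ p (s j) ]) (d j)))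
        contra (s , d , indep₁ , indep₂) = go (large-⋂ e K (λ j → H [ p′ (s j) ]) (λ j → S′ _) (λ j → bd′ _) K lg)
          where
          go : ¬ (Σ (Fin K → C) λ r → (∀ i j → (H [ p′ (s j) ]) (r i)) × Apart (Mod (e ∣_)) r)
          go (r , r-H , r-apart) = proj₂ bound (λ i → r i ∷ e ∷ []) (λ j → p′ (s j)) (pattern′ s d r indep₁ indep₂ r-H r-apart)

      -- Independent members are found among the `p i`, but the pattern uses the scaled members
      -- `p′ i`: the offsets e * d j separate those without leaving a coset of e R, which is what
      -- the rows detect.
      finite-index-⋂ : Σ ℕ λ N → ∀ (t : Fin N → C) → Σ (Fin N) λ i → Σ (Fin N) λ j → i ≢ j × (∀ ι → (H [ p ι ]) (t i - t j))
      finite-index-⋂ = suc (suc m ℕ.^ suc K) , λ t → stable em (λ none → contra (independent _ ℕₚ.≤-refl t none))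

-- Balls in dp-minimal domains

module Balls {c ℓ} (R : CommutativeRing c ℓ) (em : ExcludedMiddle (c ⊔ ℓ)) (dom : IntegralDomain R) (dp : DPMinimal R)
    (ϖ : CommutativeRing.Carrier R)
    (ϖ≉0 : CommutativeRing._≉_ R ϖ (CommutativeRing.0# R)) (ϖ-nonunit : ¬ IsUnit R ϖ) where
  open DPMinimalDomain R em dom dp public

  ∏ : ∀ {n} → (Fin n → C) → C
  ∏ {zero} f = 1#
  ∏ {suc n} f = f zero * ∏ (f ∘ suc)

  ∏-∣ : ∀ {n} (f : Fin n → C) i → f i ∣ ∏ f
  ∏-∣ f zero = a∣a*b _ _
  ∏-∣ f (suc i) = ∣-*ˡ _ (∏-∣ (f ∘ suc) i)

  ∏-≉0 : ∀ {n} (f : Fin n → C) → (∀ i → f i ≉ 0#) → ∏ f ≉ 0#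
  ∏-≉0 {zero} f h = 1≉0
  ∏-≉0 {suc n} f h = *-≉0 (h zero) (∏-≉0 (f ∘ suc) (h ∘ suc))

  aϖ∤a : ∀ {a} → a ≉ 0# → a * ϖ ∤ a
  aϖ∤a {a} a≉0 h = nonunit-∤1 ϖ-nonunit (∣-cancelˡ a≉0 (∣-respʳ (≈sym (*-identityʳ a)) h))

  powers-distinct : ∀ {n} (i j : Fin n) → i ≢ j → ϖ ^ toℕ i - ϖ ^ toℕ j ≉ 0#
  powers-distinct {n} i j ne eq = powers-apart ϖ≉0 ϖ-nonunit n i j ne (∣-respʳ (≈sym eq) (∣0 _))

  Monotone : Fm 2 → Set (c ⊔ ℓ)
  Monotone W = ∀ {x γ γ′} → γ ∣ γ′ → ⟦ W ⟧ (x ∷ γ ∷ []) → ⟦ W ⟧ (x ∷ γ′ ∷ [])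

  Chain : Fm 2 → ∀ {l} → Fm (suc l) → ∀ {K} → (Fin K → Vec C l) → Set (c ⊔ ℓ)
  Chain W ψ b = ∀ γ → γ ≉ 0# → ∀ j → Σ C λ x → ¬ ⟦ W ⟧ (x ∷ γ ∷ []) × (Σ C λ γ′ → γ′ ≉ 0# × ⟦ W ⟧ (x ∷ γ′ ∷ [])) ×
    (∀ j′ → ⟦ ψ ⟧ (x ∷ b j′) ⇔ (j′ ≡ j))

  -- The rows are the annuli between consecutive terms of a sequence of γ. Each new term is a
  -- multiple of the witnesses γ′ of all columns at once, so every annulus contains a point of every
  -- column.
  no-chain : (W : Fm 2) → Monotone W → ∀ {l} (ψ : Fm (suc l)) → Σ ℕ λ K → (b : Fin K → Vec C l) → ¬ Chain W ψ b
  no-chain W mono ψ = K , contra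
    where
    φ : Fm 3
    φ = (∼ atom W (v₀ ∷ v₁ ∷ [])) ⩓ atom W (v₀ ∷ v₂ ∷ [])
    bound = no-pattern em dp φ ψ
    K = proj₁ bound
    contra : ∀ b → ¬ Chain W ψ b
    contra b ch = proj₂ bound (λ i → g (toℕ i) ∷ g (suc (toℕ i)) ∷ []) b λ i j → x i j ,
        (λ i′ → mk⇔ (λ { (p , q) → Finₚ.toℕ-injective (row (toℕ i) (toℕ i′) (x∉ i j) (x∈ i j) p q) })
          (λ { ≡.refl → x∉ i j , x∈ i j })) ,
        proj₂ (proj₂ (proj₂ (ch (g (toℕ i)) (g≉0 (toℕ i)) j)))
      where
      next : (γ : C) → γ ≉ 0# → Fin K → C
      next γ h j = proj₁ (proj₁ (proj₂ (proj₂ (ch γ h j))))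
      next≉0 : ∀ γ h j → next γ h j ≉ 0#
      next≉0 γ h j = proj₁ (proj₂ (proj₁ (proj₂ (proj₂ (ch γ h j)))))
      seq : ℕ → Σ C λ γ → γ ≉ 0#
      seq zero = 1# , 1≉0
      seq (suc n) = proj₁ (seq n) * ∏ (next (proj₁ (seq n)) (proj₂ (seq n))) ,
        *-≉0 (proj₂ (seq n)) (∏-≉0 _ (next≉0 (proj₁ (seq n)) (proj₂ (seq n))))
      g : ℕ → C
      g n = proj₁ (seq n)
      g≉0 : ∀ n → g n ≉ 0#
      g≉0 n = proj₂ (seq n)
      g-mono : ∀ {m n} → m ℕ.≤ n → g m ∣ g n
      g-mono {m} le = go (ℕₚ.≤⇒≤′ le)
        where
        go : ∀ {n} → m ℕ.≤′ n → g m ∣ g n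
        go ℕ.≤′-refl = ∣-refl
        go (ℕ.≤′-step h) = ∣-trans (go h) (a∣a*b _ _)
      x : Fin K → Fin K → C
      x i j = proj₁ (ch (g (toℕ i)) (g≉0 (toℕ i)) j)
      x∉ : ∀ i j → ¬ ⟦ W ⟧ (x i j ∷ g (toℕ i) ∷ [])
      x∉ i j = proj₁ (proj₂ (ch (g (toℕ i)) (g≉0 (toℕ i)) j))
      x∈ : ∀ i j → ⟦ W ⟧ (x i j ∷ g (suc (toℕ i)) ∷ [])
      x∈ i j = mono (∣-*ˡ _ (∏-∣ (next _ _) j)) (proj₂ (proj₂ (proj₁ (proj₂ (proj₂ (ch (g (toℕ i)) (g≉0 (toℕ i)) j))))))
      row : ∀ m n {y} → ¬ ⟦ W ⟧ (y ∷ g m ∷ []) → ⟦ W ⟧ (y ∷ g (suc m) ∷ []) → ¬ ⟦ W ⟧ (y ∷ g n ∷ []) → ⟦ W ⟧ (y ∷ g (suc n) ∷ []) → n ≡ m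
      row m n a b p q with ℕₚ.<-cmp n m
      ... | tri< lt _ _ = contradiction (mono (g-mono lt) q) a
      ... | tri≈ _ eq _ = eq
      ... | tri> _ _ gt = contradiction (mono (g-mono gt) b) p

  record SubBall (a ε : C) (P : C → Set (c ⊔ ℓ)) : Set (c ⊔ ℓ) where
    constructor subBall
    field
      centre radius : C
      radius≉0 : radius ≉ 0#
      centre-in : ε ∣ centre - a
      radius-in : ε ∣ radius
      inside : ∀ x → radius ∣ x - centre → P x

    ⊆ball : ∀ {x} → radius ∣ x - centre → ε ∣ x - a
    ⊆ball h = ∣-respʳ (≈sym (x-z≈ _ _ _)) (∣-+ (∣-trans radius-in h) centre-in)

  shrink-ball : ∀ {a ε P} (B : SubBall a ε P) {Q} → SubBall (SubBall.centre B) (SubBall.radius B) Q → SubBall a ε Q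
  shrink-ball B B′ = subBall B′.centre B′.radius B′.radius≉0 (B.⊆ball B′.centre-in) (∣-trans B.radius-in B′.radius-in) B′.inside
    where
    module B = SubBall B
    module B′ = SubBall B′

  -- If no member of the cover contains a ball, then each of K disjoint balls has, for every γ, a
  -- point outside the member for γ; that point is caught by a later member. With these balls as
  -- columns this is a chain.
  baire : (W : Fm 2) → Monotone W → ∀ a ε → ε ≉ 0# → (∀ x → ε ∣ x - a → Σ C λ γ → γ ≉ 0# × ⟦ W ⟧ (x ∷ γ ∷ [])) →
    Σ C λ γ → γ ≉ 0# × SubBall a ε (λ x → ⟦ W ⟧ (x ∷ γ ∷ []))
  baire W mono a ε ε≉0 cover = stable em λ none → proj₂ bound b (chain none)
    where
    ψ : Fm 3
    ψ = v₂ divides (v₀ ⊟′ v₁)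
    bound = no-chain W mono ψ
    K = proj₁ bound
    η = ε * ϖ ^ K
    η≉0 : η ≉ 0#
    η≉0 = *-≉0 ε≉0 (^-≉0 K ϖ≉0)
    point : Fin K → C
    point j = a + ε * ϖ ^ toℕ j
    b : Fin K → Vec C 2
    b j = point j ∷ η ∷ []
    point-apart : ∀ j j′ x → η ∣ x - point j → η ∣ x - point j′ → j′ ≡ j
    point-apart j j′ x h h′ with j′ Fin.≟ j
    ... | yes eq = eq
    ... | no ne = contradiction (∣-cancelˡ ε≉0 (∣-respʳ
        (solve 5 (λ x a e p q → (x :- (a :+ e :* p)) :- (x :- (a :+ e :* q)) := e :* (q :- p)) ≈refl x a ε (ϖ ^ toℕ j) (ϖ ^ toℕ j′)) (∣-minus h h′)))
        (powers-apart ϖ≉0 ϖ-nonunit K j′ j ne)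
    point-in : ∀ j → ε ∣ point j - a
    point-in j = ϖ ^ toℕ j , solve 2 (λ a y → (a :+ y) :- a := y) ≈refl a (ε * ϖ ^ toℕ j)
    chain : ¬ (Σ C λ γ → γ ≉ 0# × SubBall a ε (λ x → ⟦ W ⟧ (x ∷ γ ∷ []))) → Chain W ψ b
    chain none γ γ≉0 j = x , proj₂ (proj₂ outside) ,
        cover x (∣-respʳ (≈sym (x-z≈ _ _ _)) (∣-+ (∣-trans (a∣a*b _ _) x-in) (point-in j))) ,
        (λ j′ → mk⇔ (point-apart j j′ x x-in) (λ { ≡.refl → x-in }))
      where
      outside : Σ C λ x → η ∣ x - point j × ¬ ⟦ W ⟧ (x ∷ γ ∷ [])
      outside = stable em λ no-x → none (γ , γ≉0 , subBall (point j) η η≉0 (point-in j) (a∣a*b _ _)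
        (λ x h → stable em (λ nw → no-x (x , h , nw))))
      x = proj₁ outside
      x-in = proj₁ (proj₂ outside)

  -- Germs at the points of R of a definable set, punctured so that they may be shifted.
  module Germs (D : Fm 1) where

    Dₚ : C → Set (c ⊔ ℓ)
    Dₚ x = ⟦ D ⟧ (x ∷ [])

    D-resp : ∀ {x y} → x ≈ y → Dₚ x → Dₚ y
    D-resp e = resp≈ D (e ∷ [])

    _⇔′_ : ∀ {n} → Fm n → Fm n → Fm n
    φ ⇔′ ψ = (φ ⟹ ψ) ⩓ (ψ ⟹ φ)

    agreeOn : Fm 3
    agreeOn = All ((∼ (v₀ ≋ cst 0#)) ⟹ v₁ divides v₀ ⟹ (atom D ((v₂ ⊞ v₀) ∷ []) ⇔′ atom D ((v₃ ⊞ v₀) ∷ [])))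

    AgreeOn : C → C → C → Set (c ⊔ ℓ)
    AgreeOn γ a b = ⟦ agreeOn ⟧ (γ ∷ a ∷ b ∷ [])

    agree : Fm 2
    agree = Ex ((∼ (v₀ ≋ cst 0#)) ⩓ atom agreeOn (v₀ ∷ v₁ ∷ v₂ ∷ []))

    Agree : C → C → Set (c ⊔ ℓ)
    Agree a b = ⟦ agree ⟧ (a ∷ b ∷ [])

    agreeOn-sym : ∀ {γ a b} → AgreeOn γ a b → AgreeOn γ b a
    agreeOn-sym h t t≉0 d = proj₂ (h t t≉0 d) , proj₁ (h t t≉0 d)

    agreeOn-trans : ∀ {γ a b e} → AgreeOn γ a b → AgreeOn γ b e → AgreeOn γ a e
    agreeOn-trans h g t t≉0 d = proj₁ (g t t≉0 d) ∘ proj₁ (h t t≉0 d) , proj₂ (h t t≉0 d) ∘ proj₂ (g t t≉0 d)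

    agreeOn-mono : ∀ {γ γ′ a b} → γ ∣ γ′ → AgreeOn γ a b → AgreeOn γ′ a b
    agreeOn-mono g h t t≉0 d = h t t≉0 (∣-trans g d)

    agree-sym : ∀ {a b} → Agree a b → Agree b a
    agree-sym (γ , γ≉0 , h) = γ , γ≉0 , agreeOn-sym h

    agree-trans : ∀ {a b e} → Agree a b → Agree b e → Agree a e
    agree-trans (γ , γ≉0 , h) (δ , δ≉0 , g) = γ * δ , (λ z → *-≉0 (γ≉0 ∘ lift) (δ≉0 ∘ lift) (lower z)) ,
      agreeOn-trans (agreeOn-mono (a∣a*b γ δ) h) (agreeOn-mono (a∣b*a δ γ) g)

    agree-resp : ∀ {a b a′ b′} → a ≈ a′ → b ≈ b′ → Agree a b → Agree a′ b′
    agree-resp e f = resp≈ agree (e ∷ f ∷ [])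

    private
      separates : Fm 3
      separates = ∼ (atom D ((v₁ ⊞ v₀) ∷ []) ⇔′ atom D ((v₂ ⊞ v₀) ∷ []))

      outsideBall : Fm 2
      outsideBall = ∼ (v₁ divides v₀)

      outside-mono : Monotone outsideBall
      outside-mono g n d = n (∣-trans g d)

      bound = no-chain outsideBall outside-mono separates
      K = proj₁ bound

    germs : ℕ
    germs = 2 ℕ.^ suc K

    module Separation (K N : ℕ) (big : 2 ℕ.^ suc K ℕ.< N) (f : Fin N → C) (apart : Apart Agree f) where
      -- Tests are nonzero shifts: a nonzero t lies outside the ball of radius t * ϖ around 0, which
      -- a chain needs in order to continue.
      T : C → Set (c ⊔ ℓ)
      T γ = Σ C λ t → t ≉ 0# × γ ∣ t

      private
        colour : C → Fin N → Fin 2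
        colour t j = bit (em {Dₚ (f j + t)})

        colour-sound : ∀ t j k → colour t j ≡ colour t k → (Dₚ (f j + t) → Dₚ (f k + t)) × (Dₚ (f k + t) → Dₚ (f j + t))
        colour-sound t j k = bit-sound em em

        colour-complete : ∀ t j k → (Dₚ (f j + t) → Dₚ (f k + t)) × (Dₚ (f k + t) → Dₚ (f j + t)) → colour t j ≡ colour t k
        colour-complete t j k = bit-complete em em

      Sep : C → Fin N → Fin N → Set (c ⊔ ℓ)
      Sep t j k = ⟦ separates ⟧ (t ∷ f j ∷ f k ∷ [])

      code : ℕ
      code = N ℕ.^ K

      pt : Fin code → Fin K → Fin N
      pt = Fin.finToFun {N} {K}

      Good : C → Fin code → Fin code → Set (c ⊔ ℓ)
      Good γ u v = Σ (Fin K → T γ) λ t → ∀ i l → Sep (proj₁ (t i)) (pt u l) (pt v l) ⇔ (i ≡ l)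

      private
        separated : ∀ γ → γ ≉ 0# → ∀ j k → j ≢ k → ∃ λ (t : T γ) → colour (proj₁ t) j ≢ colour (proj₁ t) k
        separated γ γ≉0 j k ne = stable em λ none → apart j k ne (γ , (λ z → γ≉0 (lower z)) ,
          λ t t≉0 d → stable em λ nt → none ((t , (λ z → t≉0 (lift z)) , d) , λ eq → nt (colour-sound t j k eq)))

        some-good : ∀ γ → γ ≉ 0# → Σ (Fin code) λ u → Σ (Fin code) λ v → Good γ u v
        some-good γ γ≉0 = go (Bondy.bondy em {T γ} 1 N (λ t → colour (proj₁ t)) K big (separated γ γ≉0))
          where
          go : Bondy.Irredundant em {T γ} 1 N (λ t → colour (proj₁ t)) (suc K) → Σ (Fin code) λ u → Σ (Fin code) λ v → Good γ u v
          go (t , π₁ , π₂ , indep) = Fin.funToFin (π₁ ∘ Fin.inject₁) , Fin.funToFin (π₂ ∘ Fin.inject₁) , t ∘ Fin.inject₁ ,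
            λ i l → ≡.subst₂ (λ a b → Sep (proj₁ (t (Fin.inject₁ i))) a b ⇔ (i ≡ l))
              (≡.sym (Finₚ.finToFun-funToFin {K} {N} (π₁ ∘ Fin.inject₁) l)) (≡.sym (Finₚ.finToFun-funToFin {K} {N} (π₂ ∘ Fin.inject₁) l))
              (mk⇔ (λ s → Finₚ.inject₁-injective (Equivalence.to (indep _ _) (λ eq → s (colour-sound _ _ _ eq))))
                   (λ eq s → Equivalence.from (indep _ _) (≡.cong Fin.inject₁ eq) (colour-complete _ _ _ s)))

        good-mono : ∀ {γ γ′} → γ ∣ γ′ → ∀ {u v} → Good γ′ u v → Good γ u v
        good-mono g (t , h) = (λ i → proj₁ (t i) , proj₁ (proj₂ (t i)) , ∣-trans g (proj₂ (proj₂ (t i)))) , h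

      -- The K pairs found for a given γ may depend on γ. There are only finitely many codes for
      -- them, and `Good` passes from smaller balls to larger ones; if every code failed at some γ,
      -- all would fail at the product of these.
      always-good : Σ (Fin code) λ u → Σ (Fin code) λ v → ∀ γ → γ ≉ 0# → Good γ u v
      always-good = stable em λ none → go none
        where
        go : ¬ (Σ (Fin code) λ u → Σ (Fin code) λ v → ∀ γ → γ ≉ 0# → Good γ u v) → ⊥
        go none = proj₂ (proj₂ (bad u v)) (good-mono (∣-trans (∏-∣ (λ v → proj₁ (bad u v)) v) (∏-∣ (λ u → ∏ (λ v → proj₁ (bad u v))) u)) (proj₂ (proj₂ best)))
          where
          bad : ∀ u v → Σ C λ γ → γ ≉ 0# × ¬ Good γ u v
          bad u v = stable em λ nb → none (u , v , λ γ γ≉0 → stable em λ ng → nb (γ , γ≉0 , ng))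
          Γ = ∏ (λ u → ∏ (λ v → proj₁ (bad u v)))
          best = some-good Γ (∏-≉0 _ (λ u → ∏-≉0 _ (λ v → proj₁ (proj₂ (bad u v)))))
          u = proj₁ best
          v = proj₁ (proj₂ best)

    -- Pairs of points that are good for all γ at once are the columns, and the tests, available at
    -- every depth, are the points of the chain.
    too-many-germs : (f : Fin (suc (suc germs)) → C) → ¬ Apart Agree f
    too-many-germs f apart = go S.always-good
      where
      module S = Separation K (suc (suc germs)) (s≤s (ℕₚ.n≤1+n _)) f apart
      go : ¬ (Σ (Fin S.code) λ u → Σ (Fin S.code) λ v → ∀ γ → γ ≉ 0# → S.Good γ u v)
      go (u , v , always) = proj₂ bound (λ j → f (S.pt u j) ∷ f (S.pt v j) ∷ []) chain
        where
        chain : Chain outsideBall separates (λ j → f (S.pt u j) ∷ f (S.pt v j) ∷ [])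
        chain γ γ≉0 j = go′ (always γ γ≉0)
          where
          go′ : S.Good γ u v → _
          go′ (t , h) = proj₁ (t j) , (λ n → n (proj₂ (proj₂ (t j)))) ,
            (proj₁ (t j) * ϖ , *-≉0 (proj₁ (proj₂ (t j))) ϖ≉0 , aϖ∤a (proj₁ (proj₂ (t j)))) ,
            (λ j′ → mk⇔ (λ s → ≡.sym (Equivalence.to (h j j′) s)) (λ eq → Equivalence.from (h j j′) (≡.sym eq)))

    shift-germ : ∀ {γ x y s} → γ ≉ 0# → γ ∣ s → AgreeOn γ x y → Agree (x + s) (y + s)
    shift-germ {γ} {x} {y} {s} γ≉0 γ∣s h = go (s ≈? 0#)
      where
      go : Dec (s ≈ 0#) → Agree (x + s) (y + s)
      go (yes s≈0) = agree-resp (≈sym (≈trans (+-congˡ s≈0) (+-identityʳ x))) (≈sym (≈trans (+-congˡ s≈0) (+-identityʳ y))) (γ , (γ≉0 ∘ lower) , h)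
      -- The factor s * ϖ in the radius keeps s + t away from 0, where germs are punctured.
      go (no s≉0) = γ * (s * ϖ) , (*-≉0 γ≉0 (*-≉0 s≉0 ϖ≉0) ∘ lower) , λ t t≉0 d →
          let g = h (s + t) (λ z → s+t≉0 d (lower z)) (∣-+ γ∣s (∣-trans (a∣a*b _ _) d))
          in (λ p → D-resp (≈sym (+-assoc _ _ _)) (proj₁ g (D-resp (+-assoc _ _ _) p))) ,
             (λ p → D-resp (≈sym (+-assoc _ _ _)) (proj₂ g (D-resp (+-assoc _ _ _) p)))
        where
        s+t≉0 : ∀ {t} → γ * (s * ϖ) ∣ t → s + t ≉ 0#
        s+t≉0 {t} d e = aϖ∤a s≉0 (∣-respʳ
          (lin₁ e (- 1#) (solve 2 (λ s t → :- t :+ :- con (+ 1) :* con (+ 0) := s :+ :- con (+ 1) :* (s :+ t)) ≈refl s t))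
          (∣-neg (∣-trans (a∣b*a _ _) d)))

    module Representatives (n : ℕ) (r : Fin n → C) (r-apart : Apart Agree r) (r-cover : ∀ x → ∃ λ i → Agree (r i) x) where

      W : Fm 2
      W = ⋁ (λ i → atom agreeOn (v₁ ∷ v₀ ∷ cst (r i) ∷ []))

      W-elim : ∀ {x γ} → ⟦ W ⟧ (x ∷ γ ∷ []) → ∃ λ i → AgreeOn γ x (r i)
      W-elim = ⋁-elim (λ i → atom agreeOn (v₁ ∷ v₀ ∷ cst (r i) ∷ []))

      W-intro : ∀ {x γ} i → AgreeOn γ x (r i) → ⟦ W ⟧ (x ∷ γ ∷ [])
      W-intro i h = ⋁-intro (λ i → atom agreeOn (v₁ ∷ v₀ ∷ cst (r i) ∷ [])) i h

      W-mono : Monotone W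
      W-mono g w = let (i , h) = W-elim w in W-intro i (agreeOn-mono g h)

      W-cover : ∀ x → Σ C λ γ → γ ≉ 0# × ⟦ W ⟧ (x ∷ γ ∷ [])
      W-cover x = let (i , γ , γ≉0 , h) = r-cover x in γ , (γ≉0 ∘ lift) , W-intro i (agreeOn-sym h)

      -- Distinct representatives have distinct germs, so both points agree with the same
      -- representative, and they do so already at radius γ.
      uniform : ∀ {γ x y} → γ ≉ 0# → ⟦ W ⟧ (x ∷ γ ∷ []) → ⟦ W ⟧ (y ∷ γ ∷ []) → Agree x y → AgreeOn γ x y
      uniform {γ} {x} {y} γ≉0 wx wy xy = go (W-elim wx) (W-elim wy)
        where
        go : (∃ λ i → AgreeOn γ x (r i)) → (∃ λ i → AgreeOn γ y (r i)) → AgreeOn γ x y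
        go (i , hx) (j , hy) with i Fin.≟ j
        ... | yes ≡.refl = agreeOn-trans hx (agreeOn-sym hy)
        ... | no ne = contradiction (agree-trans (agree-sym (γ , (γ≉0 ∘ lower) , hx)) (agree-trans xy (γ , (γ≉0 ∘ lower) , hy))) (r-apart i j ne)

      -- On a ball where germs have uniform size, the points with the germ of the centre form a subgroup of finite index,
      -- which contains an ideal by Baldwin–Saxl.
      module _ (a γ δ : C) (γ≉0 : γ ≉ 0#) (δ≉0 : δ ≉ 0#) (γ∣δ : γ ∣ δ) (inW : ∀ x → δ ∣ x - a → ⟦ W ⟧ (x ∷ γ ∷ [])) where
        private
          H : Fm 2
          H = atom agree ((cst a ⊞ (v₁ ⊠ cst δ) ⊠ v₀) ∷ cst a ∷ [])

          pt : C → C → C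
          pt k s = a + (k * δ) * s

          pt-in : ∀ k s → δ ∣ pt k s - a
          pt-in k s = k * s , solve 4 (λ a k d s → (a :+ (k :* d) :* s) :- a := d :* (k :* s)) ≈refl a k δ s

          difference : ∀ k s s′ → Agree (pt k s) (pt k s′) → Agree (pt k (s - s′)) a
          difference k s s′ h = agree-resp
            (solve 4 (λ a k s s′ → (a :+ k :* s) :+ :- (k :* s′) := a :+ k :* (s :- s′)) ≈refl a (k * δ) s s′)
            (solve 2 (λ a y → (a :+ y) :+ :- y := a) ≈refl a ((k * δ) * s′))
            (shift-germ γ≉0 (∣-neg (∣-*ʳ s′ (∣-*ˡ k γ∣δ))) (uniform γ≉0 (inW _ (pt-in k s)) (inW _ (pt-in k s′)) h))

          H-subgroup : ∀ k → Subgroup (H [ k ∷ [] ])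
          H-subgroup k = record
            { P-resp = λ e → agree-resp (+-congˡ (*-congˡ e)) ≈refl
            ; P-0 = agree-resp (+-congˡ (*-congˡ (x-x≈0 0#))) ≈refl (difference k 0# 0# (1# , (1≉0 ∘ lower) , λ t _ _ → id , id))
            ; P-minus = λ {s} {s′} p q → difference k s s′ (agree-trans p (agree-sym q)) }

          H-index : ∀ k → BoundedIndex (suc germs) (H [ k ∷ [] ])
          H-index k f apart = too-many-germs (λ i → pt k (f i)) (λ i j ne h → apart i j ne (difference k (f i) (f j) h))

          open BaldwinSaxl H germs

          e : C
          e = ϖ ^ size

          scale : ∀ k t → pt k (e * t) ≈ pt (k * e) t
          scale k t = solve 5 (λ a k d e t → a :+ (k :* d) :* (e :* t) := a :+ ((k :* e) :* d) :* t) ≈refl a k δ e t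

        germ-ideal : Σ C λ η → η ≉ 0# × δ ∣ η × (∀ w → η ∣ w → AgreeOn γ (a + w) a)
        -- All multipliers k are intersected at once. If τ lies in the group for every k * e, then
        -- all multiples of e * τ lie in the group for 1, so a subgroup becomes an ideal.
        germ-ideal = go (finite-index-⋂ (Lift ℓ C) (λ k → (lower k * e) ∷ []) (λ k → lower k ∷ []) e
            (λ k → H-subgroup _) (λ k → H-subgroup _) (λ k → H-index _) (λ k → H-index _)
            (λ k t → agree-resp (scale (lower k) t) ≈refl) (λ k t → agree-resp (≈sym (scale (lower k) t)) ≈refl)
            ((λ i → ϖ ^ toℕ i) , powers-apart ϖ≉0 ϖ-nonunit size))
          where
          go : (Σ ℕ λ N → ∀ (t : Fin N → C) → Σ (Fin N) λ i → Σ (Fin N) λ j → i ≢ j ×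
                 (∀ (k : Lift ℓ C) → Agree (pt (lower k * e) (t i - t j)) a)) →
            Σ C λ η → η ≉ 0# × δ ∣ η × (∀ w → η ∣ w → AgreeOn γ (a + w) a)
          go (N , fin) = go′ (fin (λ i → ϖ ^ toℕ i))
            where
            go′ : (Σ (Fin N) λ i → Σ (Fin N) λ j → i ≢ j × (∀ (k : Lift ℓ C) → Agree (pt (lower k * e) (ϖ ^ toℕ i - ϖ ^ toℕ j)) a)) → _
            go′ (i , j , ne , h) = δ * (e * τ) , *-≉0 δ≉0 (*-≉0 (^-≉0 size ϖ≉0) (powers-distinct i j ne)) , a∣a*b _ _ , λ w (q , w≈) →
                uniform γ≉0 (inW _ (∣-respʳ (solve 2 (λ a w → w := (a :+ w) :- a) ≈refl a w) (∣-trans (a∣a*b _ _) (q , w≈)))) (inW _ (∣-respʳ (≈sym (x-x≈0 a)) (∣0 δ)))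
                  (agree-resp (+-congˡ (≈trans (solve 4 (λ q e d t → ((q :* e) :* d) :* t := (d :* (e :* t)) :* q) ≈refl q e δ τ) (≈sym w≈))) ≈refl (h (lift q)))
              where
              τ = ϖ ^ toℕ i - ϖ ^ toℕ j

      dichotomy′ : ∀ a ε → ε ≉ 0# → SubBall a ε Dₚ ⊎ SubBall a ε (λ x → ¬ Dₚ x)
      dichotomy′ a ε ε≉0 = go (baire W W-mono a ε ε≉0 (λ x _ → W-cover x))
        where
        go : (Σ C λ γ → γ ≉ 0# × SubBall a ε (λ x → ⟦ W ⟧ (x ∷ γ ∷ []))) → SubBall a ε Dₚ ⊎ SubBall a ε (λ x → ¬ Dₚ x)
        go (γ , γ≉0 , B) = go′ (germ-ideal B.centre γ (B.radius * γ) γ≉0 (*-≉0 B.radius≉0 γ≉0) (a∣b*a _ _) (λ x h → B.inside x (∣-trans (a∣a*b _ _) h)))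
          where
          module B = SubBall B
          go′ : (Σ C λ η → η ≉ 0# × B.radius * γ ∣ η × (∀ w → η ∣ w → AgreeOn γ (B.centre + w) B.centre)) → _
          go′ (η , η≉0 , δ∣η , ideal) = decide em
            where
            -- Germs are punctured, so the one at the centre is evaluated at the nonzero shift η.
            -- Moving the centre by a multiple of η does not change the answer, hence `D` is
            -- constant on the ball around b.
            b = B.centre + η
            same : ∀ x → η ∣ x - b → (Dₚ x → Dₚ b) × (Dₚ b → Dₚ x)
            same x h = (λ p → proj₁ g (D-resp (≈sym x≈) p)) , (λ p → D-resp x≈ (proj₂ g p))
              where
              g = ideal (x - b) h η (η≉0 ∘ lower) (∣-trans (a∣b*a _ _) δ∣η)
              x≈ : (B.centre + (x - b)) + η ≈ x
              x≈ = solve 3 (λ a h x → (a :+ (x :- (a :+ h))) :+ h := x) ≈refl B.centre η x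
            ball : ∀ {P} → (∀ x → η ∣ x - b → P x) → SubBall a ε P
            ball h = shrink-ball B (subBall b η η≉0
              (∣-respʳ (solve 2 (λ a h → h := (a :+ h) :- a) ≈refl B.centre η) (∣-trans (a∣a*b _ _) δ∣η)) (∣-trans (a∣a*b _ _) δ∣η) h)
            decide : Dec (Dₚ b) → _
            decide (yes p) = inj₁ (ball (λ x h → proj₂ (same x h) p))
            decide (no p) = inj₂ (ball (λ x h q → p (proj₁ (same x h) q)))

    dichotomy : ∀ a ε → ε ≉ 0# → SubBall a ε Dₚ ⊎ SubBall a ε (λ x → ¬ Dₚ x)
    dichotomy = go (representatives Agree agree-sym em (suc germs) too-many-germs)
      where
      go : (Σ ℕ λ n → n ℕ.≤ suc germs × Σ (Fin n → C) λ r → Apart Agree r × (∀ x → ∃ λ i → Agree (r i) x)) → _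
      go (n , _ , r , r-apart , r-cover) = Representatives.dichotomy′ n r r-apart r-cover

-- Definable sets in several variables, and the open image theorem

module ValuationTopology {c ℓ} (R : CommutativeRing c ℓ) (em : ExcludedMiddle (c ⊔ ℓ)) (dom : IntegralDomain R) (dp : DPMinimal R)
    (ϖ : CommutativeRing.Carrier R)
    (ϖ≉0 : CommutativeRing._≉_ R ϖ (CommutativeRing.0# R)) (ϖ-nonunit : ¬ IsUnit R ϖ) where
  open Balls R em dom dp ϖ ϖ≉0 ϖ-nonunit public

  csts : ∀ {k n} → Vec C k → Vec (Tm n) k
  csts = Vec.map cst

  csts-sem : ∀ {k n} (β : Vec C k) (ρ : Vec C n) → ⟦ csts β ⟧ᵗˢ ρ ≡ β
  csts-sem [] ρ = ≡.refl
  csts-sem (b ∷ β) ρ = ≡.cong (b ∷_) (csts-sem β ρ)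

  Nonfat : (C → Set (c ⊔ ℓ)) → Set (c ⊔ ℓ)
  Nonfat P = ∀ a ε → ε ≉ 0# → ¬ (∀ x → ε ∣ x - a → P x)

  Generic : (C → Set (c ⊔ ℓ)) → Set (c ⊔ ℓ)
  Generic P = ∀ a ε → ε ≉ 0# → SubBall a ε P

  generic-∩ : ∀ {P Q} → Generic P → Generic Q → Generic (λ x → P x × Q x)
  generic-∩ p q a ε ε≉0 = shrink-ball B (subBall B′.centre B′.radius B′.radius≉0 B′.centre-in B′.radius-in
      λ x h → B.inside x (B′.⊆ball h) , B′.inside x h)
    where
    B = p a ε ε≉0
    module B = SubBall B
    module B′ = SubBall (q B.centre B.radius B.radius≉0)

  generic-∀ : ∀ n {P : Fin n → C → Set (c ⊔ ℓ)} → (∀ i → Generic (P i)) → Generic (λ x → ∀ i → P i x)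
  generic-∀ zero g a ε ε≉0 = subBall a ε ε≉0 (∣-respʳ (≈sym (x-x≈0 a)) (∣0 ε)) ∣-refl (λ x _ ())
  generic-∀ (suc n) {P} g a ε ε≉0 = subBall B.centre B.radius B.radius≉0 B.centre-in B.radius-in
      (λ x h → λ { zero → proj₁ (B.inside x h) ; (suc i) → proj₂ (B.inside x h) i })
    where
    module B = SubBall (generic-∩ (g zero) (generic-∀ n (λ i → g (suc i))) a ε ε≉0)

  generic-¬ : (D : Fm 1) → Nonfat (λ x → ⟦ D ⟧ (x ∷ [])) → Generic (λ x → ¬ ⟦ D ⟧ (x ∷ []))
  generic-¬ D nf a ε ε≉0 = go (Germs.dichotomy D a ε ε≉0)
    where
    go : SubBall a ε (λ x → ⟦ D ⟧ (x ∷ [])) ⊎ SubBall a ε (λ x → ¬ ⟦ D ⟧ (x ∷ [])) → SubBall a ε (λ x → ¬ ⟦ D ⟧ (x ∷ []))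
    go (inj₁ B) = contradiction (SubBall.inside B) (nf _ _ (SubBall.radius≉0 B))
    go (inj₂ B) = B

  separating-radius : ∀ {n} (f : Fin n → C) → Apart _≈_ f → Σ C λ ε → ε ≉ 0# × Apart (Mod (ε ∣_)) f
  separating-radius {n} f af = ∏ (λ i → ∏ (g i)) , ∏-≉0 _ (λ i → ∏-≉0 _ (g≉0 i)) ,
      λ i j ne h → gap i j ne (∣-trans (∣-trans (∏-∣ (g i) j) (∏-∣ (λ i → ∏ (g i)) i)) h)
    where
    entry : ∀ {i j : Fin n} → Dec (i ≡ j) → C
    entry (yes _) = 1#
    entry {i} {j} (no _) = (f i - f j) * ϖ
    g : Fin n → Fin n → C
    g i j = entry {i} {j} (i Fin.≟ j)
    diff≉0 : ∀ {i j} → i ≢ j → f i - f j ≉ 0#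
    diff≉0 ne e = af _ _ ne (-≈0⇒≈ e)
    entry≉0 : ∀ {i j} (d : Dec (i ≡ j)) → entry {i} {j} d ≉ 0#
    entry≉0 (yes _) = 1≉0
    entry≉0 (no ne) = *-≉0 (diff≉0 ne) ϖ≉0
    g≉0 : ∀ i j → g i j ≉ 0#
    g≉0 i j = entry≉0 {i} {j} (i Fin.≟ j)
    entry-gap : ∀ {i j} (d : Dec (i ≡ j)) → i ≢ j → entry {i} {j} d ∤ f i - f j
    entry-gap (yes eq) ne = contradiction eq ne
    entry-gap (no ne) _ = aϖ∤a (diff≉0 ne)
    gap : ∀ i j → i ≢ j → g i j ∤ f i - f j
    gap i j = entry-gap {i} {j} (i Fin.≟ j)

  -- Put K points of `X` into disjoint balls of radius ε and choose generic shifts b j in ε R with f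
  -- i + b j - b j′ outside `X` for j ≠ j′. Then f i + b j lies only in the ball of f i and only in
  -- the translate of `X` by b j.
  nonfat⇒finite : ∀ {k} (X : Fm (suc k)) → Σ ℕ λ K → ∀ β → Nonfat (X [ β ]) → (f : Fin K → C) → (∀ i → (X [ β ]) (f i)) → ¬ Apart _≈_ f
  nonfat⇒finite {k} X = K , λ β nf f fX af → contra β nf f fX (separating-radius f af)
    where
    φ : Fm 3
    φ = v₂ divides (v₀ ⊟′ v₁)
    ψ : Fm (2 ℕ.+ k)
    ψ = atom↓ 2 X ((v₀ ⊟′ v₁) ∷ [])
    bound = no-pattern em dp φ ψ
    K = proj₁ bound
    module _ (β : Vec C k) (nf : Nonfat (X [ β ])) (f : Fin K → C) (fX : ∀ i → (X [ β ]) (f i)) where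
      X-resp : ∀ {x y} → x ≈ y → (X [ β ]) x → (X [ β ]) y
      X-resp e = resp≈ X (e ∷ ≈ᵛ-refl)

      translate : ∀ a → Generic (λ z → ¬ (X [ β ]) (a + z))
      translate a = λ b ε ε≉0 → let module B = SubBall (generic-¬ D nonfat b ε ε≉0) in
          subBall B.centre B.radius B.radius≉0 B.centre-in B.radius-in
            (λ z h p → B.inside z h (≡.subst (λ β′ → ⟦ X ⟧ (a + z ∷ β′)) (≡.sym (csts-sem β (z ∷ []))) p))
        where
        D : Fm 1
        D = atom X ((cst a ⊞ v₀) ∷ csts β)
        nonfat : Nonfat (λ z → ⟦ D ⟧ (z ∷ []))
        nonfat b ε ε≉0 h = nf (a + b) ε ε≉0 (λ x d → X-resp (solve 2 (λ a x → a :+ (x :- a) := x) ≈refl a x)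
          (≡.subst (λ β′ → ⟦ X ⟧ (a + (x - a) ∷ β′)) (csts-sem β (x - a ∷ []))
            (h (x - a) (∣-respʳ (solve 3 (λ x a b → x :- (a :+ b) := (x :- a) :- b) ≈refl x a b) d))))

      reflect : ∀ a → Generic (λ z → ¬ (X [ β ]) (a - z))
      reflect a b ε ε≉0 = subBall (- B.centre) B.radius B.radius≉0
          (∣-respʳ (solve 2 (λ c b → :- (c :- :- b) := (:- c) :- b) ≈refl B.centre b) (∣-neg B.centre-in)) B.radius-in
          (λ z h → B.inside (- z) (∣-respʳ (solve 2 (λ c z → :- (z :- :- c) := (:- z) :- c) ≈refl B.centre z) (∣-neg h)))
        where module B = SubBall (translate a (- b) ε ε≉0)

      module _ (ε : C) (ε≉0 : ε ≉ 0#) where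

        Free : ∀ {n} → (Fin n → C) → Set (c ⊔ ℓ)
        Free b = ∀ j j′ → j ≢ j′ → ∀ i → ¬ (X [ β ]) ((f i + b j) - b j′)

        free : ∀ n → Σ (Fin n → C) λ b → (∀ j → ε ∣ b j) × Free b
        free zero = (λ ()) , (λ ()) , λ ()
        free (suc n) = extend (free n)
          where
          extend : (Σ (Fin n → C) λ b → (∀ j → ε ∣ b j) × Free b) → Σ (Fin (suc n) → C) λ b → (∀ j → ε ∣ b j) × Free b
          extend (b , b-in , fr) = y ∷ᵥ b , y∷b-in , y∷b-free
            where
            -- The new shift will occur both with a plus and with a minus sign, so translates and
            -- reflections have to be avoided together.
            module B = SubBall (generic-∀ n (λ j → generic-∀ K (λ i → generic-∩ (translate (f i - b j)) (reflect (f i + b j)))) 0# ε ε≉0)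
            y = B.centre
            y-free = B.inside y (∣-respʳ (≈sym (x-x≈0 y)) (∣0 _))
            y∷b-in : ∀ j → ε ∣ (y ∷ᵥ b) j
            y∷b-in zero = ∣-respʳ (solve 1 (λ y → y :- con (+ 0) := y) ≈refl y) B.centre-in
            y∷b-in (suc j) = b-in j
            y∷b-free : Free (y ∷ᵥ b)
            y∷b-free zero zero ne = contradiction ≡.refl ne
            y∷b-free zero (suc j′) ne i p = proj₁ (y-free j′ i) (X-resp (solve 3 (λ f y b → (f :+ y) :- b := (f :- b) :+ y) ≈refl (f i) y (b j′)) p)
            y∷b-free (suc j) zero ne i p = proj₂ (y-free j i) p
            y∷b-free (suc j) (suc j′) ne = fr j j′ (ne ∘ ≡.cong suc)

      contra : ¬ (Σ C λ ε → ε ≉ 0# × Apart (Mod (ε ∣_)) f)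
      contra (ε , ε≉0 , apart) = go (free ε ε≉0 K)
        where
        go : ¬ (Σ (Fin K → C) λ b → (∀ j → ε ∣ b j) × Free ε ε≉0 b)
        go (b , b-in , fr) = proj₂ bound (λ i → f i ∷ ε ∷ []) (λ j → b j ∷ β) λ i j → f i + b j ,
            (λ i′ → mk⇔ (row i j i′) (λ { ≡.refl → ∣-respʳ (solve 2 (λ x y → y := (x :+ y) :- x) ≈refl (f i) (b j)) (b-in j) })) ,
            (λ j′ → mk⇔ (col i j j′) (λ { ≡.refl → X-resp (solve 2 (λ x y → x := (x :+ y) :- y) ≈refl (f i) (b j)) (fX i) }))
          where
          row : ∀ i j i′ → ε ∣ (f i + b j) - f i′ → i′ ≡ i
          row i j i′ h with i′ Fin.≟ i
          ... | yes eq = eq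
          ... | no ne = contradiction (∣-respʳ (solve 3 (λ x y z → y :- ((z :+ y) :- x) := x :- z) ≈refl (f i′) (b j) (f i)) (∣-minus (b-in j) h)) (apart i′ i ne)
          col : ∀ i j j′ → (X [ β ]) ((f i + b j) - b j′) → j′ ≡ j
          col i j j′ h with j Fin.≟ j′
          ... | yes eq = ≡.sym eq
          ... | no ne = contradiction h (fr j j′ ne i)

  fat-union : ∀ n (D : Fin n → Fm 1) a ε → ε ≉ 0# → (∀ x → ε ∣ x - a → ∃ λ i → ⟦ D i ⟧ (x ∷ [])) →
    ∃ λ i → SubBall a ε (λ x → ⟦ D i ⟧ (x ∷ []))
  fat-union zero D a ε ε≉0 cover = case cover a (∣-respʳ (≈sym (x-x≈0 a)) (∣0 ε)) of λ ()
  fat-union (suc n) D a ε ε≉0 cover = go (Germs.dichotomy (D zero) a ε ε≉0)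
    where
    go : SubBall a ε (λ x → ⟦ D zero ⟧ (x ∷ [])) ⊎ SubBall a ε (λ x → ¬ ⟦ D zero ⟧ (x ∷ [])) → ∃ λ i → SubBall a ε (λ x → ⟦ D i ⟧ (x ∷ []))
    go (inj₁ B) = zero , B
    go (inj₂ B) = let (i , B′) = fat-union n (D ∘ suc) (SubBall.centre B) (SubBall.radius B) (SubBall.radius≉0 B)
                        (λ x h → tail x (SubBall.inside B x h) (cover x (SubBall.⊆ball B h)))
                  in suc i , shrink-ball B B′
      where
      tail : ∀ x → ¬ ⟦ D zero ⟧ (x ∷ []) → (∃ λ i → ⟦ D i ⟧ (x ∷ [])) → ∃ λ i → ⟦ D (suc i) ⟧ (x ∷ [])
      tail x n (zero , h) = contradiction h n
      tail x n (suc i , h) = i , h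

  baire-union : ∀ {n} (W : Fin n → Fm 2) → (∀ i → Monotone (W i)) → ∀ a ε → ε ≉ 0# →
    (∀ x → ε ∣ x - a → ∃ λ i → Σ C λ γ → γ ≉ 0# × ⟦ W i ⟧ (x ∷ γ ∷ [])) →
    ∃ λ i → Σ C λ γ → γ ≉ 0# × SubBall a ε (λ x → ⟦ W i ⟧ (x ∷ γ ∷ []))
  baire-union {n} W mono a ε ε≉0 cover = go (baire (⋁ W) (λ g h → let (i , h′) = ⋁-elim W h in ⋁-intro W i (mono i g h′)) a ε ε≉0
      (λ x h → let (i , γ , γ≉0 , w) = cover x h in γ , γ≉0 , ⋁-intro W i w))
    where
    go : (Σ C λ γ → γ ≉ 0# × SubBall a ε (λ x → ⟦ ⋁ W ⟧ (x ∷ γ ∷ []))) → ∃ λ i → Σ C λ γ → γ ≉ 0# × SubBall a ε (λ x → ⟦ W i ⟧ (x ∷ γ ∷ []))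
    go (γ , γ≉0 , B) = let (i , B′) = fat-union n (λ i → atom (W i) (v₀ ∷ cst γ ∷ [])) B.centre B.radius B.radius≉0
                             (λ x h → ⋁-elim W (B.inside x h))
                       in i , γ , γ≉0 , shrink-ball B B′
      where module B = SubBall B

  InBox : ∀ {m} → C → Vec C m → Vec C m → Set (c ⊔ ℓ)
  InBox ε a q = Pointwise (λ x y → ε ∣ x - y) q a

  inBox-mono : ∀ {m ε ε′} {a q : Vec C m} → ε ∣ ε′ → InBox ε′ a q → InBox ε a q
  inBox-mono h = Pointwise.map (∣-trans h)

  inBox-refl : ∀ {m ε} {a : Vec C m} → InBox ε a a
  inBox-refl = Pointwise.refl (∣-respʳ (≈sym (x-x≈0 _)) (∣0 _))

  record SubBox {m} (a : Vec C m) (ε : C) (P : Vec C m → Set (c ⊔ ℓ)) : Set (c ⊔ ℓ) where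
    constructor subBox
    field
      centre : Vec C m
      radius : C
      radius≉0 : radius ≉ 0#
      centre-in : InBox ε a centre
      radius-in : ε ∣ radius
      inside : ∀ q → InBox radius centre q → P q

  Monotoneᵇ : ∀ {m} → Fm (suc m) → Set (c ⊔ ℓ)
  Monotoneᵇ {m} W = ∀ {γ γ′} {q : Vec C m} → γ ∣ γ′ → ⟦ W ⟧ (γ ∷ q) → ⟦ W ⟧ (γ′ ∷ q)

  -- The one-variable slices of the cover are bad at fewer than K points, so K fixed points suffice for all slices:
  -- this makes the induction on the dimension possible.
  box-baire : ∀ m {n} (W : Fin n → Fm (suc m)) → (∀ i → Monotoneᵇ (W i)) → ∀ a ε → ε ≉ 0# →
    (∀ q → InBox ε a q → ∃ λ i → Σ C λ γ → γ ≉ 0# × ⟦ W i ⟧ (γ ∷ q)) →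
    ∃ λ i → Σ C λ γ → γ ≉ 0# × SubBox a ε (λ q → ⟦ W i ⟧ (γ ∷ q))
  box-baire zero W mono [] ε ε≉0 cover = let (i , γ , γ≉0 , w) = cover [] [] in
    i , γ , γ≉0 , subBox [] ε ε≉0 [] ∣-refl λ { [] [] → w }
  box-baire (suc m) {n} W mono (a₀ ∷ â) ε ε≉0 cover = fromBound (nonfat⇒finite bad)
    where
    -- One γ is both the index in the cover and the radius of the interval around s. The result is
    -- again monotone in a single γ, as the induction requires.
    good : Fin n → Fm (2 ℕ.+ m)
    good i = All (atom↓ 3 (W i) (v₁ ∷ (v₂ ⊞ v₁ ⊠ v₀) ∷ []))

    someGood : Fm (suc m)
    someGood = ⋁ (λ i → Ex ((∼ (v₀ ≋ cst 0#)) ⩓ good i))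

    bad : Fm (suc m)
    bad = (cst ε divides (v₀ ⊟′ cst a₀)) ⩓ (∼ someGood)

    good-mono : ∀ i {γ γ′ s} {q : Vec C m} → γ ∣ γ′ → ⟦ good i ⟧ (γ ∷ s ∷ q) → ⟦ good i ⟧ (γ′ ∷ s ∷ q)
    good-mono i {γ} {γ′} {s} (k , e) h u = mono i (k , e) (resp≈ (W i) (≈refl ∷ +-congˡ (≈trans (≈sym (*-assoc _ _ _)) (*-congʳ (≈sym e))) ∷ ≈ᵛ-refl) (h (k * u)))

    bad-nonfat : ∀ q → InBox ε â q → Nonfat (bad [ q ])
    bad-nonfat q q-in a ρ ρ≉0 allBad = go (baire-union slice (λ i g h → out i (mono i g (into i h))) a ρ ρ≉0 slice-cover)
      where
      slice : Fin n → Fm 2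
      slice i = atom (W i) (v₁ ∷ v₀ ∷ csts q)
      into : ∀ i {x γ} → ⟦ slice i ⟧ (x ∷ γ ∷ []) → ⟦ W i ⟧ (γ ∷ x ∷ q)
      into i {x} {γ} = ≡.subst (λ q → ⟦ W i ⟧ (γ ∷ x ∷ q)) (csts-sem q _)
      out : ∀ i {x γ} → ⟦ W i ⟧ (γ ∷ x ∷ q) → ⟦ slice i ⟧ (x ∷ γ ∷ [])
      out i {x} {γ} = ≡.subst (λ q → ⟦ W i ⟧ (γ ∷ x ∷ q)) (≡.sym (csts-sem q _))
      slice-cover : ∀ x → ρ ∣ x - a → ∃ λ i → Σ C λ γ → γ ≉ 0# × ⟦ slice i ⟧ (x ∷ γ ∷ [])
      slice-cover x h = let (i , γ , γ≉0 , w) = cover (x ∷ q) (proj₁ (allBad x h) ∷ q-in) in i , γ , γ≉0 , out i w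
      go : ¬ (∃ λ i → Σ C λ γ → γ ≉ 0# × SubBall a ρ (λ x → ⟦ slice i ⟧ (x ∷ γ ∷ [])))
      go (i , γ , γ≉0 , B) = proj₂ (allBad B.centre B.centre-in) (⋁-intro (λ i → Ex ((∼ (v₀ ≋ cst 0#)) ⩓ good i)) i
          (B.radius * γ , (*-≉0 B.radius≉0 γ≉0 ∘ lower) , λ u → mono i (a∣b*a γ B.radius)
            (into i (B.inside (B.centre + (B.radius * γ) * u) (γ * u ,
              solve 4 (λ c r g u → (c :+ (r :* g) :* u) :- c := r :* (g :* u)) ≈refl B.centre B.radius γ u)))))
        where module B = SubBall B

    fromBound : (Σ ℕ λ K → ∀ q → Nonfat (bad [ q ]) → (f : Fin K → C) → (∀ i → (bad [ q ]) (f i)) → ¬ Apart _≈_ f) →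
      ∃ λ i → Σ C λ γ → γ ≉ 0# × SubBox (a₀ ∷ â) ε (λ q → ⟦ W i ⟧ (γ ∷ q))
    fromBound (K , finite) = assemble (box-baire m W′ W′-mono â ε ε≉0 cover′)
      where
      s : Fin K → C
      s j = a₀ + ε * ϖ ^ toℕ j
      s-in : ∀ j → ε ∣ s j - a₀
      s-in j = ϖ ^ toℕ j , solve 2 (λ a y → (a :+ y) :- a := y) ≈refl a₀ (ε * ϖ ^ toℕ j)
      s-apart : Apart _≈_ s
      s-apart i j ne eq = powers-distinct i j ne (≈⇒-≈0 (*-cancelˡ ε≉0 (+-cancelˡ a₀ _ _ eq)))
      index₁ : Fin (n ℕ.* K) → Fin n
      index₁ u = proj₁ (Fin.remQuot {n} K u)
      index₂ : Fin (n ℕ.* K) → Fin K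
      index₂ u = proj₂ (Fin.remQuot {n} K u)
      W′ : Fin (n ℕ.* K) → Fm (suc m)
      W′ u = atom↓ 1 (good (index₁ u)) (v₀ ∷ cst (s (index₂ u)) ∷ [])
      W′-mono : ∀ u → Monotoneᵇ (W′ u)
      W′-mono u = good-mono (index₁ u)
      cover′ : ∀ q → InBox ε â q → ∃ λ u → Σ C λ γ → γ ≉ 0# × ⟦ W′ u ⟧ (γ ∷ q)
      cover′ q q-in = go (¬∀⇒∃¬ {p = c ⊔ ℓ} {x = Level.zero} em (λ allBad → finite q (bad-nonfat q q-in) s allBad s-apart))
        where
        go : (∃ λ j → ¬ (bad [ q ]) (s j)) → ∃ λ u → Σ C λ γ → γ ≉ 0# × ⟦ W′ u ⟧ (γ ∷ q)
        go (j , nb) = go′ (⋁-elim (λ i → Ex ((∼ (v₀ ≋ cst 0#)) ⩓ good i)) (stable em λ ng → nb (s-in j , ng)))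
          where
          go′ : (∃ λ i → Σ C λ γ → ¬ Lift c (γ ≈ 0#) × ⟦ good i ⟧ (γ ∷ s j ∷ q)) → ∃ λ u → Σ C λ γ → γ ≉ 0# × ⟦ W′ u ⟧ (γ ∷ q)
          go′ (i , γ , γ≉0 , g) = Fin.combine i j , γ , (γ≉0 ∘ lift) ,
            ≡.subst (λ ij → ⟦ good (proj₁ ij) ⟧ (γ ∷ s (proj₂ ij) ∷ q)) (≡.sym (Finₚ.remQuot-combine {n} {K} i j)) g
      assemble : (∃ λ u → Σ C λ γ → γ ≉ 0# × SubBox â ε (λ q → ⟦ W′ u ⟧ (γ ∷ q))) → _
      assemble (u , γ , γ≉0 , B) = index₁ u , γ , γ≉0 , subBox (s (index₂ u) ∷ B.centre) (B.radius * γ) (*-≉0 B.radius≉0 γ≉0)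
          (s-in (index₂ u) ∷ B.centre-in) (∣-*ʳ γ B.radius-in)
          λ { (x ∷ q) (x-in ∷ q-in) → inside x q (∣-trans (a∣b*a _ _) x-in) (inBox-mono (a∣a*b _ _) q-in) }
        where
        module B = SubBox B
        inside : ∀ x q → γ ∣ x - s (index₂ u) → InBox B.radius B.centre q → ⟦ W (index₁ u) ⟧ (γ ∷ x ∷ q)
        inside x q (k , e) q-in = resp≈ (W (index₁ u)) (≈refl ∷ (≈trans (+-congˡ (≈sym e)) (solve 2 (λ s x → s :+ (x :- s) := x) ≈refl (s (index₂ u)) x)) ∷ ≈ᵛ-refl)
          (B.inside q q-in k)

-- Non-units of a valuation ring

module LocalRing {c ℓ} (R : CommutativeRing c ℓ) (em : ExcludedMiddle (c ⊔ ℓ)) (dom : IntegralDomain R) (val : ValuationRing R) where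
  private
    open module D = Divisibility R
    open D.Domain em dom

  nonunit-resp : ∀ {x y} → x ≈ y → ¬ Unit x → ¬ Unit y
  nonunit-resp e h u = h (Unit-resp (≈sym e) u)

  nonunit-∣ : ∀ {x y} → x ∣ y → ¬ Unit x → ¬ Unit y
  nonunit-∣ d h u = h (∣Unit d u)

  nonunit-0 : ¬ Unit 0#
  nonunit-0 u = Unit-≉0 u ≈refl

  nonunit-neg : ∀ {x} → ¬ Unit x → ¬ Unit (- x)
  nonunit-neg h = nonunit-∣ (∣-neg ∣-refl) h

  nonunit-+ : ∀ {x y} → ¬ Unit x → ¬ Unit y → ¬ Unit (x + y)
  nonunit-+ {x} {y} h g = go (val x y)
    where
    go : x ∣ y ⊎ y ∣ x → ¬ Unit (x + y)
    go (inj₁ d) = nonunit-∣ (∣-+ ∣-refl d) h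
    go (inj₂ d) = nonunit-∣ (∣-+ d ∣-refl) g

  nonunit-minus : ∀ {x y} → ¬ Unit x → ¬ Unit y → ¬ Unit (x - y)
  nonunit-minus h g = nonunit-+ h (nonunit-neg g)

  unit+nonunit : ∀ {x y} → Unit x → ¬ Unit y → Unit (x + y)
  unit+nonunit {x} {y} u h = stable em λ n → nonunit-minus n h (Unit-resp (solve 2 (λ x y → x := (x :+ y) :- y) ≈refl x y) u)

  unit-factor : ∀ {x y} → Unit (x * y) → Unit x
  unit-factor = ∣Unit (a∣a*b _ _)

  ∤⇒∣ : ∀ {x y} → x ∤ y → y ∣ x
  ∤⇒∣ {x} {y} h = [ (λ d → contradiction d h) , id ]′ (val x y)

  -- An entry of least value, which divides all the others. The second alternative arises only for
  -- the empty family.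
  content : ∀ {n} (d : Fin n → C) → Σ C λ η → (∀ j → η ∣ d j) × ((∃ λ i → η ≡ d i) ⊎ (∀ j → d j ≈ 0#))
  content {zero} d = 1# , (λ ()) , inj₂ λ ()
  content {suc n} d = go (content (d ∘ suc))
    where
    go : (Σ C λ η → (∀ j → η ∣ d (suc j)) × ((∃ λ i → η ≡ d (suc i)) ⊎ (∀ j → d (suc j) ≈ 0#))) → _
    go (η , div , inj₂ z) = d zero , (λ { zero → ∣-refl ; (suc j) → ∣-respʳ (≈sym (z j)) (∣0 _) }) , inj₁ (zero , ≡.refl)
    go (η , div , inj₁ (i , eq)) = go′ (val (d zero) η)
      where
      go′ : d zero ∣ η ⊎ η ∣ d zero → _
      go′ (inj₁ h) = d zero , (λ { zero → ∣-refl ; (suc j) → ∣-trans h (div j) }) , inj₁ (zero , ≡.refl)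
      go′ (inj₂ h) = η , (λ { zero → h ; (suc j) → div j }) , inj₁ (suc i , eq)

-- The open image theorem for contractive perturbations of the identity

module OpenImage {c ℓ} (R : CommutativeRing c ℓ) (em : ExcludedMiddle (c ⊔ ℓ)) (dom : IntegralDomain R) (dp : DPMinimal R)
    (val : ValuationRing R) (ϖ : CommutativeRing.Carrier R)
    (ϖ≉0 : CommutativeRing._≉_ R ϖ (CommutativeRing.0# R)) (ϖ-nonunit : ¬ IsUnit R ϖ) (n : ℕ) where
  open ValuationTopology R em dom dp ϖ ϖ≉0 ϖ-nonunit
  open LocalRing R em dom val

  InM : Vec C n → Set (c ⊔ ℓ)
  InM x = ∀ i → ¬ Unit (lookup x i)

  Map : Set c
  Map = Fin n → Tm n

  -- g is the identity plus a contraction on 𝔐ⁿ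
  Contracting : Map → Set (c ⊔ ℓ)
  Contracting g = ∀ {x y} η → InM x → InM y → (∀ j → η ∣ lookup x j - lookup y j) → ∀ i →
    Σ C λ w → ¬ Unit w × ⟦ g i ⟧ᵗ x - ⟦ g i ⟧ᵗ y ≈ (lookup x i - lookup y i) + η * w

  OpenMap : Map → Set (c ⊔ ℓ)
  OpenMap g = Σ (Vec C n) λ a → Σ C λ δ → δ ≉ 0# × (∀ q → InBox δ a q → Σ (Vec C n) λ x → InM x × (∀ i → ⟦ g i ⟧ᵗ x ≈ lookup q i))

  contracting-∣ : ∀ {g} → Contracting g → ∀ {x y ε} → InM x → InM y → (∀ j → ε ∣ lookup x j - lookup y j) → ∀ i → ε ∣ ⟦ g i ⟧ᵗ x - ⟦ g i ⟧ᵗ y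
  contracting-∣ cg {ε = ε} xM yM h i = let (w , _ , e) = cg ε xM yM h i in ∣-respʳ (≈sym e) (∣-+ (h i) (a∣a*b ε w))

  -- Let η be an entry of x - y of least value, at index i. There the values of g differ by η times
  -- the unit 1 + w, so ε divides η and hence every entry.
  isometry : ∀ {g} → Contracting g → ∀ {x y ε} → InM x → InM y → (∀ i → ε ∣ ⟦ g i ⟧ᵗ x - ⟦ g i ⟧ᵗ y) → ∀ j → ε ∣ lookup x j - lookup y j
  isometry {g} cg {x} {y} {ε} xM yM h = go (content (λ j → lookup x j - lookup y j))
    where
    go : (Σ C λ η → (∀ j → η ∣ lookup x j - lookup y j) × ((∃ λ i → η ≡ lookup x i - lookup y i) ⊎ (∀ j → lookup x j - lookup y j ≈ 0#))) →
      ∀ j → ε ∣ lookup x j - lookup y j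
    go (η , div , inj₂ z) j = ∣-respʳ (≈sym (z j)) (∣0 ε)
    go (η , div , inj₁ (i , ≡.refl)) j = let (w , w-nu , e) = cg η xM yM div i in
      ∣-trans (∣-trans (h i) (proj₁ (unit+nonunit Unit-1 w-nu) ,
        ≈trans (≈sym (*-identityʳ η)) (≈trans (*-congˡ (≈sym (proj₂ (unit+nonunit Unit-1 w-nu))))
          (≈trans (≈sym (*-assoc _ _ _)) (*-congʳ (≈sym (≈trans e (solve 2 (λ h w → h :+ h :* w := h :* (con (+ 1) :+ w)) ≈refl η w))))))))
        (div j)

  wk : ∀ m → Tm n → Tm (n ℕ.+ m)
  wk m (var i) = var (i Fin.↑ˡ m)
  wk m (cst a) = cst a
  wk m (s ⊞ t) = wk m s ⊞ wk m t
  wk m (s ⊠ t) = wk m s ⊠ wk m t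
  wk m (⊟ t) = ⊟ wk m t

  wk-sem : ∀ {m} (t : Tm n) x (ρ : Vec C m) → ⟦ wk m t ⟧ᵗ (x Vec.++ ρ) ≡ ⟦ t ⟧ᵗ x
  wk-sem (var i) x ρ = Vecₚ.lookup-++ˡ x ρ i
  wk-sem (cst a) x ρ = ≡.refl
  wk-sem (s ⊞ t) x ρ = ≡.cong₂ _+_ (wk-sem s x ρ) (wk-sem t x ρ)
  wk-sem (s ⊠ t) x ρ = ≡.cong₂ _*_ (wk-sem s x ρ) (wk-sem t x ρ)
  wk-sem (⊟ t) x ρ = ≡.cong -_ (wk-sem t x ρ)

  inBox-tabulate : ∀ {m ε} {b q : Vec C m} → (∀ i → ε ∣ lookup q i - lookup b i) → InBox ε b q
  inBox-tabulate {b = []} {[]} h = []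
  inBox-tabulate {b = b ∷ bs} {q ∷ qs} h = h zero ∷ inBox-tabulate (h ∘ suc)

  module Step (g g′ : Map) (cg : Contracting g) (cg′ : Contracting g′) (k : Fin n)
      (agree : ∀ i → i ≢ k → ∀ x → ⟦ g i ⟧ᵗ x ≈ ⟦ g′ i ⟧ᵗ x)
      (a : Vec C n) (δ : C) (δ≉0 : δ ≉ 0#)
      (solveg : ∀ q → InBox δ a q → Σ (Vec C n) λ x → InM x × (∀ i → ⟦ g i ⟧ᵗ x ≈ lookup q i)) where
    private
      Image : Fm 1 → C → Vec C n → Set (c ⊔ ℓ)
      Image θ y q = Σ (Vec C n) λ x → InM x × (∀ i → i ≢ k → ⟦ g i ⟧ᵗ x ≈ lookup q i) × ⟦ θ ⟧ (⟦ g k ⟧ᵗ x ∷ []) × ⟦ g′ k ⟧ᵗ x ≈ y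

      qᵥ : Fin n → Tm (n ℕ.+ suc n)
      qᵥ i = var (n Fin.↑ʳ suc i)

      eqAt : ∀ i → Dec (i ≡ k) → Fm (n ℕ.+ suc n)
      eqAt i (yes _) = cst 0# ≋ cst 0#
      eqAt i (no _) = wk (suc n) (g i) ≋ qᵥ i

      inM : Fin n → Fm (n ℕ.+ suc n)
      inM i = ∼ (var (i Fin.↑ˡ suc n) divides cst 1#)

      body : Fm 1 → Fm (n ℕ.+ suc n)
      body θ = ⋀ inM ⩓ ⋀ (λ i → eqAt i (i Fin.≟ k)) ⩓ atom θ (wk (suc n) (g k) ∷ []) ⩓ wk (suc n) (g′ k) ≋ var (n Fin.↑ʳ zero)

      image : Fm 1 → Fm (suc n)
      image θ = exs n (body θ)

      image-intro : ∀ θ {y q} → Image θ y q → ⟦ image θ ⟧ (y ∷ q)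
      image-intro θ {y} {q} (x , xM , eqs , th , e) = exs-intro n (body θ) x
          (⋀-intro inM (λ i d → xM i (let (k , e) = ∣-resp (reflexive (Vecₚ.lookup-++ˡ x (y ∷ q) i)) ≈refl d in k , ≈sym e)) ,
           ⋀-intro (λ i → eqAt i (i Fin.≟ k)) (λ i → eq-intro i (i Fin.≟ k)) ,
           ≡.subst (λ z → ⟦ θ ⟧ (z ∷ [])) (≡.sym (wk-sem (g k) x (y ∷ q))) th ,
           lift (≈trans (reflexive (wk-sem (g′ k) x (y ∷ q))) (≈trans e (reflexive (≡.sym (Vecₚ.lookup-++ʳ x (y ∷ q) zero))))))
        where
        eq-intro : ∀ i d → ⟦ eqAt i d ⟧ (x Vec.++ y ∷ q)
        eq-intro i (yes _) = lift ≈refl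
        eq-intro i (no ne) = lift (≈trans (reflexive (wk-sem (g i) x (y ∷ q))) (≈trans (eqs i ne) (reflexive (≡.sym (Vecₚ.lookup-++ʳ x (y ∷ q) (suc i))))))

      image-elim : ∀ θ {y q} → ⟦ image θ ⟧ (y ∷ q) → Image θ y q
      image-elim θ {y} {q} h = go (exs-elim n (body θ) h)
        where
        eq-elim : ∀ x i d → i ≢ k → ⟦ eqAt i d ⟧ (x Vec.++ y ∷ q) → ⟦ g i ⟧ᵗ x ≈ lookup q i
        eq-elim x i (yes eq) ne h = contradiction eq ne
        eq-elim x i (no _) _ (lift h) = ≈trans (reflexive (≡.sym (wk-sem (g i) x (y ∷ q)))) (≈trans h (reflexive (Vecₚ.lookup-++ʳ x (y ∷ q) (suc i))))
        go : (Σ (Vec C n) λ x → ⟦ body θ ⟧ (x Vec.++ y ∷ q)) → Image θ y q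
        go (x , ms , eqs , th , lift e) = x ,
          (λ i u → ⋀-elim inM ms i (proj₁ u , ≈sym (≈trans (*-congʳ (reflexive (Vecₚ.lookup-++ˡ x (y ∷ q) i))) (proj₂ u)))) ,
          (λ i ne → eq-elim x i (i Fin.≟ k) ne (⋀-elim (λ i → eqAt i (i Fin.≟ k)) eqs i)) ,
          ≡.subst (λ z → ⟦ θ ⟧ (z ∷ [])) (wk-sem (g k) x (y ∷ q)) th ,
          ≈trans (reflexive (≡.sym (wk-sem (g′ k) x (y ∷ q)))) (≈trans e (reflexive (Vecₚ.lookup-++ʳ x (y ∷ q) zero)))

      aₖ = lookup a k

      near : Fm 1
      near = cst δ divides (v₀ ⊟′ cst aₖ)

      E : Fm (suc n)
      E = image near

      interior : Fm (2 ℕ.+ n)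
      interior = All (atom↓ 3 E ((v₁ ⊞ v₂ ⊠ v₀) ∷ []))

      interior-mono : ∀ {y γ γ′ q} → γ ∣ γ′ → ⟦ interior ⟧ (y ∷ γ ∷ q) → ⟦ interior ⟧ (y ∷ γ′ ∷ q)
      interior-mono (d , e) h u = resp≈ E (+-congˡ (≈trans (≈sym (*-assoc _ _ _)) (*-congʳ (≈sym e))) ∷ ≈ᵛ-refl) (h (d * u))

      boundary : Fm (suc n)
      boundary = E ⩓ (∼ Ex ((∼ (v₀ ≋ cst 0#)) ⩓ atom↓ 2 interior (v₁ ∷ v₀ ∷ [])))

      -- A ball inside the boundary would lie in `E` and make its own centre an interior point.
      boundary-nonfat : ∀ q → Nonfat (boundary [ q ])
      boundary-nonfat q b ε ε≉0 h = proj₂ (h b (∣-respʳ (≈sym (x-x≈0 b)) (∣0 ε))) (ε , (ε≉0 ∘ lower) ,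
        λ u → proj₁ (h (b + ε * u) (u , solve 2 (λ b y → (b :+ y) :- b := y) ≈refl b (ε * u))))

      bound = nonfat⇒finite boundary
      K = proj₁ bound

      s : Fin K → C
      s j = aₖ + δ * ϖ ^ toℕ j
      s-in : ∀ j → δ ∣ s j - aₖ
      s-in j = ϖ ^ toℕ j , solve 2 (λ a y → (a :+ y) :- a := y) ≈refl aₖ (δ * ϖ ^ toℕ j)
      s-apart : Apart _≈_ s
      s-apart i j ne eq = powers-distinct i j ne (≈⇒-≈0 (*-cancelˡ δ≉0 (+-cancelˡ aₖ _ _ eq)))

      isPoint : Fin K → Fm 1
      isPoint j = v₀ ≋ cst (s j)

      W : Fin K → Fm (suc n)
      W j = Ex (atom↓ 2 (image (isPoint j)) (v₀ ∷ []) ⩓ interior)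

      W-mono : ∀ j → Monotoneᵇ (W j)
      W-mono j h (y , p , q) = y , p , interior-mono h q

      inBox-lookup : ∀ {m ε} {b q : Vec C m} → InBox ε b q → ∀ i → ε ∣ lookup q i - lookup b i
      inBox-lookup h i = Pointwise.lookup h i

      update-in : ∀ {ε} {b q : Vec C n} z → (∀ i → i ≢ k → ε ∣ lookup q i - lookup b i) → ε ∣ z - lookup b k → InBox ε b (q Vec.[ k ]≔ z)
      update-in {ε} {b} {q} z h hz = inBox-tabulate (λ i → go i (i Fin.≟ k))
        where
        go : ∀ i → Dec (i ≡ k) → ε ∣ lookup (q Vec.[ k ]≔ z) i - lookup b i
        go i (yes ≡.refl) = ≡.subst (λ w → ε ∣ w - lookup b k) (≡.sym (Vecₚ.lookup∘updateAt k q)) hz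
        go i (no ne) = ≡.subst (λ w → ε ∣ w - lookup b i) (≡.sym (Vecₚ.lookup∘updateAt′ i k ne q)) (h i ne)

      cover : ∀ q → InBox δ a q → ∃ λ j → Σ C λ γ → γ ≉ 0# × ⟦ W j ⟧ (γ ∷ q)
      cover q q-in = go (¬∀⇒∃¬ {p = c ⊔ ℓ} {x = Level.zero} em (λ allBad → proj₂ bound q (boundary-nonfat q) y allBad y-apart))
        where
        pre : ∀ j → Σ (Vec C n) λ x → InM x × (∀ i → ⟦ g i ⟧ᵗ x ≈ lookup (q Vec.[ k ]≔ s j) i)
        pre j = solveg (q Vec.[ k ]≔ s j) (update-in (s j) (λ i _ → inBox-lookup q-in i) (s-in j))
        x : Fin K → Vec C n
        x j = proj₁ (pre j)
        x-M : ∀ j → InM (x j)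
        x-M j = proj₁ (proj₂ (pre j))
        x-other : ∀ j i → i ≢ k → ⟦ g i ⟧ᵗ (x j) ≈ lookup q i
        x-other j i ne = ≈trans (proj₂ (proj₂ (pre j)) i) (reflexive (Vecₚ.lookup∘updateAt′ i k ne q))
        x-k : ∀ j → ⟦ g k ⟧ᵗ (x j) ≈ s j
        x-k j = ≈trans (proj₂ (proj₂ (pre j)) k) (reflexive (Vecₚ.lookup∘updateAt k q))
        y : Fin K → C
        y j = ⟦ g′ k ⟧ᵗ (x j)
        y-apart : Apart _≈_ y
        -- The modulus 0 turns divisibility into equality: `isometry` then says that g′ is
        -- injective, and `contracting-∣` that g takes equal values at equal points.
        y-apart j j′ ne eq = s-apart j j′ ne (≈trans (≈sym (x-k j)) (≈trans (-≈0⇒≈ (zero∣ (contracting-∣ {g} cg (x-M j) (x-M j′)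
            (isometry {g′} cg′ (x-M j) (x-M j′) same) k))) (x-k j′)))
          where
          zero∣ : ∀ {z} → 0# ∣ z → z ≈ 0#
          zero∣ (q , e) = ≈trans e (zeroˡ q)
          same′ : ∀ i → Dec (i ≡ k) → ⟦ g′ i ⟧ᵗ (x j) ≈ ⟦ g′ i ⟧ᵗ (x j′)
          same′ i (yes ≡.refl) = eq
          same′ i (no ne) = ≈trans (≈sym (agree i ne (x j))) (≈trans (x-other j i ne) (≈trans (≈sym (x-other j′ i ne)) (agree i ne (x j′))))
          same : ∀ i → 0# ∣ ⟦ g′ i ⟧ᵗ (x j) - ⟦ g′ i ⟧ᵗ (x j′)
          same i = ∣-respʳ (≈sym (≈⇒-≈0 (same′ i (i Fin.≟ k)))) ∣-refl
        y∈E : ∀ j → ⟦ E ⟧ (y j ∷ q)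
        y∈E j = image-intro near (x j , x-M j , x-other j , ∣-respʳ (minus-cong (≈sym (x-k j)) ≈refl) (s-in j) , ≈refl)
        go : (∃ λ j → ¬ (boundary [ q ]) (y j)) → ∃ λ j → Σ C λ γ → γ ≉ 0# × ⟦ W j ⟧ (γ ∷ q)
        go (j , nb) = let (γ , γ≉0 , int) = stable em (λ ni → nb (y∈E j , ni)) in
          j , γ , (γ≉0 ∘ lift) , y j , image-intro (isPoint j) (x j , x-M j , x-other j , lift (x-k j) , ≈refl) , int

    -- Fixing all coordinates but the k-th leaves a fibre of g, whose image `E` under g′ k has fewer
    -- than K non-interior points. So one of K fixed points is sent into the interior, with a radius
    -- made uniform on a box by `box-baire`. By `isometry` this interior point moves little when q
    -- moves little.
    open-step : OpenMap g′
    open-step = go (box-baire n W W-mono a δ δ≉0 cover)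
      where
      go : (∃ λ j → Σ C λ γ → γ ≉ 0# × SubBox a δ (λ q → ⟦ W j ⟧ (γ ∷ q))) → OpenMap g′
      go (j , γ , γ≉0 , B) = go₀ (B.inside b inBox-refl)
        where
        module B = SubBox B
        b = B.centre
        ε = B.radius * γ
        go₀ : ⟦ W j ⟧ (γ ∷ b) → OpenMap g′
        go₀ (y₀ , im₀ , _) = go₁ (image-elim (isPoint j) im₀)
          where
          go₁ : Image (isPoint j) y₀ b → OpenMap g′
          go₁ (x₀ , x₀-M , x₀-other , lift x₀-k , x₀-y) = b Vec.[ k ]≔ y₀ , ε , *-≉0 B.radius≉0 γ≉0 , solution
            where
            solution : ∀ q → InBox ε (b Vec.[ k ]≔ y₀) q → Σ (Vec C n) λ x → InM x × (∀ i → ⟦ g′ i ⟧ᵗ x ≈ lookup q i)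
            solution q q-in = go₂ (B.inside q′ q′-in)
              where
              q-other : ∀ i → i ≢ k → ε ∣ lookup q i - lookup b i
              q-other i ne = ≡.subst (λ w → ε ∣ lookup q i - w) (Vecₚ.lookup∘updateAt′ i k ne b) (inBox-lookup q-in i)
              q-k : ε ∣ lookup q k - y₀
              q-k = ≡.subst (λ w → ε ∣ lookup q k - w) (Vecₚ.lookup∘updateAt k b) (inBox-lookup q-in k)
              -- `W j` imposes no condition on the k-th coordinate of its argument; resetting it to
              -- that of b keeps q′ in the box.
              q′ = q Vec.[ k ]≔ lookup b k
              q′-in : InBox B.radius b q′
              q′-in = update-in (lookup b k) (λ i ne → ∣-trans (a∣a*b _ _) (q-other i ne)) (∣-respʳ (≈sym (x-x≈0 _)) (∣0 _))
              q′-other : ∀ i → i ≢ k → lookup q′ i ≡ lookup q i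
              q′-other i ne = Vecₚ.lookup∘updateAt′ i k ne q
              go₂ : ⟦ W j ⟧ (γ ∷ q′) → Σ (Vec C n) λ x → InM x × (∀ i → ⟦ g′ i ⟧ᵗ x ≈ lookup q i)
              go₂ (y , im , int) = go₃ (image-elim (isPoint j) im)
                where
                go₃ : Image (isPoint j) y q′ → Σ (Vec C n) λ x → InM x × (∀ i → ⟦ g′ i ⟧ᵗ x ≈ lookup q i)
                go₃ (x , x-M , x-other , lift x-k , x-y) = go₄ close
                  where
                  near₀ : ∀ i → Dec (i ≡ k) → ε ∣ ⟦ g i ⟧ᵗ x - ⟦ g i ⟧ᵗ x₀
                  near₀ i (yes ≡.refl) = ∣-respʳ (≈sym (≈⇒-≈0 (≈trans x-k (≈sym x₀-k)))) (∣0 ε)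
                  near₀ i (no ne) = ∣-respʳ (minus-cong (≈sym (≈trans (x-other i ne) (reflexive (q′-other i ne)))) (≈sym (x₀-other i ne))) (q-other i ne)
                  close : γ ∣ lookup q k - y
                  close = ∣-trans (a∣b*a γ B.radius) (∣-respʳ (solve 3 (λ q y y₀ → (q :- y₀) :- (y :- y₀) := q :- y) ≈refl (lookup q k) y y₀)
                    (∣-minus q-k (∣-respʳ (minus-cong x-y x₀-y) (contracting-∣ {g′} cg′ x-M x₀-M (isometry {g} cg x-M x₀-M (λ i → near₀ i (i Fin.≟ k))) k))))
                  go₄ : γ ∣ lookup q k - y → Σ (Vec C n) λ x → InM x × (∀ i → ⟦ g′ i ⟧ᵗ x ≈ lookup q i)
                  go₄ (u , e) = go₅ (image-elim near (int u))
                    where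
                    go₅ : Image near (y + γ * u) q′ → Σ (Vec C n) λ x → InM x × (∀ i → ⟦ g′ i ⟧ᵗ x ≈ lookup q i)
                    go₅ (x′ , x′-M , x′-other , _ , x′-y) = x′ , x′-M , λ i → value i (i Fin.≟ k)
                      where
                      value : ∀ i → Dec (i ≡ k) → ⟦ g′ i ⟧ᵗ x′ ≈ lookup q i
                      value i (yes ≡.refl) = ≈trans x′-y (≈trans (+-congˡ (≈sym e)) (solve 2 (λ y q → y :+ (q :- y) := q) ≈refl y (lookup q k)))
                      value i (no ne) = ≈trans (≈sym (agree i ne x′)) (≈trans (x′-other i ne) (reflexive (q′-other i ne)))

  module _ (f : Map) (cf : Contracting f) where
    private
      choose : ∀ {k} i → Dec (toℕ i ℕ.< k) → Tm n
      choose i (yes _) = f i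
      choose i (no _) = var i

      -- Interpolates between the identity and f, so that each step changes a single coordinate.
      mixed : ℕ → Map
      mixed k i = choose i (toℕ i ℕ.<? k)

      mixed-contracting : ∀ k → Contracting (mixed k)
      mixed-contracting k {x} {y} η xM yM h i = go (toℕ i ℕ.<? k)
        where
        go : (d : Dec (toℕ i ℕ.< k)) → Σ C λ w → ¬ Unit w × ⟦ choose i d ⟧ᵗ x - ⟦ choose i d ⟧ᵗ y ≈ (lookup x i - lookup y i) + η * w
        go (yes _) = cf η xM yM h i
        go (no _) = 0# , nonunit-0 , ≈sym (≈trans (+-congˡ (zeroʳ η)) (+-identityʳ _))

      choose-agree : ∀ {k} i → toℕ i ≢ k → (d : Dec (toℕ i ℕ.< k)) (d′ : Dec (toℕ i ℕ.< suc k)) → choose i d ≡ choose i d′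
      choose-agree i ne (yes _) (yes _) = ≡.refl
      choose-agree i ne (no _) (no _) = ≡.refl
      choose-agree i ne (yes p) (no q) = contradiction (ℕₚ.m≤n⇒m≤1+n p) q
      choose-agree i ne (no p) (yes (s≤s q)) = contradiction (ℕₚ.≤∧≢⇒< q ne) p

      mixed-open : ∀ k → k ℕ.≤ n → OpenMap (mixed k)
      -- For the identity the box of radius ϖ around 0 serves, since it lies in 𝔐ⁿ.
      mixed-open zero _ = Vec.replicate n 0# , ϖ , ϖ≉0 , λ q q-in → q ,
          (λ i → nonunit-∣ (∣-respʳ (≈trans (+-congˡ (-‿cong (reflexive (Vecₚ.lookup-replicate i 0#)))) (≈trans (+-congˡ -0#≈0#) (+-identityʳ _))) (Pointwise.lookup q-in i)) ϖ-nonunit) ,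
          (λ i → value i q (toℕ i ℕ.<? 0))
        where
        value : ∀ i q (d : Dec (toℕ i ℕ.< 0)) → ⟦ choose i d ⟧ᵗ q ≈ lookup q i
        value i q (no _) = ≈refl
      mixed-open (suc k) k<n = go (mixed-open k (ℕₚ.<⇒≤ k<n))
        where
        κ : Fin n
        κ = Fin.fromℕ< k<n
        go : OpenMap (mixed k) → OpenMap (mixed (suc k))
        go (a , δ , δ≉0 , sol) = Step.open-step (mixed k) (mixed (suc k)) (mixed-contracting k) (mixed-contracting (suc k)) κ
          (λ i ne x → reflexive (≡.cong (λ t → ⟦ t ⟧ᵗ x) (choose-agree i (λ eq → ne (Finₚ.toℕ-injective (≡.trans eq (≡.sym (Finₚ.toℕ-fromℕ< k<n))))) (toℕ i ℕ.<? k) (toℕ i ℕ.<? suc k))))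
          a δ δ≉0 sol

    open-image : OpenMap f
    open-image = go (mixed-open n ℕₚ.≤-refl)
      where
      value : ∀ i x (d : Dec (toℕ i ℕ.< n)) → ⟦ choose i d ⟧ᵗ x ≈ ⟦ f i ⟧ᵗ x
      value i x (yes _) = ≈refl
      value i x (no h) = contradiction (Finₚ.toℕ<n i) h
      go : OpenMap (mixed n) → OpenMap f
      go (a , δ , δ≉0 , sol) = a , δ , δ≉0 , λ q q-in → let (x , xM , e) = sol q q-in in
        x , xM , λ i → ≈trans (≈sym (value i x (toℕ i ℕ.<? n))) (e i)

-- The algebra R[x]/(P) for a monic polynomial P

module CompanionOps {a} {A : Set a} (_+_ _*_ : A → A → A) (-_ : A → A) (0# : A) (d : ℕ) (cs : Fin (suc d) → A) where

  -- Multiplication by x on coefficient vectors, reduced by the monic polynomial with lower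
  -- coefficients `cs`. A bare carrier `A` lets the same operations act on ring elements and on
  -- terms.
  X : (Fin (suc d) → A) → Fin (suc d) → A
  X u zero = - (u (Fin.fromℕ d) * cs zero)
  X u (suc i) = u (Fin.inject₁ i) + (- (u (Fin.fromℕ d) * cs (suc i)))

  -- Horner's scheme for the polynomial with coefficients u, evaluated at the operator `X` and
  -- applied to w.
  ap : ∀ k → (Fin k → A) → (Fin (suc d) → A) → Fin (suc d) → A
  ap zero u w i = 0#
  ap (suc k) u w i = (u zero * w i) + X (ap k (u ∘ suc) w) i

  mul : (Fin (suc d) → A) → (Fin (suc d) → A) → Fin (suc d) → A
  mul = ap (suc d)

module Companion {c ℓ} (R : CommutativeRing c ℓ) (d : ℕ) (cs : Fin (suc d) → CommutativeRing.Carrier R) where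
  private
    open module Div = Divisibility R hiding (_^_)
  open CompanionOps _+_ _*_ -_ 0# d cs public

  V : Set c
  V = Fin (suc d) → C

  infix 4 _≈ᵃ_
  infixl 6 _+ᵃ_
  infixr 7 _·_

  _≈ᵃ_ : V → V → Set ℓ
  u ≈ᵃ w = ∀ i → u i ≈ w i

  _+ᵃ_ : V → V → V
  (u +ᵃ w) i = u i + w i

  -ᵃ_ : V → V
  (-ᵃ u) i = - u i

  _·_ : C → V → V
  (a · u) i = a * u i

  0ᵃ : V
  0ᵃ _ = 0#

  1ᵃ : V
  1ᵃ zero = 1#
  1ᵃ (suc _) = 0#

  private
    top : Fin (suc d)
    top = Fin.fromℕ d

  X-cong : ∀ {u w} → u ≈ᵃ w → X u ≈ᵃ X w
  X-cong e zero = -‿cong (*-congʳ (e top))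
  X-cong e (suc i) = +-cong (e (Fin.inject₁ i)) (-‿cong (*-congʳ (e top)))

  X-+ : ∀ u w → X (u +ᵃ w) ≈ᵃ X u +ᵃ X w
  X-+ u w zero = solve 3 (λ x y c → :- ((x :+ y) :* c) := :- (x :* c) :+ :- (y :* c)) ≈refl (u top) (w top) (cs zero)
  X-+ u w (suc i) = solve 5 (λ p q x y c → (p :+ q) :+ :- ((x :+ y) :* c) := (p :+ :- (x :* c)) :+ (q :+ :- (y :* c))) ≈refl
    (u (Fin.inject₁ i)) (w (Fin.inject₁ i)) (u top) (w top) (cs (suc i))

  X-· : ∀ a u → X (a · u) ≈ᵃ a · X u
  X-· a u zero = solve 3 (λ a x c → :- ((a :* x) :* c) := a :* (:- (x :* c))) ≈refl a (u top) (cs zero)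
  X-· a u (suc i) = solve 4 (λ a p x c → (a :* p) :+ :- ((a :* x) :* c) := a :* (p :+ :- (x :* c))) ≈refl a (u (Fin.inject₁ i)) (u top) (cs (suc i))

  X-0 : X 0ᵃ ≈ᵃ 0ᵃ
  X-0 zero = solve 1 (λ c → :- (con (+ 0) :* c) := con (+ 0)) ≈refl (cs zero)
  X-0 (suc i) = solve 1 (λ c → con (+ 0) :+ :- (con (+ 0) :* c) := con (+ 0)) ≈refl (cs (suc i))

  ap-cong : ∀ k {u u′ : Fin k → C} {w w′} → (∀ i → u i ≈ u′ i) → w ≈ᵃ w′ → ap k u w ≈ᵃ ap k u′ w′
  ap-cong zero e f i = ≈refl
  ap-cong (suc k) e f i = +-cong (*-cong (e zero) (f i)) (X-cong (ap-cong k (e ∘ suc) f) i)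

  ap-congʳ : ∀ k (u : Fin k → C) {w w′} → w ≈ᵃ w′ → ap k u w ≈ᵃ ap k u w′
  ap-congʳ k u = ap-cong k (λ _ → ≈refl)

  ap-+ʳ : ∀ k (u : Fin k → C) w w′ → ap k u (w +ᵃ w′) ≈ᵃ ap k u w +ᵃ ap k u w′
  ap-+ʳ zero u w w′ i = ≈sym (+-identityˡ _)
  ap-+ʳ (suc k) u w w′ i = ≈trans (+-congˡ (≈trans (X-cong (ap-+ʳ k (u ∘ suc) w w′) i) (X-+ _ _ i)))
    (solve 5 (λ a x y p q → a :* (x :+ y) :+ (p :+ q) := (a :* x :+ p) :+ (a :* y :+ q)) ≈refl (u zero) (w i) (w′ i) _ _)

  ap-+ˡ : ∀ k (u u′ : Fin k → C) w → ap k (λ i → u i + u′ i) w ≈ᵃ ap k u w +ᵃ ap k u′ w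
  ap-+ˡ zero u u′ w i = ≈sym (+-identityˡ _)
  ap-+ˡ (suc k) u u′ w i = ≈trans (+-congˡ (≈trans (X-cong (ap-+ˡ k (u ∘ suc) (u′ ∘ suc) w) i) (X-+ _ _ i)))
    (solve 5 (λ a b x p q → (a :+ b) :* x :+ (p :+ q) := (a :* x :+ p) :+ (b :* x :+ q)) ≈refl (u zero) (u′ zero) (w i) _ _)

  ap-·ʳ : ∀ k (u : Fin k → C) a w → ap k u (a · w) ≈ᵃ a · ap k u w
  ap-·ʳ zero u a w i = ≈sym (zeroʳ a)
  ap-·ʳ (suc k) u a w i = ≈trans (+-congˡ (≈trans (X-cong (ap-·ʳ k (u ∘ suc) a w) i) (X-· a _ i)))
    (solve 4 (λ u a x p → u :* (a :* x) :+ a :* p := a :* (u :* x :+ p)) ≈refl (u zero) a (w i) _)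

  ap-·ˡ : ∀ k (u : Fin k → C) a w → ap k (λ i → a * u i) w ≈ᵃ a · ap k u w
  ap-·ˡ zero u a w i = ≈sym (zeroʳ a)
  ap-·ˡ (suc k) u a w i = ≈trans (+-congˡ (≈trans (X-cong (ap-·ˡ k (u ∘ suc) a w) i) (X-· a _ i)))
    (solve 4 (λ u a x p → (a :* u) :* x :+ a :* p := a :* (u :* x :+ p)) ≈refl (u zero) a (w i) _)

  ap-0 : ∀ k (u : Fin k → C) → ap k u 0ᵃ ≈ᵃ 0ᵃ
  ap-0 zero u i = ≈refl
  ap-0 (suc k) u i = ≈trans (+-cong (zeroʳ _) (≈trans (X-cong (ap-0 k (u ∘ suc)) i) (X-0 i))) (+-identityˡ _)

  ap-X : ∀ k (u : Fin k → C) w → ap k u (X w) ≈ᵃ X (ap k u w)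
  ap-X zero u w i = ≈sym (X-0 i)
  ap-X (suc k) u w i = ≈trans (+-cong (≈sym (X-· (u zero) w i)) (X-cong (ap-X k (u ∘ suc) w) i)) (≈sym (X-+ (u zero · w) (X (ap k (u ∘ suc) w)) i))

  -- All these operators are polynomials in `X` and therefore commute. Commutativity and
  -- associativity of `mul` are drawn from this and from `mul-1ʳ`, without expanding products.
  ap-comm : ∀ k (u : Fin k → C) l (v : Fin l → C) w → ap k u (ap l v w) ≈ᵃ ap l v (ap k u w)
  ap-comm zero u l v w i = ≈sym (ap-0 l v i)
  ap-comm (suc k) u l v w i = ≈sym (≈trans (ap-+ʳ l v (u zero · w) (X (ap k (u ∘ suc) w)) i)
    (+-cong (ap-·ʳ l v (u zero) w i) (≈trans (ap-X l v (ap k (u ∘ suc) w) i) (X-cong (λ j → ≈sym (ap-comm k (u ∘ suc) l v w j)) i))))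

  -- Up to degree d no reduction takes place, because the top coefficient is 0 before each
  -- multiplication by x.
  ap-1-coeff : ∀ k → k ℕ.≤ suc d → (u : Fin k → C) → (∀ i j → toℕ i ≡ toℕ j → ap k u 1ᵃ i ≈ u j) × (∀ i → k ℕ.≤ toℕ i → ap k u 1ᵃ i ≈ 0#)
  ap-1-coeff zero _ u = (λ i ()) , (λ i _ → ≈refl)
  ap-1-coeff (suc k) (s≤s k≤d) u = coeff , vanish
    where
    IH = ap-1-coeff k (ℕₚ.m≤n⇒m≤1+n k≤d) (u ∘ suc)
    v = ap k (u ∘ suc) 1ᵃ
    v-top : v top ≈ 0#
    v-top = proj₂ IH top (ℕₚ.≤-trans k≤d (ℕₚ.≤-reflexive (≡.sym (Finₚ.toℕ-fromℕ d))))
    coeff : ∀ i j → toℕ i ≡ toℕ j → ap (suc k) u 1ᵃ i ≈ u j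
    coeff zero zero eq = lin₁ v-top (- cs zero) (solve 3 (λ u t c → (u :* con (+ 1) :+ :- (t :* c)) :+ (:- c) :* con (+ 0) := u :+ (:- c) :* t) ≈refl (u zero) (v top) (cs zero))
    coeff (suc i) (suc j) eq = lin₂ v-top (- cs (suc i)) (proj₁ IH (Fin.inject₁ i) j (≡.trans (Finₚ.toℕ-inject₁ i) (ℕₚ.suc-injective eq))) 1#
      (solve 5 (λ u t c p r → (u :* con (+ 0) :+ (p :+ :- (t :* c))) :+ ((:- c) :* con (+ 0) :+ con (+ 1) :* r) := r :+ ((:- c) :* t :+ con (+ 1) :* p)) ≈refl (u zero) (v top) (cs (suc i)) (v (Fin.inject₁ i)) (u (suc j)))
    vanish : ∀ i → suc k ℕ.≤ toℕ i → ap (suc k) u 1ᵃ i ≈ 0#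
    vanish (suc i) (s≤s le) = lin₂ v-top (- cs (suc i)) (proj₂ IH (Fin.inject₁ i) (ℕₚ.≤-trans le (ℕₚ.≤-reflexive (≡.sym (Finₚ.toℕ-inject₁ i))))) 1#
      (solve 4 (λ u t c p → (u :* con (+ 0) :+ (p :+ :- (t :* c))) :+ ((:- c) :* con (+ 0) :+ con (+ 1) :* con (+ 0)) := con (+ 0) :+ ((:- c) :* t :+ con (+ 1) :* p)) ≈refl (u zero) (v top) (cs (suc i)) (v (Fin.inject₁ i)))

  mul-1ʳ : ∀ u → mul u 1ᵃ ≈ᵃ u
  mul-1ʳ u i = proj₁ (ap-1-coeff (suc d) ℕₚ.≤-refl u) i i ≡.refl

  ap-as-mul : ∀ k (u : Fin k → C) w → ap k u w ≈ᵃ mul w (ap k u 1ᵃ)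
  ap-as-mul k u w i = ≈trans (ap-congʳ k u (λ j → ≈sym (mul-1ʳ w j)) i) (ap-comm k u (suc d) w 1ᵃ i)

  mul-comm : ∀ u w → mul u w ≈ᵃ mul w u
  mul-comm u w i = ≈trans (ap-as-mul (suc d) u w i) (ap-congʳ (suc d) w (mul-1ʳ u) i)

  mul-assoc : ∀ u w t → mul (mul u w) t ≈ᵃ mul u (mul w t)
  mul-assoc u w t i = ≈trans (mul-comm (mul u w) t i) (≈trans (ap-comm (suc d) t (suc d) u w i) (ap-congʳ (suc d) u (mul-comm t w) i))

  algebra : CommutativeRing c ℓ
  algebra = record
    { Carrier = V ; _≈_ = _≈ᵃ_ ; _+_ = _+ᵃ_ ; _*_ = mul ; -_ = -ᵃ_ ; 0# = 0ᵃ ; 1# = 1ᵃ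
    ; isCommutativeRing = record
      { isRing = record
        { +-isAbelianGroup = record
          { isGroup = record
            { isMonoid = record
              { isSemigroup = record
                { isMagma = record
                  { isEquivalence = record { refl = λ i → ≈refl ; sym = λ e i → ≈sym (e i) ; trans = λ e f i → ≈trans (e i) (f i) }
                  ; ∙-cong = λ e f i → +-cong (e i) (f i) }
                ; assoc = λ u w t i → +-assoc (u i) (w i) (t i) }
              ; identity = (λ u i → +-identityˡ (u i)) , (λ u i → +-identityʳ (u i)) }
            ; inverse = (λ u i → -‿inverseˡ (u i)) , (λ u i → -‿inverseʳ (u i))
            ; ⁻¹-cong = λ e i → -‿cong (e i) }
          ; comm = λ u w i → +-comm (u i) (w i) }
        ; *-cong = λ e f → ap-cong (suc d) e f
        ; *-assoc = mul-assoc
        ; *-identity = (λ u i → ≈trans (mul-comm 1ᵃ u i) (mul-1ʳ u i)) , mul-1ʳ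
        ; distrib = (λ u w t → ap-+ʳ (suc d) u w t) , (λ u w t → ap-+ˡ (suc d) w t u) }
      ; *-comm = mul-comm } }

  apL : List C → V → V
  apL l = ap (length l) (List.lookup l)

  X^ : ℕ → V → V
  X^ zero w = w
  X^ (suc k) w = X (X^ k w)

  apL-snoc : ∀ l b w → apL (l ++ b ∷ []) w ≈ᵃ apL l w +ᵃ b · X^ (length l) w
  apL-snoc [] b w i = ≈trans (+-congˡ (X-0 i)) (+-comm _ _)
  apL-snoc (a ∷ l) b w i = ≈trans (+-congˡ (≈trans (X-cong (apL-snoc l b w) i) (≈trans (X-+ _ _ i) (+-congˡ (X-· b _ i))))) (≈sym (+-assoc _ _ _))

  X^-1-coeff : ∀ k → k ℕ.≤ d → ∀ i → (toℕ i ≡ k → X^ k 1ᵃ i ≈ 1#) × (toℕ i ≢ k → X^ k 1ᵃ i ≈ 0#)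
  X^-1-coeff zero _ zero = (λ _ → ≈refl) , (λ ne → contradiction ≡.refl ne)
  X^-1-coeff zero _ (suc i) = (λ ()) , (λ _ → ≈refl)
  X^-1-coeff (suc k) k<d i = go i
    where
    v = X^ k 1ᵃ
    IH = X^-1-coeff k (ℕₚ.<⇒≤ k<d)
    v-top : v top ≈ 0#
    v-top = proj₂ (IH top) (λ eq → ℕₚ.<⇒≢ k<d (≡.trans (≡.sym eq) (Finₚ.toℕ-fromℕ d)))
    shifted : ∀ i → X v (suc i) ≈ v (Fin.inject₁ i)
    shifted i = lin₁ v-top (- cs (suc i)) (solve 3 (λ p t c → (p :+ :- (t :* c)) :+ (:- c) :* con (+ 0) := p :+ (:- c) :* t) ≈refl (v (Fin.inject₁ i)) (v top) (cs (suc i)))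
    go : ∀ i → (toℕ i ≡ suc k → X v i ≈ 1#) × (toℕ i ≢ suc k → X v i ≈ 0#)
    go zero = (λ ()) , (λ _ → lin₁ v-top (- cs zero) (solve 2 (λ t c → (:- (t :* c)) :+ (:- c) :* con (+ 0) := con (+ 0) :+ (:- c) :* t) ≈refl (v top) (cs zero)))
    go (suc i) = (λ eq → ≈trans (shifted i) (proj₁ (IH (Fin.inject₁ i)) (≡.trans (Finₚ.toℕ-inject₁ i) (ℕₚ.suc-injective eq)))) ,
      (λ ne → ≈trans (shifted i) (proj₂ (IH (Fin.inject₁ i)) (λ eq → ne (≡.cong suc (≡.trans (≡.sym (Finₚ.toℕ-inject₁ i)) eq)))))

  X^-top : X^ (suc d) 1ᵃ ≈ᵃ -ᵃ cs
  X^-top i = go i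
    where
    v = X^ d 1ᵃ
    v-top : v top ≈ 1#
    v-top = proj₁ (X^-1-coeff d ℕₚ.≤-refl top) (Finₚ.toℕ-fromℕ d)
    go : ∀ i → X v i ≈ - cs i
    go zero = lin₁ v-top (- cs zero) (solve 2 (λ t c → (:- (t :* c)) :+ (:- c) :* con (+ 1) := :- c :+ (:- c) :* t) ≈refl (v top) (cs zero))
    go (suc i) = lin₂ v-top (- cs (suc i)) (proj₂ (X^-1-coeff d ℕₚ.≤-refl (Fin.inject₁ i)) (λ eq → ℕₚ.<⇒≢ (Finₚ.toℕ<n i) (≡.trans (≡.sym (Finₚ.toℕ-inject₁ i)) eq))) 1#
      (solve 3 (λ t c p → (p :+ :- (t :* c)) :+ ((:- c) :* con (+ 1) :+ con (+ 1) :* con (+ 0)) := :- c :+ ((:- c) :* t :+ con (+ 1) :* p)) ≈refl (v top) (cs (suc i)) (v (Fin.inject₁ i)))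

  -- Synthetic division by x - a.
  quot : C → List C → List C
  quot a [] = []
  quot a (b ∷ ps) = eval R ps a ∷ quot a ps

  X-quot : ∀ a p w → X (apL (quot a p) w) +ᵃ eval R p a · w ≈ᵃ a · apL (quot a p) w +ᵃ apL p w
  X-quot a [] w i = ≈trans (+-cong (X-0 i) (zeroˡ _)) (+-cong (≈sym (zeroʳ a)) ≈refl)
  X-quot a (b ∷ ps) w i =
    lin₂ (≈trans (X-+ (e · w) (X U) i) (+-congʳ (X-· e w i))) 1#
         (≈trans (≈trans (≈sym (≈trans (X-+ (X U) (e · w) i) (+-congˡ (X-· e w i)))) (X-cong (X-quot a ps w) i)) (≈trans (X-+ (a · U) (apL ps w) i) (+-congʳ (X-· a U i)))) 1#
      (solve 9 (λ L b a e wi Xwi XXU XU Xp →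
          (L :+ (b :+ a :* e) :* wi) :+ (con (+ 1) :* (e :* Xwi :+ XXU) :+ con (+ 1) :* (a :* XU :+ Xp))
        := (a :* (e :* wi :+ XU) :+ (b :* wi :+ Xp)) :+ (con (+ 1) :* L :+ con (+ 1) :* (XXU :+ e :* Xwi))) ≈refl
        (X (apL (quot a (b ∷ ps)) w) i) b a e (w i) (X w i) (X (X U) i) (X U i) (X (apL ps w) i))
    where
    e = eval R ps a
    U = apL (quot a ps) w

  -- Synthetic division here preserves the length of the list, so the last entry is 0 and the
  -- leading coefficient stands just before it.
  quot-monic : ∀ a b x ps → Σ (List C) λ l → length l ≡ length ps × quot a (x ∷ ps ++ b ∷ []) ≡ (l ++ (b + a * 0#) ∷ []) ++ 0# ∷ []
  quot-monic a b x [] = [] , ≡.refl , ≡.refl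
  quot-monic a b x (y ∷ ps) = let (l , len , eq) = quot-monic a b y ps in
    eval R (y ∷ ps ++ b ∷ []) a ∷ l , ≡.cong suc len , ≡.cong (eval R (y ∷ ps ++ b ∷ []) a ∷_) eq

module CompanionTerms {c ℓ} (R : CommutativeRing c ℓ) (d : ℕ) (cs : Fin (suc d) → CommutativeRing.Carrier R) (m : ℕ) where
  private
    open module Div = Divisibility R
  open DefinableSets R
  open Companion R d cs
  module T = CompanionOps {A = Tm m} _⊞_ _⊠_ ⊟_ (cst 0#) d (cst ∘ cs)

  private
    X-sem : ∀ (u : Fin (suc d) → Tm m) x i → ⟦ T.X u i ⟧ᵗ x ≡ X (λ j → ⟦ u j ⟧ᵗ x) i
    X-sem u x zero = ≡.refl
    X-sem u x (suc i) = ≡.refl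

  ap-sem : ∀ k (u : Fin k → Tm m) w x i → ⟦ T.ap k u w i ⟧ᵗ x ≈ ap k (λ j → ⟦ u j ⟧ᵗ x) (λ j → ⟦ w j ⟧ᵗ x) i
  ap-sem zero u w x i = ≈refl
  ap-sem (suc k) u w x i = +-congˡ (≈trans (reflexive (X-sem (T.ap k (u ∘ suc) w) x i)) (X-cong (ap-sem k (u ∘ suc) w x) i))

module CompanionLocal {c ℓ} (R : CommutativeRing c ℓ) (em : ExcludedMiddle (c ⊔ ℓ)) (dom : IntegralDomain R) (val : ValuationRing R)
    (d : ℕ) (cs : Fin (suc d) → CommutativeRing.Carrier R) where
  private
    open module Div = Divisibility R
    open Div.Domain em dom
  open LocalRing R em dom val
  open Companion R d cs

  Inᴹ : V → Set (c ⊔ ℓ)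
  Inᴹ u = ∀ i → ¬ Unit (u i)

  private
    M-*ˡ : ∀ {x} y → ¬ Unit x → ¬ Unit (x * y)
    M-*ˡ y = nonunit-∣ (a∣a*b _ y)

  M-X : ∀ {u} → Inᴹ u → Inᴹ (X u)
  M-X h zero = nonunit-neg (M-*ˡ _ (h _))
  M-X h (suc i) = nonunit-+ (h _) (nonunit-neg (M-*ˡ _ (h _)))

  M-ap : ∀ k (u : Fin k → C) → (∀ i → ¬ Unit (u i)) → ∀ w → Inᴹ (ap k u w)
  M-ap zero u h w i = nonunit-0
  M-ap (suc k) u h w i = nonunit-+ (M-*ˡ _ (h zero)) (M-X (M-ap k (u ∘ suc) (h ∘ suc) w) i)

  M-resp : ∀ {u w} → u ≈ᵃ w → Inᴹ u → Inᴹ w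
  M-resp e h i = nonunit-resp (e i) (h i)

  M-mulˡ : ∀ {u} w → Inᴹ u → Inᴹ (mul u w)
  M-mulˡ w h = M-ap (suc d) _ h w

  M-mulʳ : ∀ u {w} → Inᴹ w → Inᴹ (mul u w)
  M-mulʳ u h = M-resp (mul-comm _ u) (M-mulˡ u h)

  M-· : ∀ a {u} → Inᴹ u → Inᴹ (a · u)
  M-· a h i = nonunit-∣ (a∣b*a _ a) (h i)

  M-+ : ∀ {u w} → Inᴹ u → Inᴹ w → Inᴹ (u +ᵃ w)
  M-+ h g i = nonunit-+ (h i) (g i)

  M-minus : ∀ {u w} → Inᴹ u → Inᴹ w → Inᴹ (u +ᵃ (-ᵃ w))
  M-minus h g i = nonunit-minus (h i) (g i)

-- Inverses, values of z + z², and idempotents in R[x]/(P)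

module LocalAlgebra {c ℓ} (R : CommutativeRing c ℓ) (em : ExcludedMiddle (c ⊔ ℓ)) (dom : IntegralDomain R) (dp : DPMinimal R)
    (val : ValuationRing R) (ϖ : CommutativeRing.Carrier R)
    (ϖ≉0 : CommutativeRing._≉_ R ϖ (CommutativeRing.0# R)) (ϖ-nonunit : ¬ IsUnit R ϖ)
    (d : ℕ) (cs : Fin (suc d) → CommutativeRing.Carrier R) where
  private
    open module VT = ValuationTopology R em dom dp ϖ ϖ≉0 ϖ-nonunit
    open LocalRing R em dom val
    open OpenImage R em dom dp val ϖ ϖ≉0 ϖ-nonunit (suc d)
    open module A = Companion R d cs
    open CompanionLocal R em dom val d cs
    open module CT = CompanionTerms R d cs (suc d) using (ap-sem)
    module T = CT.T
    module DA = Divisibility algebra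
    open DA using () renaming (_:+_ to _⊹_; _:*_ to _✶_; :-_ to ⁻_; _:=_ to _≗_; con to κ)

    -- The perturbation is given twice: the terms `NT` make it available to the open image theorem,
    -- the function `N` to computations in the algebra.
    module Perturbation (N : V → V) (N-cong : ∀ {x y} → x ≈ᵃ y → N x ≈ᵃ N y) (NT : Fin (suc d) → Tm (suc d)) (NT-sem : ∀ x i → ⟦ NT i ⟧ᵗ x ≈ N (lookup x) i)
        (contr : ∀ x y v η → Inᴹ x → Inᴹ y → x ≈ᵃ y +ᵃ η · v → Σ V λ w → Inᴹ w × (N x ≈ᵃ N y +ᵃ η · w)) where

      f : Map
      f i = var i ⊞ NT i

      f-contracting : Contracting f
      f-contracting {x} {y} η xM yM h i = go (contr (lookup x) (lookup y) (λ j → proj₁ (h j)) η xM yM eq)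
        where
        eq : lookup x ≈ᵃ lookup y +ᵃ η · (λ j → proj₁ (h j))
        eq j = lin₁ (proj₂ (h j)) 1# (solve 3 (λ x y v → x :+ con (+ 1) :* v := (y :+ v) :+ con (+ 1) :* (x :- y)) ≈refl (lookup x j) (lookup y j) (η * proj₁ (h j)))
        go : (Σ V λ w → Inᴹ w × (N (lookup x) ≈ᵃ N (lookup y) +ᵃ η · w)) → _
        go (w , wM , e) = w i , wM i , lin₁ (≈trans (NT-sem x i) (≈trans (e i) (+-congʳ (≈sym (NT-sem y i))))) 1#
          (solve 5 (λ x y p q w → ((x :+ p) :- (y :+ q)) :+ con (+ 1) :* (q :+ w) := ((x :- y) :+ w) :+ con (+ 1) :* p) ≈refl (lookup x i) (lookup y i) (⟦ NT i ⟧ᵗ x) (⟦ NT i ⟧ᵗ y) (η * w i))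

      image : Σ V λ a → Σ C λ δ → δ ≉ 0# × (∀ y → (∀ i → δ ∣ y i) → Σ V λ x → Inᴹ x × (x +ᵃ N x ≈ᵃ a +ᵃ y))
      image = go (open-image f f-contracting)
        where
        go : OpenMap f → Σ V λ a → Σ C λ δ → δ ≉ 0# × (∀ y → (∀ i → δ ∣ y i) → Σ V λ x → Inᴹ x × (x +ᵃ N x ≈ᵃ a +ᵃ y))
        go (a , δ , δ≉0 , sol) = lookup a , δ , δ≉0 , λ y δ∣y →
          let q = tabulate (λ i → lookup a i + y i)
              q-eq : ∀ i → lookup q i ≈ lookup a i + y i
              q-eq i = reflexive (Vecₚ.lookup∘tabulate (λ i → lookup a i + y i) i)
              (x , xM , e) = sol q (inBox-tabulate (λ i → ∣-respʳ (lin₁ (q-eq i) (- 1#)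
                (solve 3 (λ a y q → y :+ (:- con (+ 1)) :* (a :+ y) := (q :- a) :+ (:- con (+ 1)) :* q) ≈refl (lookup a i) (y i) (lookup q i))) (δ∣y i)))
          in lookup x , xM , λ i → ≈trans (+-congˡ (≈sym (NT-sem x i))) (≈trans (e i) (q-eq i))

      injective : ∀ x y δ → Inᴹ x → Inᴹ y → (∀ i → δ ∣ (x i + N x i) - (y i + N y i)) → ∀ i → δ ∣ x i - y i
      injective x y δ xM yM h i = ∣-respʳ (minus-cong (tab x i) (tab y i)) (isometry {f} f-contracting {tabulate x} {tabulate y}
          (λ j → nonunit-resp (≈sym (tab x j)) (xM j)) (λ j → nonunit-resp (≈sym (tab y j)) (yM j))
          (λ j → ∣-respʳ (minus-cong (≈sym (value x j)) (≈sym (value y j))) (h j)) i)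
        where
        tab : ∀ (z : V) i → lookup (tabulate z) i ≈ z i
        tab z i = reflexive (Vecₚ.lookup∘tabulate z i)
        value : ∀ z j → ⟦ f j ⟧ᵗ (tabulate z) ≈ z j + N z j
        value z j = +-cong (tab z j) (≈trans (NT-sem (tabulate z) j) (N-cong (tab z) j))

  -- The image of the linear map 1 + h contains a box, hence a multiple δ of 1; its preimage is divisible by δ.
  inverse : ∀ h → Inᴹ h → Σ V λ s → mul (1ᵃ +ᵃ h) s ≈ᵃ 1ᵃ
  inverse h hM = go image
    where
    open Perturbation (mul h) (ap-congʳ (suc d) h) (T.mul (cst ∘ h) var) (λ x i → ap-sem (suc d) (cst ∘ h) var x i)
      (λ x y v η _ _ e → mul h v , M-mulˡ v hM , λ i → ≈trans (ap-congʳ (suc d) h e i)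
        (≈trans (ap-+ʳ (suc d) h y (η · v) i) (+-congˡ (ap-·ʳ (suc d) h η v i))))
    go : (Σ V λ a → Σ C λ δ → δ ≉ 0# × (∀ y → (∀ i → δ ∣ y i) → Σ V λ x → Inᴹ x × (x +ᵃ mul h x ≈ᵃ a +ᵃ y))) → Σ V λ s → mul (1ᵃ +ᵃ h) s ≈ᵃ 1ᵃ
    go (a , δ , δ≉0 , sol) = go′ (sol 0ᵃ (λ i → ∣0 δ)) (sol (δ · 1ᵃ) (λ i → a∣a*b δ _))
      where
      go′ : (Σ V λ x → Inᴹ x × (x +ᵃ mul h x ≈ᵃ a +ᵃ 0ᵃ)) → (Σ V λ x → Inᴹ x × (x +ᵃ mul h x ≈ᵃ a +ᵃ δ · 1ᵃ)) → Σ V λ s → mul (1ᵃ +ᵃ h) s ≈ᵃ 1ᵃ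
      go′ (x₀ , x₀M , e₀) (x₁ , x₁M , e₁) = s , λ i → *-cancelˡ δ≉0 (≈trans (≈sym (ap-·ʳ (suc d) (1ᵃ +ᵃ h) δ s i)) (eq i))
        where
        div : ∀ i → δ ∣ x₁ i - x₀ i
        div = injective x₁ x₀ δ x₁M x₀M (λ i → 1ᵃ i , lin₂ (e₁ i) 1# (e₀ i) (- 1#)
          (solve 4 (λ p q a w → (p :- q) :+ (con (+ 1) :* (a :+ w) :+ (:- con (+ 1)) :* (a :+ con (+ 0))) := w :+ (con (+ 1) :* p :+ (:- con (+ 1)) :* q)) ≈refl (x₁ i + mul h x₁ i) (x₀ i + mul h x₀ i) (a i) (δ * 1ᵃ i)))
        s : V
        s i = proj₁ (div i)
        split : δ · s ≈ᵃ x₁ +ᵃ (-ᵃ x₀)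
        split i = ≈sym (proj₂ (div i))
        eq : mul (1ᵃ +ᵃ h) (δ · s) ≈ᵃ δ · 1ᵃ
        eq = DA.≈trans (ap-congʳ (suc d) (1ᵃ +ᵃ h) split) (DA.lin₂ e₁ 1ᵃ e₀ (-ᵃ 1ᵃ)
          (DA.solve 5 (λ h x y a w → ((κ (+ 1) ⊹ h) ✶ (x ⊹ (⁻ y))) ⊹ ((κ (+ 1) ✶ (a ⊹ w)) ⊹ ((⁻ κ (+ 1)) ✶ (a ⊹ κ (+ 0))))
              ≗ (w ⊹ ((κ (+ 1) ✶ (x ⊹ (h ✶ x))) ⊹ ((⁻ κ (+ 1)) ✶ (y ⊹ (h ✶ y)))))) DA.≈refl h x₁ x₀ a (δ · 1ᵃ)))

  -- The values of z + z² are closed under y ∗ y′ = y + y′ + 4 y y′, because (1 + 2 z)² = 1 + 4 (z + z²);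
  -- hence they contain a neighbourhood of 0 as soon as they contain a box.
  artin-schreier-open : Σ C λ δ → δ ≉ 0# × (∀ y → (∀ i → δ ∣ y i) → Σ V λ z → Inᴹ z × (z +ᵃ mul z z ≈ᵃ y))
  artin-schreier-open = go image
    where
    square : ∀ x y v η → x ≈ᵃ y +ᵃ η · v → mul x x ≈ᵃ mul y y +ᵃ η · mul (x +ᵃ y) v
    square x y v η e = DA.≈trans (DA.lin₁ e (x +ᵃ y) (DA.solve 3 (λ x y w → ((x ✶ x) ⊹ ((x ⊹ y) ✶ (y ⊹ w))) ≗ (((y ✶ y) ⊹ ((x ⊹ y) ✶ w)) ⊹ ((x ⊹ y) ✶ x))) DA.≈refl x y (η · v)))
      (λ i → +-congˡ (ap-·ʳ (suc d) (x +ᵃ y) η v i))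
    open Perturbation (λ z → mul z z) (λ e → ap-cong (suc d) e e) (T.mul var var) (λ x i → ap-sem (suc d) var var x i)
      (λ x y v η xM yM e → mul (x +ᵃ y) v , M-mulˡ v (M-+ xM yM) , square x y v η e)
    go : (Σ V λ a → Σ C λ δ → δ ≉ 0# × (∀ y → (∀ i → δ ∣ y i) → Σ V λ x → Inᴹ x × (x +ᵃ mul x x ≈ᵃ a +ᵃ y))) → _
    go (a , δ , δ≉0 , sol) = go₀ (sol 0ᵃ (λ i → ∣0 δ))
      where
      go₀ : (Σ V λ x → Inᴹ x × (x +ᵃ mul x x ≈ᵃ a +ᵃ 0ᵃ)) → Σ C λ δ → δ ≉ 0# × (∀ y → (∀ i → δ ∣ y i) → Σ V λ z → Inᴹ z × (z +ᵃ mul z z ≈ᵃ y))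
      go₀ (z₀ , z₀M , e₀) = go₁ (inverse (z₀ +ᵃ z₀) (M-+ z₀M z₀M))
        where
        t = 1ᵃ +ᵃ (z₀ +ᵃ z₀)
        go₁ : (Σ V λ s → mul t s ≈ᵃ 1ᵃ) → Σ C λ δ → δ ≉ 0# × (∀ y → (∀ i → δ ∣ y i) → Σ V λ z → Inᴹ z × (z +ᵃ mul z z ≈ᵃ y))
        go₁ (s , ts) = δ , δ≉0 , λ y δ∣y → go₂ y (sol (mul (mul t t) y) (divides-mul (mul t t) y δ∣y))
          where
          divides-mul : ∀ u y → (∀ i → δ ∣ y i) → ∀ i → δ ∣ mul u y i
          divides-mul u y h i = mul u (λ j → proj₁ (h j)) i , ≈trans (ap-congʳ (suc d) u (λ j → proj₂ (h j)) i) (ap-·ʳ (suc d) u δ (λ j → proj₁ (h j)) i)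
          go₂ : ∀ y → (Σ V λ x → Inᴹ x × (x +ᵃ mul x x ≈ᵃ a +ᵃ mul (mul t t) y)) → Σ V λ z → Inᴹ z × (z +ᵃ mul z z ≈ᵃ y)
          go₂ y (x , xM , e) = v , M-mulʳ s (M-minus xM z₀M) , DA.≈trans (DA.≈sym (DA.≈trans (key s-version) v-version)) unscaled
            where
            w = x +ᵃ (-ᵃ z₀)
            v = mul s w
            -- The values of z + z² at x and z₀ differ by t² y, so w = x - z₀ satisfies w² + t w =
            -- t² y. Dividing by t² gives v² + v = y for v = w / t.
            s-version : mul w w +ᵃ mul t w ≈ᵃ mul (mul t t) y
            s-version = DA.lin₂ e 1ᵃ e₀ (-ᵃ 1ᵃ) (DA.solve 4 (λ x z a Y →
              ((((x ⊹ (⁻ z)) ✶ (x ⊹ (⁻ z))) ⊹ ((κ (+ 1) ⊹ (z ⊹ z)) ✶ (x ⊹ (⁻ z)))) ⊹ ((κ (+ 1) ✶ (a ⊹ Y)) ⊹ ((⁻ κ (+ 1)) ✶ (a ⊹ κ (+ 0)))))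
              ≗ (Y ⊹ ((κ (+ 1) ✶ (x ⊹ (x ✶ x))) ⊹ ((⁻ κ (+ 1)) ✶ (z ⊹ (z ✶ z)))))) DA.≈refl x z₀ a (mul (mul t t) y))
            key : mul w w +ᵃ mul t w ≈ᵃ mul (mul t t) y → mul (mul s s) (mul (mul t t) y) ≈ᵃ mul (mul s s) (mul w w +ᵃ mul t w)
            key h = ap-congʳ (suc d) (mul s s) (DA.≈sym h)
            v-version : mul (mul s s) (mul w w +ᵃ mul t w) ≈ᵃ v +ᵃ mul v v
            v-version = DA.lin₁ ts (mul s w) (DA.solve 3 (λ s w t → (((s ✶ s) ✶ ((w ✶ w) ⊹ (t ✶ w))) ⊹ ((s ✶ w) ✶ κ (+ 1)))
              ≗ (((s ✶ w) ⊹ ((s ✶ w) ✶ (s ✶ w))) ⊹ ((s ✶ w) ✶ (t ✶ s)))) DA.≈refl s w t)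
            unscaled : mul (mul s s) (mul (mul t t) y) ≈ᵃ y
            unscaled = DA.lin₁ ts (mul (mul (mul t s) y +ᵃ y) 1ᵃ) (DA.solve 3 (λ s t y → (((s ✶ s) ✶ ((t ✶ t) ✶ y)) ⊹ (((((t ✶ s) ✶ y) ⊹ y) ✶ κ (+ 1)) ✶ κ (+ 1)))
              ≗ (y ⊹ (((((t ✶ s) ✶ y) ⊹ y) ✶ κ (+ 1)) ✶ (t ✶ s)))) DA.≈refl s t y)

  -- With Y = e² - e and u = 2e - 1 one has u² = 1 + 4Y. The error of e + u v is Y + (1 + 4Y)(v +
  -- v²), so v has to solve v + v² = -Y / (1 + 4Y).
  lift-idempotent : Σ C λ δ → δ ≉ 0# × (∀ e → (∀ i → δ ∣ mul e e i - e i) → Σ V λ e′ → mul e′ e′ ≈ᵃ e′ × (∀ i → ¬ Unit (e′ i - e i)))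
  lift-idempotent = go artin-schreier-open
    where
    go : (Σ C λ δ → δ ≉ 0# × (∀ y → (∀ i → δ ∣ y i) → Σ V λ z → Inᴹ z × (z +ᵃ mul z z ≈ᵃ y))) → _
    -- The additional factor ϖ puts Y into 𝔐, which makes 1 + 4Y invertible.
    go (δ , δ≉0 , sol) = δ * ϖ , *-≉0 δ≉0 ϖ≉0 , solution
      where
      solution : ∀ e → (∀ i → δ * ϖ ∣ mul e e i - e i) → Σ V λ e′ → mul e′ e′ ≈ᵃ e′ × (∀ i → ¬ Unit (e′ i - e i))
      solution e h = go₁ (inverse 4Y 4Y-M)
        where
        Y = mul e e +ᵃ (-ᵃ e)
        Y-M : Inᴹ Y
        Y-M i = nonunit-∣ (∣-trans (a∣b*a ϖ δ) (h i)) ϖ-nonunit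
        4Y = (Y +ᵃ Y) +ᵃ (Y +ᵃ Y)
        4Y-M : Inᴹ 4Y
        4Y-M = M-+ (M-+ Y-M Y-M) (M-+ Y-M Y-M)
        Y-δ : ∀ u i → δ ∣ mul u Y i
        Y-δ u i = mul u (λ j → ϖ * proj₁ (h j)) i , ≈trans (ap-congʳ (suc d) u (λ j → ≈trans (proj₂ (h j)) (*-assoc δ ϖ _)) i) (ap-·ʳ (suc d) u δ (λ j → ϖ * proj₁ (h j)) i)
        go₁ : (Σ V λ r → mul (1ᵃ +ᵃ 4Y) r ≈ᵃ 1ᵃ) → Σ V λ e′ → mul e′ e′ ≈ᵃ e′ × (∀ i → ¬ Unit (e′ i - e i))
        go₁ (r , rr) = go₂ (sol (mul (-ᵃ r) Y) (Y-δ (-ᵃ r)))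
          where
          go₂ : (Σ V λ z → Inᴹ z × (z +ᵃ mul z z ≈ᵃ mul (-ᵃ r) Y)) → Σ V λ e′ → mul e′ e′ ≈ᵃ e′ × (∀ i → ¬ Unit (e′ i - e i))
          go₂ (v , vM , ev) = e′ , idem , λ i → nonunit-resp (solve 2 (λ e x → x := (e :+ x) :- e) ≈refl (e i) (mul u v i)) (M-mulʳ u vM i)
            where
            u = (e +ᵃ e) +ᵃ (-ᵃ 1ᵃ)
            e′ = e +ᵃ mul u v
            idem : mul e′ e′ ≈ᵃ e′
            idem = DA.lin₂ ev (1ᵃ +ᵃ 4Y) rr (-ᵃ Y) (DA.solve 3 (λ e v r →
              let Y = (e ✶ e) ⊹ (⁻ e)
                  F = (Y ⊹ Y) ⊹ (Y ⊹ Y)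
                  u = (e ⊹ e) ⊹ (⁻ κ (+ 1))
                  e′ = e ⊹ (u ✶ v)
              in ((e′ ✶ e′) ⊹ (((κ (+ 1) ⊹ F) ✶ ((⁻ r) ✶ Y)) ⊹ ((⁻ Y) ✶ κ (+ 1))))
               ≗ (e′ ⊹ (((κ (+ 1) ⊹ F) ✶ (v ⊹ (v ✶ v))) ⊹ ((⁻ Y) ✶ ((κ (+ 1) ⊹ F) ✶ r))))) DA.≈refl e v r)

-- Quotients by definable prime ideals

module Quotient {c ℓ} (R : CommutativeRing c ℓ) (em : ExcludedMiddle (c ⊔ ℓ)) (Q : DefinableSets.Fm R 1) where
  private
    open module Div = Divisibility R
    open DefinableSets R

  𝔮 : C → Set (c ⊔ ℓ)
  𝔮 x = ⟦ Q ⟧ (x ∷ [])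

  𝔮-resp : ∀ {x y} → x ≈ y → 𝔮 x → 𝔮 y
  𝔮-resp e = resp em Q (e ∷ [])

  module _ (𝔮-0 : 𝔮 0#) (𝔮-+ : ∀ {x y} → 𝔮 x → 𝔮 y → 𝔮 (x + y)) (𝔮-* : ∀ {x} y → 𝔮 x → 𝔮 (x * y)) where
    private
      𝔮-neg : ∀ {x} → 𝔮 x → 𝔮 (- x)
      𝔮-neg {x} h = 𝔮-resp (solve 1 (λ x → x :* (:- con (+ 1)) := :- x) ≈refl x) (𝔮-* (- 1#) h)

      _≈ᵠ_ : C → C → Set (c ⊔ ℓ)
      x ≈ᵠ y = 𝔮 (x - y)

      emb : ∀ {x y} → x ≈ y → x ≈ᵠ y
      emb e = 𝔮-resp (≈sym (≈⇒-≈0 e)) 𝔮-0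

    -- The carrier and the operations are kept and only the equality is coarsened, so vectors and
    -- products computed over `R` are literally those over the quotient.
    quotient : CommutativeRing c (c ⊔ ℓ)
    quotient = record
      { Carrier = C ; _≈_ = _≈ᵠ_ ; _+_ = _+_ ; _*_ = _*_ ; -_ = -_ ; 0# = 0# ; 1# = 1#
      ; isCommutativeRing = record
        { isRing = record
          { +-isAbelianGroup = record
            { isGroup = record
              { isMonoid = record
                { isSemigroup = record
                  { isMagma = record
                    { isEquivalence = record { refl = emb ≈refl ; sym = λ h → 𝔮-resp (neg-swap _ _) (𝔮-neg h) ; trans = λ h g → 𝔮-resp (≈sym (x-z≈ _ _ _)) (𝔮-+ h g) }
                    ; ∙-cong = λ {x} {y} {u} {v} h g → 𝔮-resp (solve 4 (λ x y u v → (x :- y) :+ (u :- v) := (x :+ u) :- (y :+ v)) ≈refl x y u v) (𝔮-+ h g) }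
                  ; assoc = λ x y z → emb (+-assoc x y z) }
                ; identity = (λ x → emb (+-identityˡ x)) , (λ x → emb (+-identityʳ x)) }
              ; inverse = (λ x → emb (-‿inverseˡ x)) , (λ x → emb (-‿inverseʳ x))
              ; ⁻¹-cong = λ {x} {y} h → 𝔮-resp (solve 2 (λ x y → :- (x :- y) := (:- x) :- (:- y)) ≈refl x y) (𝔮-neg h) }
            ; comm = λ x y → emb (+-comm x y) }
          ; *-cong = λ {x} {y} {u} {v} h g → 𝔮-resp (solve 4 (λ x y u v → (x :- y) :* u :+ (u :- v) :* y := x :* u :- y :* v) ≈refl x y u v) (𝔮-+ (𝔮-* u h) (𝔮-* y g))
          ; *-assoc = λ x y z → emb (*-assoc x y z)
          ; *-identity = (λ x → emb (*-identityˡ x)) , (λ x → emb (*-identityʳ x))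
          ; distrib = (λ x y z → emb (distribˡ x y z)) , (λ x y z → emb (distribʳ x y z)) }
        ; *-comm = λ x y → emb (*-comm x y) } }

    ∣-quotient : ∀ {x y} → x ∣ y → Defs._∣_ quotient x y
    ∣-quotient (q , e) = q , emb e

    quotient-domain : ¬ 𝔮 1# → (∀ x y → 𝔮 (x * y) → 𝔮 x ⊎ 𝔮 y) → IntegralDomain quotient
    quotient-domain proper prime = (λ h → proper (𝔮-resp (x-0 1#) h)) , λ x y h →
        [ (λ g → inj₁ (𝔮-resp (≈sym (x-0 x)) g)) , (λ g → inj₂ (𝔮-resp (≈sym (x-0 y)) g)) ]′ (prime x y (𝔮-resp (x-0 (x * y)) h))
      where
      x-0 : ∀ x → x - 0# ≈ x
      x-0 = solve 1 (λ x → x :- con (+ 0) := x) ≈refl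

    quotient-valuation : ValuationRing R → ValuationRing quotient
    quotient-valuation val x y = [ inj₁ ∘ ∣-quotient , inj₂ ∘ ∣-quotient ]′ (val x y)

    private
      trT : ∀ {n} → Term n → Tm n
      trT (var i) = var i
      trT zeroT = cst 0#
      trT oneT = cst 1#
      trT (s ⊕ t) = trT s ⊞ trT t
      trT (s ⊗ t) = trT s ⊠ trT t

      tr : ∀ {n} → Formula n → Fm n
      tr (s ≐ t) = atom Q ((trT s ⊟′ trT t) ∷ [])
      tr (¬' φ) = ∼ tr φ
      tr (φ ∧' ψ) = tr φ ⩓ tr ψ
      tr (∃' φ) = Ex (tr φ)

      Same : ∀ {n} → (Fin n → C) → Vec C n → Set c
      Same σ ρ = ∀ i → σ i ≡ lookup ρ i

      same-∷ : ∀ {n} {σ : Fin n → C} {ρ} x → Same σ ρ → Same (x ∷ᵥ σ) (x ∷ ρ)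
      same-∷ x h zero = ≡.refl
      same-∷ x h (suc i) = h i

      trT-sem : ∀ {n} (t : Term n) {σ ρ} → Same σ ρ → ⟦_⟧ₜ quotient t σ ≡ ⟦ trT t ⟧ᵗ ρ
      trT-sem (var i) h = h i
      trT-sem zeroT h = ≡.refl
      trT-sem oneT h = ≡.refl
      trT-sem (s ⊕ t) h = ≡.cong₂ _+_ (trT-sem s h) (trT-sem t h)
      trT-sem (s ⊗ t) h = ≡.cong₂ _*_ (trT-sem s h) (trT-sem t h)

      tr-sem : ∀ {n} (φ : Formula n) {σ ρ} → Same σ ρ → (Sat quotient φ σ → ⟦ tr φ ⟧ ρ) × (⟦ tr φ ⟧ ρ → Sat quotient φ σ)
      tr-sem (s ≐ t) h = (λ { (lift p) → ≡.subst₂ (λ x y → 𝔮 (x - y)) (trT-sem s h) (trT-sem t h) p }) ,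
        (λ p → lift (≡.subst₂ (λ x y → 𝔮 (x - y)) (≡.sym (trT-sem s h)) (≡.sym (trT-sem t h)) p))
      tr-sem (¬' φ) h = (λ n p → n (proj₂ (tr-sem φ h) p)) , (λ n p → n (proj₁ (tr-sem φ h) p))
      tr-sem (φ ∧' ψ) h = (λ { (p , q) → proj₁ (tr-sem φ h) p , proj₁ (tr-sem ψ h) q }) , (λ { (p , q) → proj₂ (tr-sem φ h) p , proj₂ (tr-sem ψ h) q })
      tr-sem (∃' φ) h = (λ { (x , p) → x , proj₁ (tr-sem φ (same-∷ x h)) p }) , (λ { (x , p) → x , proj₂ (tr-sem φ (same-∷ x h)) p })

    -- Equality modulo 𝔮 is definable, so a pattern in the quotient is a pattern in `R` for formulas
    -- in which an equation becomes membership of the difference.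
    quotient-dpMinimal : DPMinimal R → DPMinimal quotient
    quotient-dpMinimal dp φ ψ = proj₁ bound , λ { (a , b , pat) → proj₂ bound (λ i → tabulate (a i)) (λ j → tabulate (b j)) λ i j →
        proj₁ (pat i j) ,
        (λ i′ → mk⇔ (λ s → Equivalence.to (proj₁ (proj₂ (pat i j)) i′) (proj₂ (tr-sem φ (same (a i′))) s))
                    (λ e → proj₁ (tr-sem φ (same (a i′))) (Equivalence.from (proj₁ (proj₂ (pat i j)) i′) e))) ,
        (λ j′ → mk⇔ (λ s → Equivalence.to (proj₂ (proj₂ (pat i j)) j′) (proj₂ (tr-sem ψ (same (b j′))) s))
                    (λ e → proj₁ (tr-sem ψ (same (b j′))) (Equivalence.from (proj₂ (proj₂ (pat i j)) j′) e))) }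
      where
      bound = no-pattern em dp (tr φ) (tr ψ)
      same : ∀ {n x} (σ : Fin n → C) → Same (x ∷ᵥ σ) (x ∷ tabulate σ)
      same σ = same-∷ _ (λ i → ≡.sym (Vecₚ.lookup∘tabulate σ i))

-- Dp-minimal valuation rings are henselian

module Derivative {c ℓ} (R : CommutativeRing c ℓ) where
  private
    open module Div = Divisibility R

  -- The auxiliary function of deriv is private; unification recovers it.
  mutual
    derivFrom : ℕ → List C → List C
    derivFrom = _

    deriv-∷ : ∀ b ps → deriv R (b ∷ ps) ≡ derivFrom (suc zero) ps
    deriv-∷ b ps with ℕ.suc ℕ.zero
    ... | k = ≡.refl

  derivFrom-suc : ∀ k ps a → eval R (derivFrom (suc k) ps) a ≈ eval R (derivFrom k ps) a + eval R ps a
  derivFrom-suc k [] a = ≈sym (+-identityˡ _)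
  derivFrom-suc k (b ∷ ps) a = lin₁ (derivFrom-suc (suc k) ps a) a
    (solve 6 (λ i b a x y z → ((con (+ 1) :+ i) :* b :+ a :* x) :+ a :* (y :+ z) := ((i :* b :+ a :* y) :+ (b :+ a :* z)) :+ a :* x) ≈refl
      (ι R k) b a (eval R (derivFrom (suc (suc k)) ps) a) (eval R (derivFrom (suc k) ps) a) (eval R ps a))

  module _ (d : ℕ) (cs : Fin (suc d) → C) where
    open Companion R d cs using (quot)

    -- Simplicity of the root enters through this identity: the value is the factor by which the
    -- quotient must be divided to become idempotent modulo 𝔐.
    eval-quot : ∀ a b ps → eval R (quot a (b ∷ ps)) a ≈ eval R (deriv R (b ∷ ps)) a
    eval-quot a b ps = go ps
      where
      go : ∀ ps → eval R ps a + a * eval R (quot a ps) a ≈ eval R (derivFrom 1 ps) a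
      go [] = solve 1 (λ a → con (+ 0) :+ a :* con (+ 0) := con (+ 0)) ≈refl a
      go (b ∷ ps) = lin₂ (go ps) a (derivFrom-suc 1 ps a) (- a)
        (solve 6 (λ a b p q e f → ((b :+ a :* p) :+ a :* (p :+ a :* q)) :+ (a :* e :+ (:- a) :* (e :+ p)) := ((con (+ 1) :+ con (+ 0)) :* b :+ a :* f) :+ (a :* (p :+ a :* q) :+ (:- a) :* f)) ≈refl
          a b (eval R ps a) (eval R (quot a ps) a) (eval R (derivFrom 1 ps) a) (eval R (derivFrom 2 ps) a))

-- From a simple root modulo 𝔐 to an idempotent, and back to a root

module SimpleRoot {c ℓ} (R : CommutativeRing c ℓ) (em : ExcludedMiddle (c ⊔ ℓ)) (dom : IntegralDomain R) (dp : DPMinimal R) (val : ValuationRing R)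
    (c₀ : CommutativeRing.Carrier R) (cs′ : List (CommutativeRing.Carrier R)) (a : CommutativeRing.Carrier R)
    (root : _∈𝔐 R (eval R (monic R (c₀ ∷ cs′)) a)) (simple : IsUnit R (eval R (deriv R (monic R (c₀ ∷ cs′))) a)) where
  private
    open module Div = Divisibility R
    open Div.Domain em dom
    open LocalRing R em dom val

    d : ℕ
    d = length cs′
    cs : Fin (suc d) → C
    cs = List.lookup (c₀ ∷ cs′)
    P : List C
    P = monic R (c₀ ∷ cs′)
    top : Fin (suc d)
    top = Fin.fromℕ d

    open module A = Companion R d cs
    open CompanionLocal R em dom val d cs
    module DA = Divisibility algebra
    open DA using () renaming (_:+_ to _⊹_; _:*_ to _✶_; :-_ to ⁻_; _:=_ to _≗_; con to κ)

    infix 4 _≡ᴹ_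
    _≡ᴹ_ : V → V → Set (c ⊔ ℓ)
    u ≡ᴹ w = ∀ i → ¬ Unit (u i - w i)

    ≡ᴹ-trans : ∀ {u w t} → u ≡ᴹ w → w ≡ᴹ t → u ≡ᴹ t
    ≡ᴹ-trans h g i = nonunit-resp (≈sym (x-z≈ _ _ _)) (nonunit-+ (h i) (g i))

    ≈⇒≡ᴹ : ∀ {u w} → u ≈ᵃ w → u ≡ᴹ w
    ≈⇒≡ᴹ e i = nonunit-resp (≈sym (≈⇒-≈0 (e i))) nonunit-0

    ≡ᴹ-+ : ∀ {u w u′ w′} → u ≡ᴹ w → u′ ≡ᴹ w′ → u +ᵃ u′ ≡ᴹ w +ᵃ w′
    ≡ᴹ-+ {u} {w} {u′} {w′} h g i = nonunit-resp (solve 4 (λ u w u′ w′ → (u :- w) :+ (u′ :- w′) := (u :+ u′) :- (w :+ w′)) ≈refl (u i) (w i) (u′ i) (w′ i)) (nonunit-+ (h i) (g i))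

    ≡ᴹ-· : ∀ k {u w} → u ≡ᴹ w → k · u ≡ᴹ k · w
    ≡ᴹ-· k {u} {w} h i = nonunit-resp (solve 3 (λ k u w → k :* (u :- w) := k :* u :- k :* w) ≈refl k (u i) (w i)) (M-· k h i)

    ≡ᴹ-X : ∀ {u w} → u ≡ᴹ w → X u ≡ᴹ X w
    ≡ᴹ-X {u} {w} h i = nonunit-resp (lin₁ eq 1# (solve 3 (λ p x y → p :+ con (+ 1) :* x := (x :- y) :+ con (+ 1) :* (p :+ y)) ≈refl (X (u +ᵃ (-ᵃ w)) i) (X u i) (X w i))) (M-X h i)
      where
      eq : X (u +ᵃ (-ᵃ w)) i + X w i ≈ X u i
      eq = ≈trans (≈sym (X-+ (u +ᵃ (-ᵃ w)) w i)) (X-cong (λ j → solve 2 (λ u w → (u :+ :- w) :+ w := u) ≈refl (u j) (w j)) i)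

    ≡ᴹ-mulʳ : ∀ t {u w} → u ≡ᴹ w → mul t u ≡ᴹ mul t w
    ≡ᴹ-mulʳ t {u} {w} h = M-resp (DA.solve 3 (λ t u w → (t ✶ (u ⊹ (⁻ w))) ≗ ((t ✶ u) ⊹ (⁻ (t ✶ w)))) DA.≈refl t u w) (M-mulʳ t h)

    -- It suffices to check 1, where x^(d + 1) is minus the lower part of P by construction of `X`.
    P-kill : ∀ w → apL P w ≈ᵃ 0ᵃ
    P-kill w = DA.≈trans (ap-as-mul (length P) (List.lookup P) w) (DA.≈trans (ap-congʳ (suc d) w on-1) (ap-0 (suc d) w))
      where
      on-1 : apL P 1ᵃ ≈ᵃ 0ᵃ
      on-1 i = lin₂ (≈trans (apL-snoc (c₀ ∷ cs′) 1# 1ᵃ i) (+-cong (mul-1ʳ cs i) (*-identityˡ _))) 1# (X^-top i) 1#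
        (solve 3 (λ p c x → p :+ (con (+ 1) :* (c :+ x) :+ con (+ 1) :* (:- c)) := con (+ 0) :+ (con (+ 1) :* p :+ con (+ 1) :* x)) ≈refl (apL P 1ᵃ i) (cs i) (X^ (suc d) 1ᵃ i))

    Q : List C
    Q = quot a P
    q : V
    q = apL Q 1ᵃ

    -- In the algebra (x - a) q = P - P(a), where P is 0 and P(a) lies in 𝔐.
    X-q : X q ≡ᴹ a · q
    X-q i = nonunit-resp (lin₂ (X-quot a P 1ᵃ i) (- 1#) (P-kill 1ᵃ i) (- 1#)
        (solve 5 (λ x p o aq z → (:- (p :* o)) :+ ((:- con (+ 1)) :* (aq :+ z) :+ (:- con (+ 1)) :* con (+ 0)) := (x :- aq) :+ ((:- con (+ 1)) :* (x :+ p :* o) :+ (:- con (+ 1)) :* z)) ≈refl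
          (X q i) (eval R P a) (1ᵃ i) (a * q i) (apL P 1ᵃ i)))
      (nonunit-neg (nonunit-∣ (a∣a*b _ _) root))

    evalᶠ : ∀ k → (Fin k → C) → C
    evalᶠ zero u = 0#
    evalᶠ (suc k) u = u zero + a * evalᶠ k (u ∘ suc)

    evalᶠ-list : ∀ l → evalᶠ (length l) (List.lookup l) ≡ eval R l a
    evalᶠ-list [] = ≡.refl
    evalᶠ-list (b ∷ l) = ≡.cong (λ e → b + a * e) (evalᶠ-list l)

    ap-q : ∀ k (u : Fin k → C) → ap k u q ≡ᴹ evalᶠ k u · q
    ap-q zero u = ≈⇒≡ᴹ (λ i → ≈sym (zeroˡ _))
    ap-q (suc k) u = ≡ᴹ-trans (≡ᴹ-+ {u zero · q} (≈⇒≡ᴹ (λ i → ≈refl)) (≡ᴹ-trans (≡ᴹ-X (ap-q k (u ∘ suc)))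
        (≡ᴹ-trans (≈⇒≡ᴹ (X-· e q)) (≡ᴹ-· e X-q))))
        (≈⇒≡ᴹ (λ i → solve 4 (λ u q e a → u :* q :+ e :* (a :* q) := (u :+ a :* e) :* q) ≈refl (u zero) (q i) e a))
      where e = evalᶠ k (u ∘ suc)

    -- The quotient is monic of degree d. A unit in the top coordinate later reads off the scalar by
    -- which an element is a multiple of the idempotent.
    q-top : q top ≈ 1#
    q-top = go (quot-monic a 1# c₀ cs′)
      where
      go : (Σ (List C) λ l → length l ≡ d × Q ≡ (l ++ (1# + a * 0#) ∷ []) ++ 0# ∷ []) → q top ≈ 1#
      go (l , len , eq) = ≈trans (reflexive (≡.cong (λ z → apL z 1ᵃ top) eq))
          (≈trans (apL-snoc (l ++ b ∷ []) 0# 1ᵃ top) (≈trans (+-congˡ (zeroˡ _)) (≈trans (+-identityʳ _) (≈trans (apL-snoc l b 1ᵃ top)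
            (lin₂ vanish 1# one (1# + a * 0#) (solve 3 (λ a p x → (p :+ (con (+ 1) :+ a :* con (+ 0)) :* x) :+ (con (+ 1) :* con (+ 0) :+ (con (+ 1) :+ a :* con (+ 0)) :* con (+ 1))
              := con (+ 1) :+ (con (+ 1) :* p :+ (con (+ 1) :+ a :* con (+ 0)) :* x)) ≈refl a (apL l 1ᵃ top) (X^ (length l) 1ᵃ top)))))))
        where
        b = 1# + a * 0#
        vanish : apL l 1ᵃ top ≈ 0#
        vanish = proj₂ (ap-1-coeff (length l) (ℕₚ.≤-trans (ℕₚ.≤-reflexive len) (ℕₚ.n≤1+n d)) (List.lookup l)) top (ℕₚ.≤-reflexive (≡.trans len (≡.sym (Finₚ.toℕ-fromℕ d))))
        one : X^ (length l) 1ᵃ top ≈ 1#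
        one = proj₁ (X^-1-coeff (length l) (ℕₚ.≤-reflexive len) top) (≡.trans (Finₚ.toℕ-fromℕ d) (≡.sym len))

    Qa-unit : Unit (eval R Q a)
    Qa-unit = Unit-resp (≈sym (Derivative.eval-quot R d cs a c₀ (cs′ ++ 1# ∷ []))) simple

    υ : C
    υ = proj₁ Qa-unit
    υ-inv : eval R Q a * υ ≈ 1#
    υ-inv = proj₂ Qa-unit

    e₀ : V
    e₀ = υ · q

    e₀-top : Unit (e₀ top)
    e₀-top = Unit-resp (≈sym (≈trans (*-congˡ q-top) (*-identityʳ υ))) (eval R Q a , ≈trans (*-comm _ _) υ-inv)

    X-e₀ : X e₀ ≡ᴹ a · e₀
    X-e₀ = ≡ᴹ-trans (≈⇒≡ᴹ (X-· υ q)) (≡ᴹ-trans (≡ᴹ-· υ X-q) (≈⇒≡ᴹ (λ i → solve 3 (λ u a q → u :* (a :* q) := a :* (u :* q)) ≈refl υ a (q i))))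

    mul-e₀ : ∀ w → Σ C λ k → mul w e₀ ≡ᴹ k · e₀
    mul-e₀ w = k , ≡ᴹ-trans (≈⇒≡ᴹ (ap-·ʳ (suc d) w υ q)) (≡ᴹ-trans (≡ᴹ-· υ (ap-q (suc d) w)) (≈⇒≡ᴹ (λ i → solve 3 (λ u k q → u :* (k :* q) := k :* (u :* q)) ≈refl υ k (q i))))
      where k = evalᶠ (suc d) w

    -- Modulo 𝔐 every polynomial acts on q through its value at a. Hence q² is congruent to Q(a) q,
    -- and the inverse υ of Q(a) normalises it.
    e₀-idempotent : mul e₀ e₀ ≡ᴹ e₀
    e₀-idempotent = ≡ᴹ-trans (≈⇒≡ᴹ (DA.≈trans (ap-·ˡ (suc d) q υ e₀) (λ i → *-congˡ (ap-·ʳ (suc d) q υ q i))))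
      (≡ᴹ-trans (≡ᴹ-· υ (≡ᴹ-· υ q-square)) (≈⇒≡ᴹ (λ i → lin₁ υ-inv (υ * q i) (solve 3 (λ u Q q → (u :* (u :* (Q :* q))) :+ (u :* q) :* con (+ 1) := (u :* q) :+ (u :* q) :* (Q :* u)) ≈refl υ (eval R Q a) (q i)))))
      where
      q-square : mul q q ≡ᴹ eval R Q a · q
      q-square = ≡ᴹ-trans (≈⇒≡ᴹ (DA.≈sym (ap-as-mul (length Q) (List.lookup Q) q)))
        (≡.subst (λ k → apL Q q ≡ᴹ k · q) (evalᶠ-list Q) (ap-q (length Q) (List.lookup Q)))

    unit-top : ∀ {e} → e ≡ᴹ e₀ → Unit (e top)
    unit-top {e} h = Unit-resp (solve 2 (λ x y → x :+ (y :- x) := y) ≈refl (e₀ top) (e top)) (unit+nonunit e₀-top (h top))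

    nearly-idempotent : ∀ {e} → e ≡ᴹ e₀ → mul e e ≡ᴹ e
    nearly-idempotent {e} h = ≡ᴹ-trans (≡ᴹ-mulʳ e h) (≡ᴹ-trans (≈⇒≡ᴹ (mul-comm e e₀)) (≡ᴹ-trans (≡ᴹ-mulʳ e₀ h) (≡ᴹ-trans e₀-idempotent (λ i → nonunit-resp (neg-swap _ _) (nonunit-neg (h i))))))

  -- The idempotent e cuts out a factor of rank one, on which x acts as the root.
  root-from-idempotent : ∀ e → mul e e ≈ᵃ e → e ≡ᴹ e₀ → Σ C λ r → eval R P r ≈ 0# × ¬ Unit (r - a)
  root-from-idempotent e idem near = r , P-root , r-near
    where
    e-top = unit-top near
    r = X e top * proj₁ e-top
    u : V
    u = X e +ᵃ (-ᵃ (r · e))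
    u-top : u top ≈ 0#
    u-top = lin₁ (proj₂ e-top) (- X e top) (solve 3 (λ x s e → (x :+ :- ((x :* s) :* e)) :+ (:- x) :* con (+ 1) := con (+ 0) :+ (:- x) :* (e :* s)) ≈refl (X e top) (proj₁ e-top) (e top))
    e-u : mul e u ≈ᵃ u
    e-u = DA.≈trans (ap-+ʳ (suc d) e (X e) (-ᵃ (r · e))) (DA.+-cong (DA.≈trans (ap-X (suc d) e e) (X-cong idem))
      (DA.≈trans (DA.solve 2 (λ e w → (e ✶ (⁻ w)) ≗ (⁻ (e ✶ w))) DA.≈refl e (r · e)) (DA.-‿cong (DA.≈trans (ap-·ʳ (suc d) e r e) (λ i → *-congˡ (idem i))))))
    -- Modulo 𝔐 the vector w is a multiple of e. The top coordinate of e is a unit, so a vanishing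
    -- top coordinate of w forces the scalar k into 𝔐.
    primitive-contra : ∀ w → mul e w ≈ᵃ w → w top ≈ 0# → Inᴹ w
    primitive-contra w ew w0 = go (mul-e₀ w)
      where
      go : (Σ C λ k → mul w e₀ ≡ᴹ k · e₀) → Inᴹ w
      go (k , h) i = nonunit-resp (solve 2 (λ w x → (w :- x) :+ x := w) ≈refl (w i) (k * e i)) (nonunit-+ (w-near i) (nonunit-∣ (a∣a*b k _) k-nonunit))
        where
        w-near : w ≡ᴹ k · e
        w-near = ≡ᴹ-trans (≈⇒≡ᴹ (DA.≈trans (DA.≈sym ew) (mul-comm e w))) (≡ᴹ-trans (≡ᴹ-mulʳ w near) (≡ᴹ-trans h (≡ᴹ-· k (λ i → nonunit-resp (neg-swap _ _) (nonunit-neg (near i))))))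
        k-nonunit : ¬ Unit k
        k-nonunit ku = w-near top (Unit-resp (lin₁ w0 (- 1#) (solve 2 (λ w x → (:- x) :+ (:- con (+ 1)) :* con (+ 0) := (w :- x) :+ (:- con (+ 1)) :* w) ≈refl (w top) (k * e top))) (Unit-neg (Unit-* ku e-top)))
    -- Otherwise u divided by an entry of least value has an entry 1, while it satisfies the same
    -- equations and so has all entries in 𝔐.
    u≈0 : u ≈ᵃ 0ᵃ
    u≈0 = go (content u)
      where
      go : (Σ C λ η → (∀ j → η ∣ u j) × ((∃ λ i → η ≡ u i) ⊎ (∀ j → u j ≈ 0#))) → u ≈ᵃ 0ᵃ
      go (η , div , inj₂ z) = z
      go (.(u i) , div , inj₁ (i , ≡.refl)) = go′ (u i ≈? 0#)
        where
        η = u i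
        go′ : Dec (η ≈ 0#) → u ≈ᵃ 0ᵃ
        go′ (yes η≈0) j = ≈trans (proj₂ (div j)) (≈trans (*-congʳ η≈0) (zeroˡ _))
        go′ (no η≉0) = contradiction (Unit-resp (*-cancelˡ η≉0 (≈trans (*-identityʳ η) (proj₂ (div i)))) Unit-1) (primitive-contra w e-w w-top i)
          where
          w : V
          w j = proj₁ (div j)
          u≈ηw : u ≈ᵃ η · w
          u≈ηw j = proj₂ (div j)
          e-w : mul e w ≈ᵃ w
          e-w j = *-cancelˡ η≉0 (≈trans (≈sym (ap-·ʳ (suc d) e η w j)) (≈trans (ap-congʳ (suc d) e (λ k → ≈sym (u≈ηw k)) j) (≈trans (e-u j) (u≈ηw j))))
          w-top : w top ≈ 0#
          w-top = *-cancelˡ η≉0 (≈trans (≈sym (u≈ηw top)) (≈trans u-top (≈sym (zeroʳ η))))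
    X-e : X e ≈ᵃ r · e
    X-e i = -≈0⇒≈ (u≈0 i)
    act : ∀ l → apL l e ≈ᵃ eval R l r · e
    act [] i = ≈sym (zeroˡ _)
    act (b ∷ l) i = ≈trans (+-congˡ (≈trans (X-cong (act l) i) (≈trans (X-· (eval R l r) e i) (*-congˡ (X-e i)))))
      (solve 4 (λ b e p r → b :* e :+ p :* (r :* e) := (b :+ r :* p) :* e) ≈refl b (e i) (eval R l r) r)
    P-root : eval R P r ≈ 0#
    P-root = *-cancelˡ (Unit-≉0 e-top) (≈trans (*-comm _ _) (≈trans (≈trans (≈sym (act P top)) (P-kill e top)) (≈sym (zeroʳ _))))
    r-near : ¬ Unit (r - a)
    r-near ru = bad top (Unit-resp (lin₁ (X-e top) (- 1#) (solve 4 (λ r a e x → (r :- a) :* e :+ (:- con (+ 1)) :* (r :* e) := (x :- a :* e) :+ (:- con (+ 1)) :* x) ≈refl r a (e top) (X e top))) (Unit-* ru e-top))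
      where
      bad : X e ≡ᴹ a · e
      bad = ≡ᴹ-trans (≡ᴹ-X near) (≡ᴹ-trans X-e₀ (≡ᴹ-· a (λ i → nonunit-resp (neg-swap _ _) (nonunit-neg (near i)))))

  Approximable : C → Set (c ⊔ ℓ)
  Approximable z = Σ V λ e → e ≡ᴹ e₀ × (∀ i → z ∣ mul e e i - e i)

  approx-∣ : ∀ {z z′} → z ∣ z′ → Approximable z′ → Approximable z
  approx-∣ h (e , near , div) = e , near , λ i → ∣-trans h (div i)

  -- Newton's method for idempotents: e ↦ 3e² − 2e³ squares the error.
  approx-square : ∀ {z} → Approximable z → Approximable (z * z)
  approx-square {z} (e , near , div) = e′ , near′ , div′
    where
    e′ = mul e e +ᵃ (mul e e +ᵃ (mul e e +ᵃ (-ᵃ (mul e (mul e e) +ᵃ mul e (mul e e)))))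
    Y = mul e e +ᵃ (-ᵃ e)
    near′ : e′ ≡ᴹ e₀
    near′ = ≡ᴹ-trans (M-resp (DA.solve 1 (λ e → (((e ✶ e) ⊹ (⁻ e)) ✶ (κ (+ 1) ⊹ (⁻ (e ⊹ e)))) ≗
        (((e ✶ e) ⊹ ((e ✶ e) ⊹ ((e ✶ e) ⊹ (⁻ ((e ✶ (e ✶ e)) ⊹ (e ✶ (e ✶ e))))))) ⊹ (⁻ e))) DA.≈refl e)
      (M-mulˡ _ (nearly-idempotent near))) near
    v : V
    v i = proj₁ (div i)
    error : mul e′ e′ +ᵃ (-ᵃ e′) ≈ᵃ mul (mul Y Y) ((Y +ᵃ Y) +ᵃ ((Y +ᵃ Y) +ᵃ (-ᵃ (1ᵃ +ᵃ (1ᵃ +ᵃ 1ᵃ)))))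
    error = DA.solve 1 (λ e → let e′ = (e ✶ e) ⊹ ((e ✶ e) ⊹ ((e ✶ e) ⊹ (⁻ ((e ✶ (e ✶ e)) ⊹ (e ✶ (e ✶ e)))))) ; Y = (e ✶ e) ⊹ (⁻ e) in
      ((e′ ✶ e′) ⊹ (⁻ e′)) ≗ ((Y ✶ Y) ✶ ((Y ⊹ Y) ⊹ ((Y ⊹ Y) ⊹ (⁻ (κ (+ 1) ⊹ (κ (+ 1) ⊹ κ (+ 1)))))))) DA.≈refl e
    div′ : ∀ i → z * z ∣ mul e′ e′ i - e′ i
    div′ i = mul (mul v v) t i , ≈trans (error i) (≈trans (ap-cong (suc d) YY (λ j → ≈refl) i) (ap-·ˡ (suc d) (mul v v) (z * z) t i))
      where
      t = (Y +ᵃ Y) +ᵃ ((Y +ᵃ Y) +ᵃ (-ᵃ (1ᵃ +ᵃ (1ᵃ +ᵃ 1ᵃ))))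
      YY : mul Y Y ≈ᵃ (z * z) · mul v v
      YY j = ≈trans (ap-cong (suc d) (λ k → proj₂ (div k)) (λ k → proj₂ (div k)) j)
        (≈trans (ap-·ˡ (suc d) v z (z · v) j) (≈trans (*-congˡ (ap-·ʳ (suc d) v z v j)) (≈sym (*-assoc z z _))))

  private
    open DefinableSets R

    N : ℕ
    N = suc d ℕ.+ 1
    module CT = CompanionTerms R d cs N

    eᵥ : Fin (suc d) → Tm N
    eᵥ i = var (i Fin.↑ˡ 1)

    closeᶠ : Fin (suc d) → Fm N
    closeᶠ i = ∼ ((eᵥ i ⊟′ cst (e₀ i)) divides cst 1#)

    errorᶠ : Fin (suc d) → Fm N
    errorᶠ i = var (suc d Fin.↑ʳ zero) divides (CT.T.mul eᵥ eᵥ i ⊟′ eᵥ i)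

    approximable : Fm 1
    approximable = exs (suc d) (⋀ closeᶠ ⩓ ⋀ errorᶠ)

    module _ (z : C) (ev : Vec C (suc d)) where
      env : Vec C N
      env = ev Vec.++ (z ∷ [])
      e-sem : ∀ i → ⟦ eᵥ i ⟧ᵗ env ≈ lookup ev i
      e-sem i = reflexive (Vecₚ.lookup-++ˡ ev (z ∷ []) i)
      z-sem : lookup env (suc d Fin.↑ʳ zero) ≈ z
      z-sem = reflexive (Vecₚ.lookup-++ʳ ev (z ∷ []) zero)
      error-sem : ∀ i → ⟦ CT.T.mul eᵥ eᵥ i ⊟′ eᵥ i ⟧ᵗ env ≈ mul (lookup ev) (lookup ev) i - lookup ev i
      error-sem i = minus-cong (≈trans (CT.ap-sem (suc d) eᵥ eᵥ env i) (ap-cong (suc d) e-sem e-sem i)) (e-sem i)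

    ∤1⇒nonunit : ∀ {x} → x ∤ 1# → ¬ Unit x
    ∤1⇒nonunit h (y , e) = h (y , ≈sym e)

    approximable-elim : ∀ {z} → ⟦ approximable ⟧ (z ∷ []) → Approximable z
    approximable-elim {z} h = go (exs-elim (suc d) (⋀ closeᶠ ⩓ ⋀ errorᶠ) h)
      where
      go : (Σ (Vec C (suc d)) λ ev → ⟦ ⋀ closeᶠ ⩓ ⋀ errorᶠ ⟧ (ev Vec.++ (z ∷ []))) → Approximable z
      go (ev , cl , er) = lookup ev ,
        (λ i → nonunit-resp (minus-cong (e-sem z ev i) ≈refl) (∤1⇒nonunit (⋀-elim closeᶠ cl i))) ,
        (λ i → ∣-resp (z-sem z ev) (error-sem z ev i) (⋀-elim errorᶠ er i))

    approximable-intro : ∀ {z} → Approximable z → ⟦ approximable ⟧ (z ∷ [])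
    approximable-intro {z} (e , near , div) = exs-intro (suc d) (⋀ closeᶠ ⩓ ⋀ errorᶠ) ev
        (⋀-intro closeᶠ (λ i → nonunit-∤1 (nonunit-resp (minus-cong (≈sym (≈trans (e-sem z ev i) (tab i))) ≈refl) (near i))) ,
         ⋀-intro errorᶠ (λ i → ∣-resp (≈sym (z-sem z ev)) (≈sym (≈trans (error-sem z ev i) (minus-cong (ap-cong (suc d) tab tab i) (tab i)))) (div i)))
      where
      ev = tabulate e
      tab : ∀ i → lookup ev i ≈ e i
      tab i = reflexive (Vecₚ.lookup∘tabulate e i)

  -- If no idempotent is found, the elements that are not approximable form a definable prime ideal,
  -- modulo which idempotents are arbitrarily well approximated and hence liftable.
  module _ (none : ¬ Approximable 0#) where
    private
      𝔮ᶠ : Fm 1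
      𝔮ᶠ = ∼ approximable

      module Q = Quotient R em 𝔮ᶠ

      to : ∀ {x} → ¬ Approximable x → Q.𝔮 x
      to h g = h (approximable-elim g)

      from : ∀ {x} → Q.𝔮 x → ¬ Approximable x
      from h g = h (approximable-intro g)

      𝔮-* : ∀ {x} y → Q.𝔮 x → Q.𝔮 (x * y)
      𝔮-* y h = to (λ g → from h (approx-∣ (a∣a*b _ y) g))

      𝔮-∣ : ∀ {x y} → x ∣ y → Q.𝔮 x → Q.𝔮 y
      𝔮-∣ d h = to (λ g → from h (approx-∣ d g))

      𝔮-+ : ∀ {x y} → Q.𝔮 x → Q.𝔮 y → Q.𝔮 (x + y)
      𝔮-+ {x} {y} h g = [ (λ d → 𝔮-∣ (∣-+ ∣-refl d) h) , (λ d → 𝔮-∣ (∣-+ d ∣-refl) g) ]′ (val x y)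

      𝔮-0 : Q.𝔮 0#
      𝔮-0 = to none

      proper : ¬ Q.𝔮 1#
      proper h = from h (e₀ , ≈⇒≡ᴹ (λ i → ≈refl) , λ i → 1∣ _)

      prime : ∀ x y → Q.𝔮 (x * y) → Q.𝔮 x ⊎ Q.𝔮 y
      prime x y h = go em em
        where
        go : Dec (Approximable x) → Dec (Approximable y) → Q.𝔮 x ⊎ Q.𝔮 y
        go (no n) _ = inj₁ (to n)
        go (yes _) (no n) = inj₂ (to n)
        go (yes p) (yes q) = contradiction ([ (λ d → approx-∣ (*-mono-∣ d ∣-refl) (approx-square q)) , (λ d → approx-∣ (*-mono-∣ ∣-refl d) (approx-square p)) ]′ (val x y)) (from h)

      R/𝔮 : CommutativeRing c (c ⊔ ℓ)
      R/𝔮 = Q.quotient 𝔮-0 𝔮-+ 𝔮-*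

      𝔮-nonunit : ∀ {x} → Q.𝔮 x → ¬ Unit x
      𝔮-nonunit h u = proper (𝔮-∣ (Unit⇒∣ 1# u) h)

      unit-lift : ∀ {x} → IsUnit R/𝔮 x → Unit x
      unit-lift {x} (y , h) = unit-factor (Unit-resp (solve 2 (λ o z → o :+ (z :- o) := z) ≈refl 1# (x * y)) (unit+nonunit Unit-1 (𝔮-nonunit h)))

      unit-drop : ∀ {x} → Unit x → IsUnit R/𝔮 x
      unit-drop (y , e) = y , Q.𝔮-resp (≈sym (≈⇒-≈0 e)) 𝔮-0

    -- An entry of least value in the error of e is approximable by e itself, and hence cannot lie
    -- in 𝔮.
    absurd-idempotent : ∀ e → (∀ i → Q.𝔮 (mul e e i - e i)) → ¬ (e ≡ᴹ e₀)
    absurd-idempotent e h near = go (content (λ i → mul e e i - e i))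
      where
      go : ¬ (Σ C λ η → (∀ j → η ∣ mul e e j - e j) × ((∃ λ i → η ≡ mul e e i - e i) ⊎ (∀ j → mul e e j - e j ≈ 0#)))
      go (η , div , inj₁ (i , ≡.refl)) = from (h i) (e , near , div)
      go (η , div , inj₂ z) = none (e , near , λ i → ∣-respʳ (≈sym (z i)) (∣0 0#))

    contradictory : ⊥
    contradictory = go (content (λ i → mul e₀ e₀ i - e₀ i))
      where
      go : ¬ (Σ C λ η → (∀ j → η ∣ mul e₀ e₀ j - e₀ j) × ((∃ λ i → η ≡ mul e₀ e₀ i - e₀ i) ⊎ (∀ j → mul e₀ e₀ j - e₀ j ≈ 0#)))
      go (η , div , inj₂ z) = none (e₀ , ≈⇒≡ᴹ (λ i → ≈refl) , λ i → ∣-respʳ (≈sym (z i)) (∣0 0#))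
      -- The nonzero non-unit of the quotient is an entry of least value in the error of e₀: it is
      -- approximable by e₀, so it is outside 𝔮, and it lies in 𝔐 because e₀ is idempotent modulo 𝔐.
      go (ϖ , div , inj₁ (i , eq)) = go′ LA.lift-idempotent
        where
        ϖ≉0 : ¬ Q.𝔮 (ϖ - 0#)
        ϖ≉0 h = from (Q.𝔮-resp (solve 1 (λ x → x :- con (+ 0) := x) ≈refl ϖ) h) (e₀ , ≈⇒≡ᴹ (λ i → ≈refl) , div)
        ϖ-nonunit : ¬ IsUnit R/𝔮 ϖ
        ϖ-nonunit u = ≡.subst (λ z → ¬ Unit z) (≡.sym eq) (e₀-idempotent i) (unit-lift u)
        module LA = LocalAlgebra R/𝔮 em (Q.quotient-domain 𝔮-0 𝔮-+ 𝔮-* proper prime) (Q.quotient-dpMinimal 𝔮-0 𝔮-+ 𝔮-* dp)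
          (Q.quotient-valuation 𝔮-0 𝔮-+ 𝔮-* val) ϖ ϖ≉0 ϖ-nonunit d cs
        go′ : ¬ (Σ C λ δ → ¬ Q.𝔮 (δ - 0#) × (∀ e → (∀ i → Defs._∣_ R/𝔮 δ (mul e e i - e i)) →
          Σ V λ e′ → (∀ i → Q.𝔮 (mul e′ e′ i - e′ i)) × (∀ i → ¬ IsUnit R/𝔮 (e′ i - e i))))
        go′ (δ , δ≉0 , lifting) = go″ (stable em (λ n → δ≉0 (Q.𝔮-resp (solve 1 (λ x → x := x :- con (+ 0)) ≈refl δ) (to n))))
          where
          go″ : ¬ Approximable δ
          go″ (e , near , div) = let (e′ , idem , close) = lifting e (λ i → Q.∣-quotient 𝔮-0 𝔮-+ 𝔮-* (div i)) in
            absurd-idempotent e′ idem (≡ᴹ-trans (λ i u → close i (unit-drop u)) near)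

  simple-root : Σ C λ r → eval R P r ≈ 0# × ¬ Unit (r - a)
  simple-root = go (stable em contradictory)
    where
    go : Approximable 0# → Σ C λ r → eval R P r ≈ 0# × ¬ Unit (r - a)
    go (e , near , div) = root-from-idempotent e (λ i → -≈0⇒≈ (≈trans (proj₂ (div i)) (zeroˡ _))) near

valuation⇒henselian : ∀ {c ℓ} (R : CommutativeRing c ℓ) → ExcludedMiddle (c ⊔ ℓ) → IntegralDomain R → DPMinimal R → ValuationRing R → Henselian R
valuation⇒henselian R em dom dp val [] a root simple =
  contradiction (1# , ≈trans (*-identityʳ _) (≈trans (+-congˡ (zeroʳ a)) (+-identityʳ 1#))) root
  where open Divisibility R
valuation⇒henselian R em dom dp val (c₀ ∷ cs) a root simple =
  SimpleRoot.simple-root R em dom dp val c₀ cs a root (stable em simple)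

-- Criteria for valuation rings

module ValuationCriteria {c ℓ} (R : CommutativeRing c ℓ) (em : ExcludedMiddle (c ⊔ ℓ)) (dom : IntegralDomain R) (dp : DPMinimal R) where
  open DPMinimalDomain R em dom dp

  -- The common consequence of an infinite residue field and of an infinite subfield. It speaks of
  -- units only and does not presuppose that the non-units form an ideal.
  UnitDifferences : Set (c ⊔ ℓ)
  UnitDifferences = ∀ n → Σ (Fin n → C) (Apart (λ x y → ¬ Unit (x - y)))

  private
    multiples : C → Fm 1
    multiples a = cst a divides v₀

    valuation-by-cases : (∀ a b → a ∤ b → b ∤ a → ⊥) → ValuationRing R
    valuation-by-cases h a b = go em em
      where
      go : Dec (a ∣ b) → Dec (b ∣ a) → a ∣ b ⊎ b ∣ a
      go (yes p) _ = inj₁ p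
      go (no _) (yes q) = inj₂ q
      go (no p) (no q) = ⊥-elim (h a b p q)

  unitDifferences⇒valuation : UnitDifferences → ValuationRing R
  unitDifferences⇒valuation many = valuation-by-cases λ a b a∤b b∤a →
      let (K , noGrid) = no-grid (multiples a) (multiples b)
          (f , apart) = many K
      in noGrid [] [] (∣-subgroup a) (∣-subgroup b) (λ i → f i * b) (λ i → f i * a)
           (λ i → a∣b*a b (f i)) (λ i j ne → cancel a b a∤b (f i) (f j) (stable em (apart i j ne)))
           (λ i → a∣b*a a (f i)) (λ i j ne → cancel b a b∤a (f i) (f j) (stable em (apart i j ne)))
    where
    cancel : ∀ a b → a ∤ b → ∀ x y → Unit (x - y) → a ∤ x * b - y * b
    cancel a b a∤b x y (s , e) h = a∤b (∣-respʳ (lin₁ e b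
      (solve 4 (λ x y b s → (x :* b :- y :* b) :* s :+ b :* con (+ 1) := b :+ b :* ((x :- y) :* s)) ≈refl x y b s)) (∣-*ʳ s h))

  infiniteResidue⇒unitDifferences : InfiniteResidueField R → UnitDifferences
  infiniteResidue⇒unitDifferences inf = apart-of-infinite (λ x y → ¬ Unit (x - y))
    (λ h u → h (Unit-resp (neg-swap _ _) (Unit-neg u))) em (λ n f cover → inf (n , f , cover))

  infiniteSubfield⇒unitDifferences : HasInfiniteSubfield R → UnitDifferences
  infiniteSubfield⇒unitDifferences (S , sub , inf) n = go (apart-of-infinite E ≈sym em
      (λ n f cover → inf (n , proj₁ ∘ f , λ x x∈ → cover (x , x∈))) n)
    where
    open IsSubfield sub
    X = Σ C S
    E : X → X → Set ℓ
    E x y = proj₁ x ≈ proj₁ y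
    go : Σ (Fin n → X) (Apart E) → Σ (Fin n → C) (Apart (λ x y → ¬ Unit (x - y)))
    go (f , apart) = proj₁ ∘ f , λ i j ne nu →
      let (y , _ , e) = inv (close+ (proj₂ (f i)) (close- (proj₂ (f j)))) (λ z → apart i j ne (-≈0⇒≈ z)) in nu (y , e)

  -- Closure of the non-units under subtraction comes from the valuation ring that the hypothesis
  -- itself provides.
  unitDifferences⇒infiniteResidue : UnitDifferences → InfiniteResidueField R
  unitDifferences⇒infiniteResidue many (n , f , cover) = go (many (suc n))
    where
    open LocalRing R em dom (unitDifferences⇒valuation many)
    go : ¬ (Σ (Fin (suc n) → C) (Apart (λ x y → ¬ Unit (x - y))))
    go (g , apart) = go′ (Finₚ.pigeonhole ℕₚ.≤-refl (λ i → proj₁ (cover (g i))))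
      where
      go′ : ¬ (∃ λ i → ∃ λ j → i Fin.< j × proj₁ (cover (g i)) ≡ proj₁ (cover (g j)))
      go′ (i , j , i<j , eq) = apart i j (Finₚ.<⇒≢ i<j) (nonunit-resp
        (solve 3 (λ f x y → (f :- y) :- (f :- x) := x :- y) ≈refl (f (proj₁ (cover (g i)))) (g i) (g j))
        (nonunit-minus (≡.subst (λ k → ¬ Unit (f k - g j)) (≡.sym eq) (proj₂ (cover (g j)))) (proj₂ (cover (g i)))))

  -- Powers of m replace the elements with unit differences: 1 - m^k is a unit for k > 0, since
  -- otherwise m would divide it and hence 1.
  principal⇒valuation : MaximalIdealPrincipal R → ValuationRing R
  principal⇒valuation (m , gen) = valuation-by-cases λ a b a∤b b∤a →
      let (K , noGrid) = no-grid (multiples a) (multiples b) in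
      noGrid [] [] (∣-subgroup a) (∣-subgroup b) (λ i → m ^ toℕ i * b) (λ i → m ^ toℕ i * a)
        (λ i → a∣b*a b (m ^ toℕ i)) (λ i j ne → apart a b a∤b b∤a (toℕ i) (toℕ j) (ne ∘ Finₚ.toℕ-injective))
        (λ i → a∣b*a a (m ^ toℕ i)) (λ i j ne → apart b a b∤a a∤b (toℕ i) (toℕ j) (ne ∘ Finₚ.toℕ-injective))
    where
    m-nonunit : ¬ Unit m
    m-nonunit = Equivalence.from (gen m) ∣-refl
    -- If the cofactor q is a unit, then b divides a; otherwise m divides q and one factor m
    -- cancels. For m = 0 every non-unit is 0.
    descend : ∀ a b k → a ∣ m ^ k * b → a ∣ b ⊎ b ∣ a
    descend a b zero h = inj₁ (∣-respʳ (*-identityˡ b) h)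
    descend a b (suc k) (q , e) = go em
      where
      go : Dec (Unit q) → a ∣ b ⊎ b ∣ a
      go (yes (s , qs)) = inj₂ (m ^ suc k * s , lin₂ e (- s) qs (- a)
        (solve 5 (λ a q s M b → a :+ ((:- s) :* (a :* q) :+ (:- a) :* con (+ 1)) := b :* (M :* s) :+ ((:- s) :* (M :* b) :+ (:- a) :* (q :* s))) ≈refl a q s (m ^ suc k) b))
      go (no nu) = go′ (Equivalence.to (gen q) nu) (m ≈? 0#)
        where
        go′ : m ∣ q → Dec (m ≈ 0#) → a ∣ b ⊎ b ∣ a
        go′ (q′ , e′) (no m≉0) = descend a b k (q′ , *-cancelˡ m≉0 (lin₂ e 1# e′ a
          (solve 6 (λ m M b a q q′ → m :* (M :* b) :+ (con (+ 1) :* (a :* q) :+ a :* (m :* q′)) := m :* (a :* q′) :+ (con (+ 1) :* ((m :* M) :* b) :+ a :* q)) ≈refl m (m ^ k) b a q q′)))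
        go′ _ (yes m≈0) = field-case em
          where
          field-case : Dec (Unit a) → a ∣ b ⊎ b ∣ a
          field-case (yes u) = inj₁ (Unit⇒∣ b u)
          field-case (no nu) = let (s , e) = Equivalence.to (gen a) nu in inj₂ (∣-respʳ (≈sym (≈trans e (≈trans (*-congʳ m≈0) (zeroˡ s)))) (∣0 b))
    factor : ∀ i r → m ^ i - m ^ (suc i ℕ.+ r) ≈ m ^ i * (1# - m * m ^ r)
    factor i r = ≈trans (minus-cong ≈refl (≈trans (*-congˡ (^-+ m i r)) (solve 3 (λ m p q → m :* (p :* q) := p :* (m :* q)) ≈refl m (m ^ i) (m ^ r))))
      (solve 2 (λ p q → p :- p :* q := p :* (con (+ 1) :- q)) ≈refl (m ^ i) (m * m ^ r))
    unit : ∀ r → Unit (1# - m * m ^ r)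
    unit r = stable em λ nu → m-nonunit (let (s , e) = Equivalence.to (gen _) nu in s + m ^ r ,
      lin₁ e (- 1#) (solve 3 (λ m s p → m :* (s :+ p) :+ (:- con (+ 1)) :* (m :* s) := con (+ 1) :+ (:- con (+ 1)) :* (con (+ 1) :- m :* p)) ≈refl m s (m ^ r)))
    less : ∀ a b → a ∤ b → b ∤ a → ∀ i j → i ℕ.< j → a ∤ m ^ i * b - m ^ j * b
    less a b a∤b b∤a i j lt h = [ a∤b , b∤a ]′ (descend a b i (go (unit r)))
      where
      r = j ℕ.∸ suc i
      j≡ : suc i ℕ.+ r ≡ j
      j≡ = ℕₚ.m+[n∸m]≡n lt
      h′ : a ∣ m ^ i * (1# - m * m ^ r) * b
      h′ = ∣-respʳ (≈trans (solve 3 (λ x y b → x :* b :- y :* b := (x :- y) :* b) ≈refl (m ^ i) (m ^ (suc i ℕ.+ r)) b) (*-congʳ (factor i r)))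
        (≡.subst (λ j → a ∣ m ^ i * b - m ^ j * b) (≡.sym j≡) h)
      go : Unit (1# - m * m ^ r) → a ∣ m ^ i * b
      go (s , e) = ∣-respʳ (lin₁ e (m ^ i * b) (solve 4 (λ M u b s → ((M :* u) :* b) :* s :+ (M :* b) :* con (+ 1) := M :* b :+ (M :* b) :* (u :* s)) ≈refl (m ^ i) (1# - m * m ^ r) b s)) (∣-*ʳ s h′)
    apart : ∀ a b → a ∤ b → b ∤ a → ∀ i j → i ≢ j → a ∤ m ^ i * b - m ^ j * b
    apart a b a∤b b∤a i j ne h = go (ℕₚ.<-cmp i j)
      where
      go : _ → ⊥
      go (tri< lt _ _) = less a b a∤b b∤a i j lt h
      go (tri≈ _ eq _) = ne eq
      go (tri> _ _ gt) = less a b a∤b b∤a j i gt (∣-respʳ (neg-swap _ _) (∣-neg h))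

-- Integral closure and root closure

module Closures {c ℓ} (R : CommutativeRing c ℓ) (em : ExcludedMiddle (c ⊔ ℓ)) (dom : IntegralDomain R) where
  open Divisibility R
  open Domain em dom

  private
    ^-length-snoc : ∀ b (ps : List C) {x} → b ^ length (ps ++ x ∷ []) ≈ b * b ^ length ps
    ^-length-snoc b [] = ≈refl
    ^-length-snoc b (p ∷ ps) = *-congˡ (^-length-snoc b ps)

    -- Every lower term contains b = a k, hence a factor k beside the leading power of a. When the
    -- value is 0 this gives 1 + k s = 0, so k is a unit.
    homEval-multiple : ∀ cs a b k → b ≈ a * k → Σ C λ s → homEval R (cs ++ 1# ∷ []) a b ≈ a ^ length cs * (1# + k * s)
    homEval-multiple [] a b k e = 0# , solve 2 (λ a k → con (+ 1) :* con (+ 1) :+ a :* con (+ 0) := con (+ 1) :* (con (+ 1) :+ k :* con (+ 0))) ≈refl a k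
    homEval-multiple (p ∷ ps) a b k e with homEval-multiple ps a b k e
    ... | s , h = s + p * k ^ n , lin₂ h a (≈trans (^-length-snoc b ps {1#}) (≈trans (*-cong e (^-cong n e)) (*-congˡ (^-*-distrib a k n)))) p
        (solve 8 (λ p B a H A k s Kn → (p :* B :+ a :* H) :+ (a :* (A :* (con (+ 1) :+ k :* s)) :+ p :* ((a :* k) :* (A :* Kn)))
           := ((a :* A) :* (con (+ 1) :+ k :* (s :+ p :* Kn))) :+ (a :* H :+ p :* B)) ≈refl p (b ^ length (ps ++ 1# ∷ [])) a (homEval R (ps ++ 1# ∷ []) a b) (a ^ n) k s (k ^ n))
      where n = length ps

  valuation⇒integrallyClosed : ValuationRing R → IntegrallyClosed R
  valuation⇒integrallyClosed val cs a b b≉0 h = go (val b a)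
    where
    go : b ∣ a ⊎ a ∣ b → b ∣ a
    go (inj₁ d) = d
    go (inj₂ (k , e)) = go′ (homEval-multiple cs a b k e)
      where
      a≉0 : a ≉ 0#
      a≉0 = ∣-≉0 (k , e) b≉0
      go′ : (Σ C λ s → homEval R (cs ++ 1# ∷ []) a b ≈ a ^ length cs * (1# + k * s)) → b ∣ a
      go′ (s , f) = - s , lin₂ e s (*-cancelˡ (^-≉0 (length cs) a≉0) (≈trans (≈sym f) (≈trans h (≈sym (zeroʳ _))))) a
        (solve 4 (λ a b k s → a :+ (s :* (a :* k) :+ a :* con (+ 0)) := b :* (:- s) :+ (s :* b :+ a :* (con (+ 1) :+ k :* s))) ≈refl a b k s)

  integrallyClosed⇒rootClosed : IntegrallyClosed R → RootClosed R
  integrallyClosed⇒rootClosed ic n a b b≉0 (q , e) = ic (- q ∷ List.replicate n 0#) a b b≉0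
      (lin₂ e 1# (^-cong′ (len n)) (- q) (≈trans (+-congʳ (+-congˡ (*-congˡ (zeros n))))
        (solve 5 (λ q B a A B′ → ((:- q) :* B :+ a :* A) :+ (con (+ 1) :* (B′ :* q) :+ (:- q) :* B′) := con (+ 0) :+ (con (+ 1) :* (a :* A) :+ (:- q) :* B)) ≈refl q (b ^ length (List.replicate n 0# ++ 1# ∷ [])) a (a ^ n) (b ^ suc n))))
    where
    len : ∀ n → length (List.replicate n 0# ++ 1# ∷ []) ≡ suc n
    len zero = ≡.refl
    len (suc n) = ≡.cong suc (len n)
    ^-cong′ : ∀ {m n} → m ≡ n → b ^ m ≈ b ^ n
    ^-cong′ eq = reflexive (≡.cong (b ^_) eq)
    zeros : ∀ n → homEval R (List.replicate n 0# ++ 1# ∷ []) a b ≈ a ^ n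
    zeros zero = solve 1 (λ a → con (+ 1) :* con (+ 1) :+ a :* con (+ 0) := con (+ 1)) ≈refl a
    zeros (suc n) = ≈trans (+-cong (zeroˡ _) (*-congˡ (zeros n))) (+-identityˡ _)

-- Binomial coefficients and characteristic

binom : ℕ → ℕ → ℕ
binom n zero = 1
binom zero (suc k) = 0
binom (suc n) (suc k) = binom n k ℕ.+ binom n (suc k)

-- For n + 1 = p and k + 1 < p, Euclid's property turns this into divisibility of the binomial
-- coefficient by p.
binom-absorption : ∀ n k → suc k ℕ.* binom (suc n) (suc k) ≡ suc n ℕ.* binom n k
binom-absorption zero zero = ≡.refl
binom-absorption zero (suc k) = ℕₚ.*-zeroʳ k
binom-absorption (suc n) zero = begin
  1 ℕ.* (1 ℕ.+ binom (suc n) 1)           ≡⟨ ℕₚ.*-identityˡ _ ⟩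
  1 ℕ.+ binom (suc n) 1                   ≡⟨ ≡.cong suc (≡.trans (≡.sym (ℕₚ.*-identityˡ _)) (binom-absorption n zero)) ⟩
  suc (suc n) ℕ.* 1                       ∎
  where open ≡.≡-Reasoning
binom-absorption (suc n) (suc k) = begin
  suc (suc k) ℕ.* (B ℕ.+ binom (suc n) (suc (suc k)))             ≡⟨ ℕₚ.*-distribˡ-+ (suc (suc k)) B _ ⟩
  (B ℕ.+ suc k ℕ.* B) ℕ.+ suc (suc k) ℕ.* binom (suc n) (suc (suc k)) ≡⟨ ≡.cong₂ (λ x y → (B ℕ.+ x) ℕ.+ y) (binom-absorption n k) (binom-absorption n (suc k)) ⟩
  (B ℕ.+ suc n ℕ.* binom n k) ℕ.+ suc n ℕ.* binom n (suc k)       ≡⟨ ℕₚ.+-assoc B _ _ ⟩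
  B ℕ.+ (suc n ℕ.* binom n k ℕ.+ suc n ℕ.* binom n (suc k))       ≡⟨ ≡.cong (B ℕ.+_) (≡.sym (ℕₚ.*-distribˡ-+ (suc n) (binom n k) (binom n (suc k)))) ⟩
  suc (suc n) ℕ.* B                                               ∎
  where
  open ≡.≡-Reasoning
  B = binom (suc n) (suc k)

binom-vanish : ∀ n k → n ℕ.< k → binom n k ≡ 0
binom-vanish zero (suc k) _ = ≡.refl
binom-vanish (suc n) (suc k) (s≤s lt) = ≡.cong₂ ℕ._+_ (binom-vanish n k lt) (binom-vanish n (suc k) (ℕₚ.m≤n⇒m≤1+n lt))

binom-diag : ∀ n → binom n n ≡ 1
binom-diag zero = ≡.refl
binom-diag (suc n) = ≡.cong₂ ℕ._+_ (binom-diag n) (binom-vanish n (suc n) ℕₚ.≤-refl)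

-- Primality in the form in which the residue characteristic supplies it: a product of units is a
-- unit.
record EuclidPrime (p : ℕ) : Set where
  field
    2≤p : 2 ℕ.≤ p
    euclid : ∀ m n → p ℕD.∣ m ℕ.* n → p ℕD.∣ m ⊎ p ℕD.∣ n

  binom-divisible : ∀ k → 0 ℕ.< k → k ℕ.< p → p ℕD.∣ binom p k
  binom-divisible (suc k) _ k<p = go p ≡.refl
    where
    go : ∀ n → n ≡ p → p ℕD.∣ binom n (suc k)
    go zero eq = contradiction (≡.subst (suc k ℕ.<_) (≡.sym eq) k<p) λ ()
    go (suc n) ≡.refl = [ (λ d → contradiction (ℕD.∣⇒≤ d) (ℕₚ.<⇒≱ k<p)) , id ]′
      (euclid (suc k) (binom (suc n) (suc k)) (ℕD.divides (binom n k) (≡.trans (binom-absorption n k) (ℕₚ.*-comm (suc n) _))))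

module Integers {c ℓ} (R : CommutativeRing c ℓ) where
  private
    open module Div = Divisibility R

  ι′ : ℕ → C
  ι′ = ι R

  ι-+ : ∀ m n → ι′ (m ℕ.+ n) ≈ ι′ m + ι′ n
  ι-+ zero n = ≈sym (+-identityˡ _)
  ι-+ (suc m) n = ≈trans (+-congˡ (ι-+ m n)) (≈sym (+-assoc _ _ _))

  ι-* : ∀ m n → ι′ (m ℕ.* n) ≈ ι′ m * ι′ n
  ι-* zero n = ≈sym (zeroˡ _)
  ι-* (suc m) n = ≈trans (ι-+ n (m ℕ.* n)) (≈trans (+-congˡ (ι-* m n)) (solve 2 (λ a b → b :+ a :* b := (con (+ 1) :+ a) :* b) ≈refl (ι′ m) (ι′ n)))

  ι-1 : ι′ 1 ≈ 1#
  ι-1 = +-identityʳ 1#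

  private
    module _ (x y : C) where
      -- The sum of f k x^k y^(n - k) over k ≤ n, nested in y.
      homogeneous : ℕ → (ℕ → ℕ) → C
      homogeneous zero f = ι′ (f 0)
      homogeneous (suc n) f = y * homogeneous n f + ι′ (f (suc n)) * x ^ suc n

      shifted : (ℕ → ℕ) → ℕ → ℕ
      shifted f zero = 0
      shifted f (suc k) = f k

      homogeneous-x : ∀ n f → x * homogeneous n f ≈ homogeneous (suc n) (shifted f)
      homogeneous-x zero f = solve 3 (λ x y a → x :* a := y :* con (+ 0) :+ a :* (x :* con (+ 1))) ≈refl x y (ι′ (f 0))
      homogeneous-x (suc n) f = lin₁ (homogeneous-x n f) y
        (solve 6 (λ x y h a p k → x :* (y :* h :+ a :* p) :+ y :* k := (y :* k :+ a :* (x :* p)) :+ y :* (x :* h)) ≈refl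
          x y (homogeneous n f) (ι′ (f (suc n))) (x ^ suc n) (homogeneous (suc n) (shifted f)))

      homogeneous-y : ∀ n f → f (suc n) ≡ 0 → y * homogeneous n f ≈ homogeneous (suc n) f
      homogeneous-y n f eq = ≈sym (≈trans (+-congˡ (≈trans (*-congʳ (reflexive (≡.cong ι′ eq))) (zeroˡ _))) (+-identityʳ _))

      homogeneous-+ : ∀ n f g → homogeneous n f + homogeneous n g ≈ homogeneous n (λ k → f k ℕ.+ g k)
      homogeneous-+ zero f g = ≈sym (ι-+ (f 0) (g 0))
      homogeneous-+ (suc n) f g = lin₂ (homogeneous-+ n f g) y (ι-+ (f (suc n)) (g (suc n))) (- x ^ suc n)
        (solve 8 (λ y h k a b p hk ab → ((y :* h :+ a :* p) :+ (y :* k :+ b :* p)) :+ (y :* hk :+ (:- p) :* (a :+ b)) := (y :* hk :+ ab :* p) :+ (y :* (h :+ k) :+ (:- p) :* ab)) ≈refl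
          y (homogeneous n f) (homogeneous n g) (ι′ (f (suc n))) (ι′ (g (suc n))) (x ^ suc n) (homogeneous n (λ k → f k ℕ.+ g k)) (ι′ (f (suc n) ℕ.+ g (suc n))))

      homogeneous-cong : ∀ n {f g} → (∀ k → f k ≡ g k) → homogeneous n f ≈ homogeneous n g
      homogeneous-cong zero e = reflexive (≡.cong ι′ (e 0))
      homogeneous-cong (suc n) e = +-cong (*-congˡ (homogeneous-cong n e)) (*-congʳ (reflexive (≡.cong ι′ (e (suc n)))))

      binomial-theorem : ∀ n → (x + y) ^ n ≈ homogeneous n (binom n)
      binomial-theorem zero = ≈sym ι-1
      binomial-theorem (suc n) = ≈trans (*-congˡ (binomial-theorem n)) (≈trans (distribʳ _ x y)
        (≈trans (+-cong (homogeneous-x n (binom n)) (homogeneous-y n (binom n) (binom-vanish n (suc n) ℕₚ.≤-refl)))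
          (≈trans (homogeneous-+ (suc n) (shifted (binom n)) (binom n)) (homogeneous-cong (suc n) pascal))))
        where
        pascal : ∀ k → shifted (binom n) k ℕ.+ binom n k ≡ binom (suc n) k
        pascal zero = ≡.refl
        pascal (suc k) = ≡.refl

      divisible-tail : ∀ p n f → f 0 ≡ 1 → (∀ k → 0 ℕ.< k → k ℕ.≤ n → p ℕD.∣ f k) → Σ C λ g → homogeneous n f ≈ y ^ n + ι′ p * (x * g)
      divisible-tail p zero f f0 _ = 0# , ≈trans (reflexive (≡.cong ι′ f0)) (solve 2 (λ x p → con (+ 1) :+ con (+ 0) := con (+ 1) :+ p :* (x :* con (+ 0))) ≈refl x (ι′ p))
      divisible-tail p (suc n) f f0 div = go (divisible-tail p n f f0 (λ k a b → div k a (ℕₚ.m≤n⇒m≤1+n b))) (div (suc n) (s≤s z≤n) ℕₚ.≤-refl)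
        where
        go : (Σ C λ g → homogeneous n f ≈ y ^ n + ι′ p * (x * g)) → p ℕD.∣ f (suc n) → Σ C λ g → homogeneous (suc n) f ≈ y ^ suc n + ι′ p * (x * g)
        go (g , e) (ℕD.divides q eq) = y * g + ι′ q * x ^ n , lin₂ e y (≈trans (reflexive (≡.cong ι′ eq)) (ι-* q p)) (x ^ suc n)
          (solve 9 (λ x y h a P Y p g q → (y :* h :+ a :* (x :* P)) :+ (y :* (Y :+ p :* (x :* g)) :+ (x :* P) :* (q :* p))
             := (y :* Y :+ p :* (x :* (y :* g :+ q :* P))) :+ (y :* h :+ (x :* P) :* a)) ≈refl
            x y (homogeneous n f) (ι′ (f (suc n))) (x ^ n) (y ^ n) (ι′ p) g (ι′ q))

  -- The factor x * y of the error is displayed because in mixed characteristic a factor in 𝔐 must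
  -- survive division of p by ρ^p.
  freshman : ∀ {p} → EuclidPrime p → ∀ x y → Σ C λ g → (x + y) ^ p ≈ (x ^ p + y ^ p) + ι′ p * ((x * y) * g)
  freshman {zero} pr x y = contradiction (EuclidPrime.2≤p pr) λ ()
  freshman {suc n} pr x y = go (divisible-tail x y (suc n) n (binom (suc n)) ≡.refl (λ k a b → EuclidPrime.binom-divisible pr k a (s≤s b)))
    where
    go : (Σ C λ g → homogeneous x y n (binom (suc n)) ≈ y ^ n + ι′ (suc n) * (x * g)) → _
    go (g , e) = g , ≈trans (binomial-theorem x y (suc n)) (lin₂ e y (≈trans (reflexive (≡.cong ι′ (binom-diag (suc n)))) ι-1) (x ^ suc n)
      (solve 8 (λ x y h a P Y p g → (y :* h :+ a :* P) :+ (y :* (Y :+ p :* (x :* g)) :+ P :* con (+ 1)) := ((P :+ y :* Y) :+ p :* ((x :* y) :* g)) :+ (y :* h :+ P :* a)) ≈refl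
        x y (homogeneous x y n (binom (suc n))) (ι′ (binom (suc n) (suc n))) (x ^ suc n) (y ^ n) (ι′ (suc n)) g))

-- The prime field in equicharacteristic zero

module CharacteristicZero {c ℓ} (R : CommutativeRing c ℓ) (em : ExcludedMiddle (c ⊔ ℓ)) (dom : IntegralDomain R)
    (char : HasChar R 0) (residueChar : ResidueHasChar R 0) where
  open Divisibility R
  open Domain em dom
  open Integers R

  private
    ι-unit : ∀ n → Unit (ι′ (suc n))
    ι-unit n = stable em λ nu → contradiction (ℕD.0∣⇒≡0 (Equivalence.to (residueChar (suc n)) nu)) λ ()

    IsInt : C → Set ℓ
    IsInt z = Σ ℕ λ m → Σ ℕ λ k → z + ι′ k ≈ ι′ m

    int-ι : ∀ n → IsInt (ι′ n)
    int-ι n = n , 0 , +-identityʳ _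

    int-neg : ∀ {z} → IsInt z → IsInt (- z)
    int-neg {z} (m , k , e) = k , m , lin₁ e (- 1#) (solve 3 (λ z k m → (:- z :+ m) :+ (:- con (+ 1)) :* m := k :+ (:- con (+ 1)) :* (z :+ k)) ≈refl z (ι′ k) (ι′ m))

    int-+ : ∀ {z w} → IsInt z → IsInt w → IsInt (z + w)
    int-+ {z} {w} (m , k , e) (n , l , f) = m ℕ.+ n , k ℕ.+ l , ≈trans (+-congˡ (ι-+ k l))
      (≈trans (≈trans (solve 4 (λ z w k l → (z :+ w) :+ (k :+ l) := (z :+ k) :+ (w :+ l)) ≈refl z w (ι′ k) (ι′ l)) (+-cong e f)) (≈sym (ι-+ m n)))

    int-* : ∀ {z w} → IsInt z → IsInt w → IsInt (z * w)
    int-* {z} {w} (m , k , e) (n , l , f) = m ℕ.* n ℕ.+ k ℕ.* l , m ℕ.* l ℕ.+ k ℕ.* n ,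
      ≈trans (+-congˡ (≈trans (ι-+ (m ℕ.* l) (k ℕ.* n)) (+-cong (ι-* m l) (ι-* k n))))
        (≈trans (lin₂ e w f (ι′ m - ι′ k)
          (solve 6 (λ z w m k n l → (z :* w :+ (m :* l :+ k :* n)) :+ (w :* m :+ (m :- k) :* n) := (m :* n :+ k :* l) :+ (w :* (z :+ k) :+ (m :- k) :* (w :+ l)))
            ≈refl z w (ι′ m) (ι′ k) (ι′ n) (ι′ l)))
          (≈sym (≈trans (ι-+ (m ℕ.* n) (k ℕ.* l)) (+-cong (ι-* m n) (ι-* k l)))))

    int-unit : ∀ {z} → IsInt z → z ≉ 0# → Unit z
    int-unit {z} (m , k , e) z≉0 = go (ℕₚ.<-cmp m k)
      where
      split : ∀ {m k} → m ℕ.< k → ι′ k ≈ ι′ m + ι′ (suc (k ℕ.∸ suc m))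
      split {m} {k} lt = ≈trans (reflexive (≡.cong ι′ (≡.trans (≡.sym (ℕₚ.m+[n∸m]≡n lt)) (≡.sym (ℕₚ.+-suc m _))))) (ι-+ m _)
      go : _ → Unit z
      go (tri≈ _ ≡.refl _) = contradiction (lin₁ e 1# (solve 2 (λ z k → z :+ con (+ 1) :* k := con (+ 0) :+ con (+ 1) :* (z :+ k)) ≈refl z (ι′ k))) z≉0
      go (tri> _ _ gt) = Unit-resp (lin₂ e (- 1#) (split gt) (- 1#) (solve 4 (λ z k m s → s :+ ((:- con (+ 1)) :* m :+ (:- con (+ 1)) :* (k :+ s)) := z :+ ((:- con (+ 1)) :* (z :+ k) :+ (:- con (+ 1)) :* m)) ≈refl z (ι′ k) (ι′ m) (ι′ (suc (m ℕ.∸ suc k))))) (ι-unit (m ℕ.∸ suc k))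
      go (tri< lt _ _) = Unit-resp (lin₂ e (- 1#) (split lt) 1# (solve 4 (λ z k m s → (:- s) :+ ((:- con (+ 1)) :* m :+ con (+ 1) :* (m :+ s)) := z :+ ((:- con (+ 1)) :* (z :+ k) :+ con (+ 1) :* k)) ≈refl z (ι′ k) (ι′ m) (ι′ (suc (k ℕ.∸ suc m))))) (Unit-neg (ι-unit (k ℕ.∸ suc m)))

    -- The prime field, as fractions of integers: in residue characteristic 0 the nonzero integers
    -- are units.
    Rational : C → Set (c ⊔ ℓ)
    Rational x = Σ C λ z → Σ C λ w → IsInt z × IsInt w × w ≉ 0# × x * w ≈ z

    rational-ι : ∀ n → Rational (ι′ n)
    rational-ι n = ι′ n , ι′ 1 , int-ι n , int-ι 1 , (λ e → 1≉0 (≈trans (≈sym ι-1) e)) , ≈trans (*-congˡ ι-1) (*-identityʳ _)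

    rational-resp : ∀ {x y} → x ≈ y → Rational x → Rational y
    rational-resp e (z , w , zi , wi , w≉0 , f) = z , w , zi , wi , w≉0 , ≈trans (*-congʳ (≈sym e)) f

    subfield : IsSubfield R Rational
    subfield = record
      { resp = rational-resp
      ; has0 = rational-ι 0
      ; has1 = rational-resp ι-1 (rational-ι 1)
      ; close+ = λ { {x} {y} (z , w , zi , wi , w≉0 , e) (z′ , w′ , zi′ , wi′ , w≉0′ , e′) →
          z * w′ + z′ * w , w * w′ , int-+ (int-* zi wi′) (int-* zi′ wi) , int-* wi wi′ , *-≉0 w≉0 w≉0′ ,
          lin₂ e w′ e′ w (solve 6 (λ x y z w z′ w′ → (x :+ y) :* (w :* w′) :+ (w′ :* z :+ w :* z′) := (z :* w′ :+ z′ :* w) :+ (w′ :* (x :* w) :+ w :* (y :* w′))) ≈refl x y z w z′ w′) }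
      ; close- = λ { {x} (z , w , zi , wi , w≉0 , e) → - z , w , int-neg zi , wi , w≉0 , ≈trans (≈sym (-‿distribˡ-* x w)) (-‿cong e) }
      ; close* = λ { {x} {y} (z , w , zi , wi , w≉0 , e) (z′ , w′ , zi′ , wi′ , w≉0′ , e′) →
          z * z′ , w * w′ , int-* zi zi′ , int-* wi wi′ , *-≉0 w≉0 w≉0′ ,
          ≈trans (solve 4 (λ x y w w′ → (x :* y) :* (w :* w′) := (x :* w) :* (y :* w′)) ≈refl x y w w′) (*-cong e e′) }
      ; inv = λ { {x} (z , w , zi , wi , w≉0 , e) x≉0 →
          let z≉0 = λ z≈0 → *-≉0 x≉0 w≉0 (≈trans e z≈0)
              (s , f) = int-unit zi z≉0
          in w * s , (w , z , wi , zi , z≉0 , lin₁ f w (solve 3 (λ w s z → (w :* s) :* z :+ w :* con (+ 1) := w :+ w :* (z :* s)) ≈refl w s z)) ,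
             lin₂ e s f 1# (solve 4 (λ x w s z → x :* (w :* s) :+ (s :* z :+ con (+ 1) :* con (+ 1)) := con (+ 1) :+ (s :* (x :* w) :+ con (+ 1) :* (z :* s))) ≈refl x w s z) } }

    ι-injective : ∀ {i j} → i ℕ.< j → ι′ i ≉ ι′ j
    ι-injective {i} {j} lt e = contradiction (ℕD.0∣⇒≡0 (Equivalence.to (char (suc r)) (lin₂ e (- 1#) j≈ (- 1#)
        (solve 3 (λ i j s → s :+ ((:- con (+ 1)) :* j :+ (:- con (+ 1)) :* (i :+ s)) := con (+ 0) :+ ((:- con (+ 1)) :* i :+ (:- con (+ 1)) :* j)) ≈refl (ι′ i) (ι′ j) (ι′ (suc r)))))) λ ()
      where
      r = j ℕ.∸ suc i
      j≈ : ι′ j ≈ ι′ i + ι′ (suc r)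
      j≈ = ≈trans (reflexive (≡.cong ι′ (≡.trans (≡.sym (ℕₚ.m+[n∸m]≡n lt)) (≡.sym (ℕₚ.+-suc i r))))) (ι-+ i (suc r))

  hasInfiniteSubfield : HasInfiniteSubfield R
  hasInfiniteSubfield = Rational , subfield , λ { (n , f , cover) →
    let (i , j , i<j , eq) = Finₚ.pigeonhole ℕₚ.≤-refl (λ (i : Fin (suc n)) → proj₁ (cover (ι′ (toℕ i)) (rational-ι (toℕ i)))) in
    ι-injective i<j (≈trans (≈sym (proj₂ (cover (ι′ (toℕ i)) (rational-ι (toℕ i)))))
      (≈trans (reflexive (≡.cong f eq)) (proj₂ (cover (ι′ (toℕ j)) (rational-ι (toℕ j)))))) }

-- Artin–Schreier theory in characteristic p

module PowerTerms {c ℓ} (R : CommutativeRing c ℓ) where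
  open Divisibility R
  open DefinableSets R

  powᵗ : ∀ {n} → Tm n → ℕ → Tm n
  powᵗ t zero = cst 1#
  powᵗ t (suc k) = t ⊠ powᵗ t k

  powᵗ-sem : ∀ {n} (t : Tm n) k ρ → ⟦ powᵗ t k ⟧ᵗ ρ ≡ ⟦ t ⟧ᵗ ρ ^ k
  powᵗ-sem t zero ρ = ≡.refl
  powᵗ-sem t (suc k) ρ = ≡.cong (⟦ t ⟧ᵗ ρ *_) (powᵗ-sem t k ρ)

module Frobenius {c ℓ} (R : CommutativeRing c ℓ) (em : ExcludedMiddle (c ⊔ ℓ)) (dom : IntegralDomain R)
    (p′ : ℕ) (pr : EuclidPrime (suc (suc p′))) (ιp≈0 : CommutativeRing._≈_ R (ι R (suc (suc p′))) (CommutativeRing.0# R)) where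
  open Divisibility R
  open Domain em dom
  open Integers R

  p : ℕ
  p = suc (suc p′)

  F : C → C
  F x = x ^ p

  F-cong : ∀ {x y} → x ≈ y → F x ≈ F y
  F-cong = ^-cong p

  F-+ : ∀ x y → F (x + y) ≈ F x + F y
  F-+ x y = let (g , e) = freshman pr x y in ≈trans e (≈trans (+-congˡ (≈trans (*-congʳ ιp≈0) (zeroˡ _))) (+-identityʳ _))

  F-minus : ∀ x y → F (x - y) ≈ F x - F y
  F-minus x y = lin₁ (≈trans (≈sym (F-+ (x - y) y)) (F-cong (solve 2 (λ x y → (x :- y) :+ y := x) ≈refl x y))) 1#
    (solve 3 (λ d x y → d :+ con (+ 1) :* x := (x :- y) :+ con (+ 1) :* (d :+ y)) ≈refl (F (x - y)) (F x) (F y))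

  F-* : ∀ x y → F (x * y) ≈ F x * F y
  F-* x y = ^-*-distrib x y p

  F-0 : F 0# ≈ 0#
  F-0 = zeroˡ _

  F-1 : F 1# ≈ 1#
  F-1 = 1^ p

  F-neg : ∀ x → F (- x) ≈ - F x
  F-neg x = ≈trans (F-cong (≈sym (+-identityˡ _))) (≈trans (F-minus 0# x) (≈trans (+-congʳ F-0) (+-identityˡ _)))

  Fⁿ : ℕ → C → C
  Fⁿ zero x = x
  Fⁿ (suc n) x = F (Fⁿ n x)

  Fⁿ-cong : ∀ n {x y} → x ≈ y → Fⁿ n x ≈ Fⁿ n y
  Fⁿ-cong zero e = e
  Fⁿ-cong (suc n) e = F-cong (Fⁿ-cong n e)

  Fⁿ-+ : ∀ n x y → Fⁿ n (x + y) ≈ Fⁿ n x + Fⁿ n y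
  Fⁿ-+ zero x y = ≈refl
  Fⁿ-+ (suc n) x y = ≈trans (F-cong (Fⁿ-+ n x y)) (F-+ _ _)

  Fⁿ-neg : ∀ n x → Fⁿ n (- x) ≈ - Fⁿ n x
  Fⁿ-neg zero x = ≈refl
  Fⁿ-neg (suc n) x = ≈trans (F-cong (Fⁿ-neg n x)) (F-neg _)

  Fⁿ-* : ∀ n x y → Fⁿ n (x * y) ≈ Fⁿ n x * Fⁿ n y
  Fⁿ-* zero x y = ≈refl
  Fⁿ-* (suc n) x y = ≈trans (F-cong (Fⁿ-* n x y)) (F-* _ _)

  Fⁿ-F : ∀ n x → Fⁿ n (F x) ≈ F (Fⁿ n x)
  Fⁿ-F zero x = ≈refl
  Fⁿ-F (suc n) x = F-cong (Fⁿ-F n x)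

  Fⁿ-∘ : ∀ m n x → Fⁿ (m ℕ.+ n) x ≈ Fⁿ m (Fⁿ n x)
  Fⁿ-∘ zero n x = ≈refl
  Fⁿ-∘ (suc m) n x = F-cong (Fⁿ-∘ m n x)

  Fⁿ-period : ∀ m n {x} → Fⁿ n x ≈ x → Fⁿ (m ℕ.* n) x ≈ x
  Fⁿ-period zero n e = ≈refl
  Fⁿ-period (suc m) n {x} e = ≈trans (Fⁿ-∘ n (m ℕ.* n) x) (≈trans (Fⁿ-cong n (Fⁿ-period m n e)) e)

  Fⁿ-power : ∀ n x → Fⁿ n x ≈ x ^ (p ℕ.^ n)
  Fⁿ-power zero x = ≈sym (*-identityʳ x)
  Fⁿ-power (suc n) x = ≈trans (F-cong (Fⁿ-power n x)) (≈sym (^-* x p (p ℕ.^ n)))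

  Fⁿ-exponent : ∀ n → Σ ℕ λ k → ∀ x → Fⁿ (suc n) x ≈ x ^ suc (suc k)
  Fⁿ-exponent n = go (p ℕ.^ suc n) (ℕₚ.≤-trans (s≤s (s≤s z≤n)) (ℕₚ.m≤m*n p (p ℕ.^ n) {{ℕ.>-nonZero (ℕₚ.m^n>0 p n)}})) (Fⁿ-power (suc n))
    where
    go : ∀ Q → 2 ℕ.≤ Q → (∀ x → Fⁿ (suc n) x ≈ x ^ Q) → Σ ℕ λ k → ∀ x → Fⁿ (suc n) x ≈ x ^ suc (suc k)
    go (suc zero) (s≤s ())
    go (suc (suc k)) _ h = k , h

  -- These are 0 and the roots of unity in `R`, that is, the elements algebraic over the prime
  -- field.
  Periodic : C → Set (c ⊔ ℓ)
  Periodic x = Lift c (Σ ℕ λ n → Fⁿ (suc n) x ≈ x)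

  periodic-resp : ∀ {x y} → x ≈ y → Periodic x → Periodic y
  periodic-resp e (lift (n , h)) = lift (n , ≈trans (Fⁿ-cong (suc n) (≈sym e)) (≈trans h e))

  common-period : ∀ {x y} → Periodic x → Periodic y → Σ ℕ λ n → Fⁿ (suc n) x ≈ x × Fⁿ (suc n) y ≈ y
  common-period {x} {y} (lift (m , h)) (lift (n , g)) = n ℕ.+ m ℕ.* suc n ,
    ≈trans (reflexive (≡.cong (λ k → Fⁿ k x) (ℕₚ.*-comm (suc m) (suc n)))) (Fⁿ-period (suc n) (suc m) h) , Fⁿ-period (suc m) (suc n) g

  periodic-* : ∀ {x y} → Periodic x → Periodic y → Periodic (x * y)
  periodic-* px py = let (n , h , g) = common-period px py in lift (n , ≈trans (Fⁿ-* (suc n) _ _) (*-cong h g))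

  periodic-1 : Periodic 1#
  periodic-1 = lift (0 , F-1)

  periodic-^ : ∀ {x} n → Periodic x → Periodic (x ^ n)
  periodic-^ zero px = periodic-1
  periodic-^ (suc n) px = periodic-* px (periodic-^ n px)

  periodic-inverse : ∀ {x} → Periodic x → x ≉ 0# → Σ C λ y → Periodic y × x * y ≈ 1#
  periodic-inverse {x} px@(lift (n , h)) x≉0 = let (k , pow) = Fⁿ-exponent n in
    x ^ k , periodic-^ k px , *-cancelˡ x≉0 (≈trans (≈sym (pow x)) (≈trans h (≈sym (*-identityʳ x))))

  periodic-subfield : IsSubfield R Periodic
  periodic-subfield = record
    { resp = periodic-resp
    ; has0 = lift (0 , F-0)
    ; has1 = periodic-1
    ; close+ = λ px py → let (n , h , g) = common-period px py in lift (n , ≈trans (Fⁿ-+ (suc n) _ _) (+-cong h g))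
    ; close- = λ { (lift (n , h)) → lift (n , ≈trans (Fⁿ-neg (suc n) _) (-‿cong h)) }
    ; close* = periodic-*
    ; inv = periodic-inverse }

  -- For y = u / v with y^p − y = a, iterating gives F^j y = y + trace a j, which vanishes for j = p K if F^K a = a.
  module _ (a : C) where
    trace : ℕ → C
    trace zero = 0#
    trace (suc j) = F (trace j) + a

    trace-iterate : ∀ {u v} → v ≉ 0# → a * F v ≈ F u - u * v ^ suc p′ → ∀ j → v * Fⁿ j u ≈ Fⁿ j v * (u + v * trace j)
    trace-iterate {u} {v} v≉0 e zero = solve 2 (λ u v → v :* u := v :* (u :+ v :* con (+ 0))) ≈refl u v
    trace-iterate {u} {v} v≉0 e (suc j) = *-cancelˡ (^-≉0 (suc p′) v≉0)
      (lin₂ (≈trans (≈sym (F-* v (Fⁿ j u))) (≈trans (F-cong (trace-iterate v≉0 e j)) (≈trans (F-* _ _) (*-congˡ (≈trans (F-+ u (v * trace j)) (+-congˡ (F-* v (trace j)))))))) 1# e (- Fⁿ (suc j) v)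
        (solve 8 (λ vq v U V u t a Fu → vq :* (v :* U) :+ (con (+ 1) :* (V :* (Fu :+ (v :* vq) :* t)) :+ (:- V) :* (Fu :- u :* vq))
           := vq :* (V :* (u :+ v :* (t :+ a))) :+ (con (+ 1) :* ((v :* vq) :* U) :+ (:- V) :* (a :* (v :* vq)))) ≈refl
          (v ^ suc p′) v (Fⁿ (suc j) u) (Fⁿ (suc j) v) u (F (trace j)) a (F u)))

    module _ (K : ℕ) (period : Fⁿ K a ≈ a) where
      trace-fixed : ∀ j → Fⁿ K (trace j) ≈ trace j
      trace-fixed zero = go K
        where
        go : ∀ n → Fⁿ n 0# ≈ 0#
        go zero = ≈refl
        go (suc n) = ≈trans (F-cong (go n)) F-0
      trace-fixed (suc j) = ≈trans (Fⁿ-+ K _ a) (+-cong (≈trans (Fⁿ-F K (trace j)) (F-cong (trace-fixed j))) period)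

      trace-+ : ∀ i j → trace (i ℕ.+ j) ≈ Fⁿ i (trace j) + trace i
      trace-+ zero j = ≈sym (+-identityʳ _)
      trace-+ (suc i) j = ≈trans (+-congʳ (≈trans (F-cong (trace-+ i j)) (F-+ _ _))) (+-assoc _ _ a)

      trace-multiple : ∀ n → trace (n ℕ.* K) ≈ ι′ n * trace K
      trace-multiple zero = ≈sym (zeroˡ _)
      trace-multiple (suc n) = ≈trans (trace-+ K (n ℕ.* K)) (≈trans (+-congʳ (≈trans (trace-fixed (n ℕ.* K)) (trace-multiple n)))
        (solve 2 (λ i t → i :* t :+ t := (con (+ 1) :+ i) :* t) ≈refl (ι′ n) (trace K)))

      trace-vanish : trace (p ℕ.* K) ≈ 0#
      trace-vanish = ≈trans (trace-multiple p) (≈trans (*-congʳ ιp≈0) (zeroˡ _))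

  ArtinSchreierRoots : Set (c ⊔ ℓ)
  ArtinSchreierRoots = ∀ a → Unit a → Σ C λ u → Σ C λ v → v ≉ 0# × a * F v ≈ F u - u * v ^ suc p′

  module _ (rc : RootClosed R) (roots : ArtinSchreierRoots) where

    private
      Good : C → Set (c ⊔ ℓ)
      Good y = y ≉ 0# × Periodic y

    next : ∀ a → Good a → Σ C λ y → Good y × F y - y ≈ a
    next a (a≉0 , pa@(lift (n , period))) = go (roots a (let (b , _ , e) = periodic-inverse pa a≉0 in b , e))
      where
      go : (Σ C λ u → Σ C λ v → v ≉ 0# × a * F v ≈ F u - u * v ^ suc p′) → Σ C λ y → Good y × F y - y ≈ a
      go (u , v , v≉0 , e) = go₁ (Fⁿ-exponent J)
        where
        -- J + 1 = p (n + 1) is the multiple of the period at which the trace vanishes.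
        J = n ℕ.+ suc p′ ℕ.* suc n
        u≉0 : u ≉ 0#
        u≉0 u≈0 = *-≉0 a≉0 (^-≉0 p v≉0) (≈trans e (≈trans (minus-cong (F-cong u≈0) (*-congʳ u≈0))
          (≈trans (minus-cong F-0 (zeroˡ _)) (x-x≈0 0#))))
        iterated : v * Fⁿ (suc J) u ≈ Fⁿ (suc J) v * u
        iterated = ≈trans (trace-iterate a v≉0 e (suc J)) (*-congˡ (≈trans (+-congˡ (≈trans (*-congˡ (trace-vanish a (suc n) period)) (zeroʳ v))) (+-identityʳ u)))
        go₁ : (Σ ℕ λ k → ∀ x → Fⁿ (suc J) x ≈ x ^ suc (suc k)) → Σ C λ y → Good y × F y - y ≈ a
        -- A power of Frobenius fixes u / v, so some power of u / v is 1; root-closedness then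
        -- places u / v in `R`.
        go₁ (k , pow) = go₂ (rc k u v v≉0 (1# , ≈trans (*-cancelˡ u≉0 (*-cancelˡ v≉0 powers)) (≈sym (*-identityʳ _))))
          where
          powers : v * (u * u ^ suc k) ≈ v * (u * v ^ suc k)
          powers = ≈trans (*-congˡ (≈sym (pow u))) (≈trans iterated (≈trans (*-congʳ (pow v)) (solve 3 (λ v w u → (v :* w) :* u := v :* (u :* w)) ≈refl v (v ^ suc k) u)))
          go₂ : v ∣ u → Σ C λ y → Good y × F y - y ≈ a
          go₂ (y , u≈) = y , (y≉0 , lift (J , fixed)) , equation
            where
            Fv≉0 = ^-≉0 p v≉0
            equation : F y - y ≈ a
            equation = *-cancelˡ Fv≉0 (≈sym (≈trans (*-comm (F v) a) (≈trans e (≈trans (minus-cong (≈trans (F-cong u≈) (F-* v y)) (*-congʳ u≈))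
              (solve 4 (λ V Y v y → (v :* V) :* Y :- (v :* y) :* V := (v :* V) :* (Y :- y)) ≈refl (v ^ suc p′) (F y) v y)))))
            y≉0 : y ≉ 0#
            y≉0 y≈0 = u≉0 (≈trans u≈ (≈trans (*-congˡ y≈0) (zeroʳ v)))
            FJv≉0 : Fⁿ (suc J) v ≉ 0#
            FJv≉0 z = ^-≉0 (suc (suc k)) v≉0 (≈trans (≈sym (pow v)) z)
            fixed : Fⁿ (suc J) y ≈ y
            fixed = *-cancelˡ v≉0 (*-cancelˡ FJv≉0 (≈trans (≈trans (solve 3 (λ V v Y → V :* (v :* Y) := v :* (V :* Y)) ≈refl (Fⁿ (suc J) v) v (Fⁿ (suc J) y))
              (*-congˡ (≈sym (≈trans (Fⁿ-cong (suc J) u≈) (Fⁿ-* (suc J) v y))))) (≈trans iterated (*-congˡ u≈))))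

    private
      tower : ℕ → Σ C Good
      tower zero = 1# , 1≉0 , periodic-1
      tower (suc n) = let (y , g , _) = next (proj₁ (tower n)) (proj₂ (tower n)) in y , g

      y : ℕ → C
      y n = proj₁ (tower n)

      ℘ : C → C
      ℘ x = F x - x

      ℘-cong : ∀ {x z} → x ≈ z → ℘ x ≈ ℘ z
      ℘-cong e = minus-cong (F-cong e) e

      y-℘ : ∀ n → ℘ (y (suc n)) ≈ y n
      y-℘ n = proj₂ (proj₂ (next (proj₁ (tower n)) (proj₂ (tower n))))

      ℘ⁿ : ℕ → C → C
      ℘ⁿ zero x = x
      ℘ⁿ (suc n) x = ℘ⁿ n (℘ x)

      ℘ⁿ-cong : ∀ n {x z} → x ≈ z → ℘ⁿ n x ≈ ℘ⁿ n z
      ℘ⁿ-cong zero e = e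
      ℘ⁿ-cong (suc n) e = ℘ⁿ-cong n (℘-cong e)

      y-killed : ∀ n → ℘ⁿ (suc n) (y n) ≈ 0#
      y-killed zero = ≈trans (minus-cong F-1 ≈refl) (x-x≈0 1#)
      y-killed (suc n) = ≈trans (℘ⁿ-cong (suc n) (y-℘ n)) (y-killed n)

      y-descend : ∀ k m → ℘ⁿ k (y (k ℕ.+ m)) ≈ y m
      y-descend zero m = ≈refl
      y-descend (suc k) m = ≈trans (℘ⁿ-cong k (y-℘ (k ℕ.+ m))) (y-descend k m)

      -- Applying ℘ i + 1 times kills y i, but takes a later y j to another member of the tower,
      -- which is nonzero.
      y-distinct : ∀ {i j} → i ℕ.< j → y i ≉ y j
      y-distinct {i} {j} lt e = proj₁ (proj₂ (tower (j ℕ.∸ suc i))) (≈trans (≈sym (y-descend (suc i) (j ℕ.∸ suc i)))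
        (≈trans (℘ⁿ-cong (suc i) (≈trans (reflexive (≡.cong y (ℕₚ.m+[n∸m]≡n lt))) (≈sym e))) (y-killed i)))

    periodic-infinite : HasInfiniteSubfield R
    periodic-infinite = Periodic , periodic-subfield , λ { (n , f , cover) →
      let y∈ = λ i → proj₂ (proj₂ (tower i))
          (i , j , i<j , eq) = Finₚ.pigeonhole ℕₚ.≤-refl (λ (i : Fin (suc n)) → proj₁ (cover (y (toℕ i)) (y∈ (toℕ i)))) in
      y-distinct i<j (≈trans (≈sym (proj₂ (cover (y (toℕ i)) (y∈ (toℕ i))))) (≈trans (reflexive (≡.cong f eq)) (proj₂ (cover (y (toℕ j)) (y∈ (toℕ j)))))) }

-- A common nonzero element of the Artin-Schreier groups

module ArtinSchreier {c ℓ} (R : CommutativeRing c ℓ) (em : ExcludedMiddle (c ⊔ ℓ)) (dom : IntegralDomain R) (dp : DPMinimal R)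
    (p′ : ℕ) (pr : EuclidPrime (suc (suc p′))) (ιp≈0 : CommutativeRing._≈_ R (ι R (suc (suc p′))) (CommutativeRing.0# R))
    (w : CommutativeRing.Carrier R) (w≉0 : CommutativeRing._≉_ R w (CommutativeRing.0# R)) (w-nonunit : ¬ IsUnit R w) where
  open DPMinimalDomain R em dom dp
  open Frobenius R em dom p′ pr ιp≈0
  open PowerTerms R

  private
    q : ℕ
    q = suc p′

    -- t / b is of the form y^p − y in the fraction field
    AS : C → C → Set (c ⊔ ℓ)
    AS b t = Σ C λ u → Σ C λ v → v ≉ 0# × t * F v ≈ b * (F u - u * v ^ q)

    H : Fm 2
    H = Ex (Ex ((∼ (v₀ ≋ cst 0#)) ⩓ (v₂ ⊠ powᵗ v₀ p) ≋ (v₃ ⊠ (powᵗ v₁ p ⊟′ v₁ ⊠ powᵗ v₀ q))))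

    H-elim : ∀ {t b} → (H [ b ∷ [] ]) t → AS b t
    H-elim {t} {b} (u , v , v≉0 , lift e) = u , v , (v≉0 ∘ lift) ,
      ≈trans (*-congˡ (reflexive (≡.sym (powᵗ-sem v₀ p ρ)))) (≈trans e (*-congˡ (minus-cong (reflexive (powᵗ-sem v₁ p ρ)) (*-congˡ (reflexive (powᵗ-sem v₀ q ρ))))))
      where
      ρ : Vec C 4
      ρ = v ∷ u ∷ t ∷ b ∷ []

    H-intro : ∀ {t b} → AS b t → (H [ b ∷ [] ]) t
    H-intro {t} {b} (u , v , v≉0 , e) = u , v , (v≉0 ∘ lower) ,
      lift (≈trans (*-congˡ (reflexive (powᵗ-sem v₀ p ρ))) (≈trans e (*-congˡ (minus-cong (reflexive (≡.sym (powᵗ-sem v₁ p ρ))) (*-congˡ (reflexive (≡.sym (powᵗ-sem v₀ q ρ))))))))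
      where
      ρ : Vec C 4
      ρ = v ∷ u ∷ t ∷ b ∷ []

    AS-minus : ∀ {b t t′} → AS b t → AS b t′ → AS b (t - t′)
    AS-minus {b} {t} {t′} (u , v , v≉0 , e) (u′ , v′ , v′≉0 , e′) = u * v′ - u′ * v , v * v′ , *-≉0 v≉0 v′≉0 ,
      ≈trans (*-congˡ (F-* v v′)) (≈trans (lin₂ e (F v′) e′ (- F v)
        (solve 11 (λ b t t′ u u′ v v′ V V′ U U′ →
            ((t :- t′) :* ((v :* V) :* (v′ :* V′))) :+ ((v′ :* V′) :* (b :* (U :- u :* V)) :+ (:- (v :* V)) :* (b :* (U′ :- u′ :* V′)))
          := b :* ((U :* (v′ :* V′) :- U′ :* (v :* V)) :- (u :* v′ :- u′ :* v) :* (V :* V′)) :+ ((v′ :* V′) :* (t :* (v :* V)) :+ (:- (v :* V)) :* (t′ :* (v′ :* V′)))) ≈refl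
          b t t′ u u′ v v′ (v ^ q) (v′ ^ q) (F u) (F u′)))
        (*-congˡ (minus-cong (≈sym (≈trans (F-minus _ _) (minus-cong (F-* u v′) (F-* u′ v)))) (*-congˡ (≈sym (^-*-distrib v v′ q))))))

    H-subgroup : ∀ b → Subgroup (H [ b ∷ [] ])
    H-subgroup b = record
      { P-resp = λ e → resp≈ H (e ∷ ≈refl ∷ [])
      ; P-0 = H-intro (0# , 1# , 1≉0 , ≈trans (zeroˡ _) (≈sym (≈trans (*-congˡ (≈trans (minus-cong F-0 (zeroˡ _)) (x-x≈0 0#))) (zeroʳ b))))
      ; P-minus = λ h g → H-intro (AS-minus (H-elim h) (H-elim g)) }

    scale-up : ∀ e {b t} → AS b t → AS (e * b) (e * t)
    scale-up e {b} {t} (u , v , v≉0 , h) = u , v , v≉0 , ≈trans (*-assoc e t _) (≈trans (*-congˡ h) (≈sym (*-assoc e b _)))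

    scale-down : ∀ e {b t} → e ≉ 0# → AS (e * b) (e * t) → AS b t
    scale-down e {b} {t} e≉0 (u , v , v≉0 , h) = u , v , v≉0 , *-cancelˡ e≉0 (≈trans (≈sym (*-assoc e t _)) (≈trans h (*-assoc e b _)))

    multiples : Fm 2
    multiples = v₁ divides v₀

    bound = no-grid H multiples
    K = proj₁ bound

    ≡1-power : ∀ y → w ∣ y - 1# → ∀ n → w ∣ y ^ n - 1#
    ≡1-power y h zero = ∣-respʳ (≈sym (x-x≈0 1#)) (∣0 w)
    ≡1-power y h (suc n) = ∣-respʳ (solve 2 (λ y z → (y :- con (+ 1)) :* z :+ (z :- con (+ 1)) := y :* z :- con (+ 1)) ≈refl y (y ^ n)) (∣-+ (∣-*ʳ _ h) (≡1-power y h n))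

    module Index (b : C) (b≉0 : b ≉ 0#) where
      -- The exponent K ensures that v divided by w^i still contains the factor w * b for all i < K.
      v : C
      v = (w * b) ^ K
      v≉0 : v ≉ 0#
      v≉0 = ^-≉0 K (*-≉0 w≉0 b≉0)
      e : C
      e = F v
      e≉0 : e ≉ 0#
      e≉0 = ^-≉0 p v≉0
      value : C → C
      value u = b * (F u - u * v ^ q)

      value-AS : ∀ u → AS (e * b) (value u)
      value-AS u = u , v , v≉0 , solve 3 (λ b x e → (b :* x) :* e := (e :* b) :* x) ≈refl b (F u - u * v ^ q) e

      value-minus : ∀ u u′ → value u - value u′ ≈ value (u - u′)
      value-minus u u′ = lin₁ (F-minus u u′) (- b) (solve 7 (λ b u u′ V U U′ D → (b :* (U :- u :* V) :- b :* (U′ :- u′ :* V)) :+ (:- b) :* (U :- U′) := b :* (D :- (u :- u′) :* V) :+ (:- b) :* D) ≈refl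
        b u u′ (v ^ q) (F u) (F u′) (F (u - u′)))

      -- After division by b F(w^i), both the modulus and the linear term become divisible by w. So
      -- w would divide F y for some y congruent to 1 modulo w.
      less : ∀ i j → i ℕ.< j → j ℕ.< K → e ∤ value (w ^ i) - value (w ^ j)
      less i j i<j j<K h = go
        where
        r = j ℕ.∸ suc i
        s = w ^ r
        y = 1# - w * s
        y-1 : w ∣ y - 1#
        y-1 = - s , solve 2 (λ w s → (con (+ 1) :- w :* s) :- con (+ 1) := w :* (:- s)) ≈refl w s
        W = w ^ i
        difference : w ^ i - w ^ j ≈ W * y
        difference = ≈trans (minus-cong ≈refl (≈trans (reflexive (≡.cong (w ^_) (≡.sym (ℕₚ.m+[n∸m]≡n i<j)))) (*-congˡ (^-+ w i r))))
          (solve 3 (λ w W s → W :- w :* (W :* s) := W :* (con (+ 1) :- w :* s)) ≈refl w W s)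
        k = K ℕ.∸ suc i
        z = w ^ k * b ^ (i ℕ.+ k)
        v-split : v ≈ W * (w * b * z)
        v-split = ≈trans (reflexive (≡.cong ((w * b) ^_) (≡.sym (ℕₚ.m+[n∸m]≡n (ℕₚ.<-trans i<j j<K)))))
          (≈trans (^-*-distrib w b (suc i ℕ.+ k)) (≈trans (*-congʳ (*-congˡ (^-+ w i k)))
            (solve 5 (λ w b W wk bk → (w :* (W :* wk)) :* (b :* bk) := W :* ((w :* b) :* (wk :* bk))) ≈refl w b W (w ^ k) (b ^ (i ℕ.+ k)))))
        x = w * b * z
        go : ⊥
        go = nonunit-∤1 w-nonunit (∣-respʳ (solve 1 (λ t → t :- (t :- con (+ 1)) := con (+ 1)) ≈refl (F y)) (∣-minus w∣Fy (≡1-power y y-1 p)))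
          where
          w∣x : w ∣ x
          w∣x = ∣-*ʳ z (a∣a*b w b)
          FW = F W
          h₁ : FW * (x * x ^ q) ∣ b * (FW * F y - (W * y) * (W ^ q * x ^ q))
          h₁ = ∣-resp (≈trans (F-cong v-split) (F-* W x)) (≈trans (value-minus (w ^ i) (w ^ j)) (*-congˡ (minus-cong (≈trans (F-cong difference) (F-* W y))
            (*-cong difference (≈trans (^-cong q v-split) (^-*-distrib W x q)))))) h
          h₂ : (FW * b) * (w * (z * x ^ q)) ∣ (FW * b) * (F y - y * x ^ q)
          h₂ = ∣-resp (solve 5 (λ FW w b z X → FW :* (((w :* b) :* z) :* X) := (FW :* b) :* (w :* (z :* X))) ≈refl FW w b z (x ^ q))
            (solve 6 (λ W Wq b y Y X → b :* ((W :* Wq) :* Y :- (W :* y) :* (Wq :* X)) := ((W :* Wq) :* b) :* (Y :- y :* X)) ≈refl W (W ^ q) b y (F y) (x ^ q)) h₁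
          w∣Fy : w ∣ F y
          w∣Fy = ∣-respʳ (solve 2 (λ Y t → (Y :- t) :+ t := Y) ≈refl (F y) (y * x ^ q))
            (∣-+ (∣-trans (a∣a*b w _) (∣-cancelˡ (*-≉0 (^-≉0 p (^-≉0 i w≉0)) b≉0) h₂)) (∣-*ˡ y (∣-*ʳ _ w∣x)))

      value-apart : Apart (Mod (e ∣_)) (λ (i : Fin K) → value (w ^ toℕ i))
      value-apart i j ne h = go (ℕₚ.<-cmp (toℕ i) (toℕ j))
        where
        go : _ → ⊥
        go (tri< lt _ _) = less (toℕ i) (toℕ j) lt (Finₚ.toℕ<n j) h
        go (tri≈ _ eq _) = ne (Finₚ.toℕ-injective eq)
        go (tri> _ _ gt) = less (toℕ j) (toℕ i) gt (Finₚ.toℕ<n i) (∣-respʳ (neg-swap _ _) (∣-neg h))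

      -- The group for e * b contains K elements apart modulo e. By `no-grid` there cannot be K
      -- multiples of e apart modulo this group, and dividing by e transfers the bound to b.
      H-index : BoundedIndex (suc K) (H [ b ∷ [] ])
      H-index f apart = proj₂ bound (e * b ∷ []) (e ∷ []) (H-subgroup (e * b)) (∣-subgroup e)
          (λ i → e * f (emb i)) (λ i → value (w ^ toℕ i)) (λ i → a∣a*b e _)
          (λ i j ne h → apart (emb i) (emb j) (λ eq → ne (Finₚ.inject≤-injective _ _ i j eq))
            (H-intro (scale-down e e≉0 (H-elim (Subgroup.P-resp (H-subgroup (e * b)) (solve 3 (λ e x y → e :* x :- e :* y := e :* (x :- y)) ≈refl e (f (emb i)) (f (emb j))) h)))))
          (λ i → H-intro (value-AS (w ^ toℕ i))) value-apart
        where
        emb : Fin K → Fin (suc (suc K))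
        emb i = Fin.inject≤ i (ℕₚ.m≤n⇒m≤1+n (ℕₚ.n≤1+n K))

    open BaldwinSaxl H K

    Nonzero : Set (c ⊔ ℓ)
    Nonzero = Σ C λ b → b ≉ 0#

    ε : C
    ε = w ^ size
    ε≉0 : ε ≉ 0#
    ε≉0 = ^-≉0 size w≉0

    common : Σ C λ τ → τ ≉ 0# × (∀ b → b ≉ 0# → AS b τ)
    common = go (finite-index-⋂ Nonzero (λ b → proj₁ b ∷ []) (λ b → ε * proj₁ b ∷ []) ε
        (λ b → H-subgroup _) (λ b → H-subgroup _) (λ b → Index.H-index (proj₁ b) (proj₂ b)) (λ b → Index.H-index (ε * proj₁ b) (*-≉0 ε≉0 (proj₂ b)))
        (λ b t h → H-intro (scale-down ε ε≉0 (H-elim h))) (λ b t h → H-intro (scale-up ε (H-elim h)))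
        ((λ i → w ^ toℕ i) , powers-apart w≉0 w-nonunit size))
      where
      go : (Σ ℕ λ N → ∀ (t : Fin N → C) → Σ (Fin N) λ i → Σ (Fin N) λ j → i ≢ j × (∀ (b : Nonzero) → (H [ proj₁ b ∷ [] ]) (t i - t j))) → _
      go (N , fin) = go′ (fin (λ i → w ^ toℕ i))
        where
        go′ : (Σ (Fin N) λ i → Σ (Fin N) λ j → i ≢ j × (∀ (b : Nonzero) → (H [ proj₁ b ∷ [] ]) (w ^ toℕ i - w ^ toℕ j))) → Σ C λ τ → τ ≉ 0# × (∀ b → b ≉ 0# → AS b τ)
        go′ (i , j , ne , h) = w ^ toℕ i - w ^ toℕ j , (λ z → powers-apart w≉0 w-nonunit N i j ne (∣-respʳ (≈sym z) (∣0 _))) , λ b b≉0 → H-elim (h (b , b≉0))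

  -- A common element τ may be read with the denominator b = τ / a, which gives τ / b = a.
  artinSchreierRoots : ArtinSchreierRoots
  artinSchreierRoots a (a⁻¹ , inv) = go common
    where
    a⁻¹≉0 : a⁻¹ ≉ 0#
    a⁻¹≉0 z = 1≉0 (≈trans (≈sym inv) (≈trans (*-congˡ z) (zeroʳ a)))
    go : (Σ C λ τ → τ ≉ 0# × (∀ b → b ≉ 0# → AS b τ)) → Σ C λ u → Σ C λ v → v ≉ 0# × a * F v ≈ F u - u * v ^ suc p′
    go (τ , τ≉0 , h) = let (u , v , v≉0 , e) = h (τ * a⁻¹) (*-≉0 τ≉0 a⁻¹≉0) in
      u , v , v≉0 , *-cancelˡ τ≉0 (lin₂ e a inv (τ * (F u - u * v ^ q))
        (solve 5 (λ τ a b V X → τ :* (a :* V) :+ (a :* ((τ :* b) :* X) :+ (τ :* X) :* con (+ 1)) := τ :* X :+ (a :* (τ :* V) :+ (τ :* X) :* (a :* b))) ≈refl τ a a⁻¹ (F v) (F u - u * v ^ q)))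

-- Mixed characteristic with finite residue field

module MixedCharacteristic {c ℓ} (R : CommutativeRing c ℓ) (em : ExcludedMiddle (c ⊔ ℓ)) (dom : IntegralDomain R) (dp : DPMinimal R) (val : ValuationRing R)
    (p′ : ℕ) (pr : EuclidPrime (suc (suc p′)))
    (ιp≉0 : CommutativeRing._≉_ R (ι R (suc (suc p′))) (CommutativeRing.0# R)) (ιp-nonunit : ¬ IsUnit R (ι R (suc (suc p′))))
    (finite : FiniteResidueField R) (nonprincipal : ¬ MaximalIdealPrincipal R) where
  open DPMinimalDomain R em dom dp
  open LocalRing R em dom val
  open Integers R
  open PowerTerms R

  private
    p q : ℕ
    p = suc (suc p′)
    q = suc p′

    M : C → Set (c ⊔ ℓ)
    M x = ¬ Unit x

    M-*ʳ : ∀ {x} y → M x → M (x * y)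
    M-*ʳ y = nonunit-∣ (a∣a*b _ y)

    M-*ˡ : ∀ x {y} → M y → M (x * y)
    M-*ˡ x = nonunit-∣ (a∣b*a _ x)

    -- Strict divisibility: among nonzero elements, d has smaller value than k.
    _≺_ : C → C → Set (c ⊔ ℓ)
    d ≺ k = Σ C λ t → M t × k ≈ d * t

    ∤⇒≺ : ∀ {x y} → x ∤ y → y ≺ x
    ∤⇒≺ {x} {y} h = go (∤⇒∣ h)
      where
      go : y ∣ x → y ≺ x
      go (t , e) = t , (λ { (s , f) → h (s , lin₂ e (- s) f (- y) (solve 4 (λ x y t s → y :+ ((:- s) :* (y :* t) :+ (:- y) :* con (+ 1)) := x :* s :+ ((:- s) :* x :+ (:- y) :* (t :* s))) ≈refl x y t s)) }) , e

    ≺-trans : ∀ {x y z} → x ≺ y → y ≺ z → x ≺ z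
    ≺-trans (t , tM , e) (s , sM , f) = t * s , M-*ʳ s tM , ≈trans f (≈trans (*-congʳ e) (*-assoc _ _ _))

    ≺⇒∤ : ∀ {x y} → y ≉ 0# → x ≺ y → y ∤ x
    ≺⇒∤ {x} {y} y≉0 (t , tM , e) (s , f) = tM (s , *-cancelˡ y≉0 (lin₂ e (- 1#) f (- t)
      (solve 4 (λ x y t s → y :* (t :* s) :+ ((:- con (+ 1)) :* (x :* t) :+ (:- t) :* (y :* s)) := y :* con (+ 1) :+ ((:- con (+ 1)) :* y :+ (:- t) :* x)) ≈refl x y t s)))

    smaller : ∀ z → M z → Σ C λ y → M y × y ≺ z
    smaller z zM = stable em λ none → nonprincipal (z , λ x → mk⇔ (λ xM → stable em λ z∤x → none (x , xM , ∤⇒≺ z∤x)) (λ d → nonunit-∣ d zM))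

    -- Since z does not generate 𝔐, it is a product of two elements of 𝔐; the square of the factor
    -- of smaller value divides z.
    half : ∀ z → M z → z ≉ 0# → Σ C λ y → M y × y ≉ 0# × y * y ∣ z
    half z zM z≉0 = go (smaller z zM)
      where
      go : (Σ C λ y → M y × y ≺ z) → Σ C λ y → M y × y ≉ 0# × y * y ∣ z
      go (y , yM , t , tM , e) = go′ (val y t)
        where
        yt≉0 : y * t ≉ 0#
        yt≉0 h = z≉0 (≈trans e h)
        go′ : y ∣ t ⊎ t ∣ y → Σ C λ y → M y × y ≉ 0# × y * y ∣ z
        go′ (inj₁ d) = y , yM , *≉0ˡ yt≉0 , ∣-respʳ (≈sym e) (*-mono-∣ ∣-refl d)
        go′ (inj₂ d) = t , tM , *≉0ʳ yt≉0 , ∣-respʳ (≈sym e) (*-mono-∣ d ∣-refl)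

    high-root : ∀ z → M z → z ≉ 0# → ∀ N → Σ C λ k → M k × k ≉ 0# × k ^ suc N ∣ z
    high-root z zM z≉0 zero = z , zM , z≉0 , ∣-resp (≈sym (*-identityʳ z)) ≈refl ∣-refl
    high-root z zM z≉0 (suc N) = go (high-root z zM z≉0 N)
      where
      go : (Σ C λ k → M k × k ≉ 0# × k ^ suc N ∣ z) → Σ C λ k → M k × k ≉ 0# × k ^ suc (suc N) ∣ z
      go (k , kM , k≉0 , d) = let (y , yM , y≉0 , d′) = half k kM k≉0 in y , yM , y≉0 ,
        ∣-trans (^-≤-∣ y (s≤s (ℕₚ.m≤n+m (suc N) N))) (∣-trans (∣-resp (≈trans (^-*-distrib y y (suc N)) (≈sym (^-+ y (suc N) (suc N)))) ≈refl (^-mono-∣ (suc N) d′)) d)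

    -- The last argument is 2p - 1, so that κ^(2p) divides p.
    root = high-root (ι′ p) ιp-nonunit ιp≉0 (suc p′ ℕ.+ p)
    κ : C
    κ = proj₁ root
    κM : M κ
    κM = proj₁ (proj₂ root)
    κ≉0 : κ ≉ 0#
    κ≉0 = proj₁ (proj₂ (proj₂ root))
    -- The square leaves room for the scaling in Baldwin-Saxl: if b divides κ, then κ * b still
    -- divides ρ, so `Index` applies to both. At the same time ρ^p = κ^(2p) divides p.
    ρ : C
    ρ = κ * κ
    ρ≉0 : ρ ≉ 0#
    ρ≉0 = *-≉0 κ≉0 κ≉0
    ρᵖ≉0 : ρ ^ p ≉ 0#
    ρᵖ≉0 = ^-≉0 p ρ≉0
    ρᵖ∣ιp : ρ ^ p ∣ ι′ p
    ρᵖ∣ιp = ∣-resp (≈trans (^-+ κ p p) (≈sym (^-*-distrib κ κ p))) ≈refl (proj₂ (proj₂ (proj₂ root)))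

    value : C → C
    value m = m ^ p - m * ρ ^ q

    -- τ = b ρ^p ((m/ρ)^p − m/ρ + n) with m and n in 𝔐
    AS : C → C → Set (c ⊔ ℓ)
    AS b τ = Σ C λ m → Σ C λ n → M m × M n × τ ≈ b * (value m + ρ ^ p * n)

    A : Fm 2
    A = Ex (Ex ((∼ (v₁ divides cst 1#)) ⩓ (∼ (v₀ divides cst 1#)) ⩓ v₂ ≋ (v₃ ⊠ ((powᵗ v₁ p ⊟′ v₁ ⊠ cst (ρ ^ q)) ⊞ cst (ρ ^ p) ⊠ v₀))))

    A-elim : ∀ {τ b} → (A [ b ∷ [] ]) τ → AS b τ
    A-elim {τ} {b} (m , n , mM , nM , lift e) = m , n , (λ { (s , f) → mM (s , ≈sym f) }) , (λ { (s , f) → nM (s , ≈sym f) }) ,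
      ≈trans e (*-congˡ (+-congʳ (+-congʳ (reflexive (powᵗ-sem v₁ p σ)))))
      where
      σ : Vec C 4
      σ = n ∷ m ∷ τ ∷ b ∷ []

    A-intro : ∀ {τ b} → AS b τ → (A [ b ∷ [] ]) τ
    A-intro {τ} {b} (m , n , mM , nM , e) = m , n , nonunit-∤1 mM , nonunit-∤1 nM ,
      lift (≈trans e (*-congˡ (+-congʳ (+-congʳ (reflexive (≡.sym (powᵗ-sem v₁ p σ)))))))
      where
      σ : Vec C 4
      σ = n ∷ m ∷ τ ∷ b ∷ []

    -- Additivity of the p-th power fails by p times a multiple of m′. As ρ^p divides p and m′ is in
    -- 𝔐, the failure lies in ρ^p 𝔐 and is absorbed by the term n of `AS`.
    value-minus : ∀ {m m′} → M m → M m′ → Σ C λ n → M n × value m - value m′ ≈ value (m - m′) + ρ ^ p * n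
    value-minus {m} {m′} mM m′M = go (freshman pr d m′) ρᵖ∣ιp
      where
      d = m - m′
      go : (Σ C λ g → (d + m′) ^ p ≈ (d ^ p + m′ ^ p) + ι′ p * ((d * m′) * g)) → ρ ^ p ∣ ι′ p → Σ C λ n → M n × value m - value m′ ≈ value d + ρ ^ p * n
      go (g , e) (s , f) = s * ((d * m′) * g) , M-*ˡ s (M-*ʳ g (M-*ˡ d m′M)) ,
        lin₂ (≈trans (^-cong p (solve 2 (λ m m′ → m := (m :- m′) :+ m′) ≈refl m m′)) e) 1# f ((d * m′) * g)
          (solve 10 (λ m m′ P P′ D r i x s Rp → ((P :- m :* r) :- (P′ :- m′ :* r)) :+ (con (+ 1) :* ((D :+ P′) :+ i :* x) :+ x :* (Rp :* s))
             := ((D :- (m :- m′) :* r) :+ Rp :* (s :* x)) :+ (con (+ 1) :* P :+ x :* i)) ≈refl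
            m m′ (m ^ p) (m′ ^ p) (d ^ p) (ρ ^ q) (ι′ p) ((d * m′) * g) s (ρ ^ p))

    AS-minus : ∀ {b τ τ′} → AS b τ → AS b τ′ → AS b (τ - τ′)
    AS-minus {b} {τ} {τ′} (m , n , mM , nM , e) (m′ , n′ , m′M , n′M , e′) = go (value-minus mM m′M)
      where
      go : (Σ C λ k → M k × value m - value m′ ≈ value (m - m′) + ρ ^ p * k) → AS b (τ - τ′)
      go (k , kM , f) = m - m′ , (n - n′) + k , nonunit-minus mM m′M , nonunit-+ (nonunit-minus nM n′M) kM ,
        ≈trans (minus-cong e e′) (lin₁ f b (solve 8 (λ b V V′ D r n n′ k → (b :* (V :+ r :* n) :- b :* (V′ :+ r :* n′)) :+ b :* (D :+ r :* k) := b :* (D :+ r :* ((n :- n′) :+ k)) :+ b :* (V :- V′)) ≈refl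
          b (value m) (value m′) (value (m - m′)) (ρ ^ p) n n′ k))

    value-0 : value 0# ≈ 0#
    value-0 = ≈trans (minus-cong (zeroˡ _) (zeroˡ _)) (x-x≈0 0#)

    A-subgroup : ∀ b → Subgroup (A [ b ∷ [] ])
    A-subgroup b = record
      { P-resp = λ e → resp≈ A (e ∷ ≈refl ∷ [])
      ; P-0 = A-intro (0# , 0# , nonunit-0 , nonunit-0 , ≈sym (≈trans (*-congˡ (≈trans (+-cong value-0 (zeroʳ _)) (+-identityˡ 0#))) (zeroʳ b)))
      ; P-minus = λ h g → A-intro (AS-minus (A-elim h) (A-elim g)) }

    H : Fm 2
    H = atom A ((v₀ ⊠ cst (ρ ^ p)) ∷ v₁ ∷ [])

    distrib-minus : ∀ x y z → x * z - y * z ≈ (x - y) * z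
    distrib-minus = solve 3 (λ x y z → x :* z :- y :* z := (x :- y) :* z) ≈refl

    H-subgroup : ∀ b → Subgroup (H [ b ∷ [] ])
    H-subgroup b = record
      { P-resp = λ e → resp≈ H (e ∷ ≈refl ∷ [])
      ; P-0 = Subgroup.P-resp (A-subgroup b) (≈sym (zeroˡ _)) (Subgroup.P-0 (A-subgroup b))
      ; P-minus = λ {x} {y} h g → Subgroup.P-resp (A-subgroup b) (distrib-minus x y _) (Subgroup.P-minus (A-subgroup b) h g) }

    scale-up : ∀ b t → (H [ b ∷ [] ]) t → (H [ κ * b ∷ [] ]) (κ * t)
    scale-up b t h = let (m , n , mM , nM , e) = A-elim h in
      A-intro (m , n , mM , nM , ≈trans (*-assoc κ t _) (≈trans (*-congˡ e) (≈sym (*-assoc κ b _))))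

    scale-down : ∀ b t → (H [ κ * b ∷ [] ]) (κ * t) → (H [ b ∷ [] ]) t
    scale-down b t h = let (m , n , mM , nM , e) = A-elim h in
      A-intro (m , n , mM , nM , *-cancelˡ κ≉0 (≈trans (≈sym (*-assoc κ t _)) (≈trans e (*-assoc κ b _))))

    -- Because 𝔐 is not principal, its elements can have ever smaller values. They supply infinitely
    -- many elements whose differences have smaller value than κ.
    chain : ℕ → Σ C M
    chain zero = κ , κM
    chain (suc n) = let (y , yM , _) = smaller (proj₁ (chain n)) (proj₂ (chain n)) in y , yM

    y : ℕ → C
    y n = proj₁ (chain n)

    y-step : ∀ n → y (suc n) ≺ y n
    y-step n = proj₂ (proj₂ (smaller (proj₁ (chain n)) (proj₂ (chain n))))

    y-≺ : ∀ n k → y (suc (k ℕ.+ n)) ≺ y n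
    y-≺ n zero = y-step n
    y-≺ n (suc k) = ≺-trans (y-step (suc (k ℕ.+ n))) (y-≺ n k)

    y-less : ∀ i j → i ℕ.< j → y j ≺ y i
    y-less i j lt = ≡.subst (λ k → y k ≺ y i) (≡.trans (≡.cong suc (ℕₚ.+-comm (j ℕ.∸ suc i) i)) (ℕₚ.m+[n∸m]≡n lt)) (y-≺ i (j ℕ.∸ suc i))

    ≺-neg : ∀ {d k} → d ≺ k → (- d) ≺ k
    ≺-neg {d} (t , tM , e) = - t , nonunit-neg tM , ≈trans e (solve 2 (λ d t → d :* t := (:- d) :* (:- t)) ≈refl d t)

    ≺-resp : ∀ {d d′ k} → d ≈ d′ → d ≺ k → d′ ≺ k
    ≺-resp f (t , tM , e) = t , tM , ≈trans e (*-congʳ f)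

    difference-≺ : ∀ i j → i ℕ.< j → (y (suc i) - y (suc j)) ≺ κ
    difference-≺ i j lt = go (y-less (suc i) (suc j) (s≤s lt)) (y-less 0 (suc j) (s≤s z≤n))
      where
      go : y (suc j) ≺ y (suc i) → y (suc j) ≺ κ → (y (suc i) - y (suc j)) ≺ κ
      go (t , tM , e) (t′ , t′M , e′) = go′ (Unit-resp (solve 1 (λ t → :- con (+ 1) :+ t := t :- con (+ 1)) ≈refl t) (unit+nonunit (Unit-neg Unit-1) tM))
        where
        go′ : Unit (t - 1#) → (y (suc i) - y (suc j)) ≺ κ
        go′ (s , f) = s * t′ , M-*ˡ s t′M , ≈trans e′ (lin₂ e (- (s * t′)) f (- (y (suc j) * t′))
          (solve 5 (λ a b t s t′ → b :* t′ :+ ((:- (s :* t′)) :* (b :* t) :+ (:- (b :* t′)) :* con (+ 1)) := (a :- b) :* (s :* t′) :+ ((:- (s :* t′)) :* a :+ (:- (b :* t′)) :* ((t :- con (+ 1)) :* s))) ≈refl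
            (y (suc i)) (y (suc j)) t s t′))

    point : ∀ {n} → Fin n → C
    point i = y (suc (toℕ i))

    point-≺ : ∀ {n} (i j : Fin n) → i ≢ j → (point i - point j) ≺ κ
    point-≺ i j ne = go (ℕₚ.<-cmp (toℕ i) (toℕ j))
      where
      go : _ → (point i - point j) ≺ κ
      go (tri< lt _ _) = difference-≺ (toℕ i) (toℕ j) lt
      go (tri≈ _ eq _) = contradiction (Finₚ.toℕ-injective eq) ne
      go (tri> _ _ gt) = ≺-resp (neg-swap _ _) (≺-neg (difference-≺ (toℕ j) (toℕ i) gt))

    multiples : Fm 2
    multiples = v₁ divides v₀

    bound = no-grid A multiples
    K = proj₁ bound

    module Index (b : C) (b≉0 : b ≉ 0#) (b∣ρ : b ∣ ρ) where

      -- Write κ = d t. The linear term is negligible, so `value d` is d^p up to a unit. If ρ^p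
      -- divided b d^p, multiplication by t^p and b ∣ ρ would make κ^(p - 2) t^p a divisor of 1.
      value-small : ∀ d → d ≺ κ → ρ ^ p ∤ b * value d
      value-small d (t , tM , e) h = go (unit+nonunit Unit-1 (nonunit-neg (M-*ʳ ((t * κ) ^ p′) (M-*ʳ κ tM))))
        where
        split : value d ≈ d ^ p * (1# - (t * κ) * (t * κ) ^ p′)
        split = ≈trans (minus-cong ≈refl (*-congˡ (≈trans (^-cong q (≈trans (*-congʳ e) (*-assoc d t κ))) (^-*-distrib d (t * κ) q))))
          (solve 3 (λ d D X → d :* D :- d :* (D :* X) := (d :* D) :* (con (+ 1) :- X)) ≈refl d (d ^ q) ((t * κ) ^ q))
        go : Unit (1# - (t * κ) * (t * κ) ^ p′) → ⊥
        go (s , f) = nonunit-∤1 tM (∣-trans (∣-*ˡ _ (a∣a*b t _)) h₃)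
          where
          h₁ : ρ ^ p ∣ b * d ^ p
          h₁ = ∣-respʳ (lin₂ split (b * s) f (b * d ^ p) (solve 5 (λ b D U s V → (b :* V) :* s :+ ((b :* s) :* (D :* U) :+ (b :* D) :* con (+ 1)) := b :* D :+ ((b :* s) :* V :+ (b :* D) :* (U :* s))) ≈refl
            b (d ^ p) (1# - (t * κ) * (t * κ) ^ p′) s (value d))) (∣-*ʳ s h)
          h₂ : (κ ^ p * (κ * κ)) * (κ ^ p′ * t ^ p) ∣ (κ ^ p * (κ * κ)) * 1#
          h₂ = ∣-resp (≈trans (*-congʳ (^-*-distrib κ κ p)) (solve 4 (λ k P k′ T → (P :* (k :* (k :* k′))) :* T := (P :* (k :* k)) :* (k′ :* T)) ≈refl κ (κ ^ p) (κ ^ p′) (t ^ p)))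
            (≈trans (*-congˡ (≈trans (≈sym (^-*-distrib d t p)) (^-cong p (≈sym e)))) (solve 2 (λ r P → r :* P := (P :* r) :* con (+ 1)) ≈refl ρ (κ ^ p)))
            (∣-trans (*-mono-∣ h₁ (∣-refl {t ^ p})) (∣-resp (≈sym (*-assoc b _ _)) ≈refl (*-mono-∣ b∣ρ ∣-refl)))
          h₃ : κ ^ p′ * t ^ p ∣ 1#
          h₃ = ∣-cancelˡ (*-≉0 (^-≉0 p κ≉0) ρ≉0) h₂

      H-index : BoundedIndex (suc K) (H [ b ∷ [] ])
      H-index f apart = proj₂ bound (b ∷ []) (ρ ^ p ∷ []) (A-subgroup b) (∣-subgroup (ρ ^ p))
          (λ i → f (emb i) * ρ ^ p) (λ i → b * value (point i)) (λ i → a∣b*a _ _)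
          (λ i j ne h → apart (emb i) (emb j) (λ eq → ne (Finₚ.inject≤-injective _ _ i j eq)) (Subgroup.P-resp (A-subgroup b) (distrib-minus _ _ _) h))
          (λ i → A-intro (point i , 0# , proj₂ (chain (suc (toℕ i))) , nonunit-0 , *-congˡ (≈sym (≈trans (+-congˡ (zeroʳ _)) (+-identityʳ _)))))
          (λ i j ne h → value-small (point i - point j) (point-≺ i j ne) (reduce i j h (value-minus (proj₂ (chain (suc (toℕ i)))) (proj₂ (chain (suc (toℕ j)))))))
        where
        emb : Fin K → Fin (suc (suc K))
        emb i = Fin.inject≤ i (ℕₚ.m≤n⇒m≤1+n (ℕₚ.n≤1+n K))
        reduce : ∀ (i j : Fin K) → ρ ^ p ∣ b * value (point i) - b * value (point j) →
          (Σ C λ n → M n × value (point i) - value (point j) ≈ value (point i - point j) + ρ ^ p * n) → ρ ^ p ∣ b * value (point i - point j)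
        reduce i j h (n , _ , e) = ∣-respʳ (lin₁ e b (solve 6 (λ b V V′ D r n → ((b :* V :- b :* V′) :- r :* (b :* n)) :+ b :* (D :+ r :* n) := b :* D :+ b :* (V :- V′)) ≈refl
          b (value (point i)) (value (point j)) (value (point i - point j)) (ρ ^ p) n)) (∣-minus h (a∣a*b (ρ ^ p) (b * n)))

    open BaldwinSaxl H K

    Divisor : Set (c ⊔ ℓ)
    Divisor = Σ C λ b → b ∣ κ

    common : Σ C λ τ → τ ≺ κ × (∀ b → b ∣ κ → (H [ b ∷ [] ]) τ)
    common = go (finite-index-⋂ Divisor (λ b → proj₁ b ∷ []) (λ b → κ * proj₁ b ∷ []) κ
        (λ b → H-subgroup _) (λ b → H-subgroup _)
        (λ b → Index.H-index (proj₁ b) (∣-≉0 (proj₂ b) κ≉0) (∣-trans (proj₂ b) (a∣a*b κ κ)))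
        (λ b → Index.H-index (κ * proj₁ b) (*-≉0 κ≉0 (∣-≉0 (proj₂ b) κ≉0)) (*-mono-∣ ∣-refl (proj₂ b)))
        (λ b t → scale-down (proj₁ b) t) (λ b t → scale-up (proj₁ b) t)
        (point , λ i j ne h → ≺⇒∤ κ≉0 (point-≺ i j ne) h))
      where
      go : (Σ ℕ λ N → ∀ (t : Fin N → C) → Σ (Fin N) λ i → Σ (Fin N) λ j → i ≢ j × (∀ (b : Divisor) → (H [ proj₁ b ∷ [] ]) (t i - t j))) → _
      go (N , fin) = go′ (fin point)
        where
        go′ : (Σ (Fin N) λ i → Σ (Fin N) λ j → i ≢ j × (∀ (b : Divisor) → (H [ proj₁ b ∷ [] ]) (point i - point j))) → Σ C λ τ → τ ≺ κ × (∀ b → b ∣ κ → (H [ b ∷ [] ]) τ)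
        go′ (i , j , ne , h) = point i - point j , point-≺ i j ne , λ b d → h (b , d)

    ℘ : C → C
    ℘ x = x ^ p - x

    power-difference : ∀ x z n → (x - z) ∣ (x ^ n - z ^ n)
    power-difference x z zero = ∣-respʳ (≈sym (x-x≈0 1#)) (∣0 _)
    power-difference x z (suc n) = ∣-respʳ (solve 4 (λ x z X Z → (x :- z) :* X :+ z :* (X :- Z) := x :* X :- z :* Z) ≈refl x z (x ^ n) (z ^ n))
      (∣-+ (a∣a*b _ _) (∣-*ˡ z (power-difference x z n)))

    _≡ᴹ_ : C → C → Set (c ⊔ ℓ)
    x ≡ᴹ z = M (x - z)

    ≡ᴹ-sym : ∀ {x z} → x ≡ᴹ z → z ≡ᴹ x
    ≡ᴹ-sym h = nonunit-resp (neg-swap _ _) (nonunit-neg h)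

    ≡ᴹ-trans : ∀ {x z u} → x ≡ᴹ z → z ≡ᴹ u → x ≡ᴹ u
    ≡ᴹ-trans h g = nonunit-resp (≈sym (x-z≈ _ _ _)) (nonunit-+ h g)

    ≈⇒≡ᴹ : ∀ {x z} → x ≈ z → x ≡ᴹ z
    ≈⇒≡ᴹ e = nonunit-resp (≈sym (≈⇒-≈0 e)) nonunit-0

    ℘-≡ᴹ : ∀ {x z} → x ≡ᴹ z → ℘ x ≡ᴹ ℘ z
    ℘-≡ᴹ {x} {z} h = nonunit-∣ (∣-respʳ (solve 4 (λ x z X Z → (X :- Z) :- (x :- z) := (X :- x) :- (Z :- z)) ≈refl x z (x ^ p) (z ^ p)) (∣-minus (power-difference x z p) ∣-refl)) h

    ℘-0 : ℘ 0# ≈ 0#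
    ℘-0 = ≈trans (minus-cong (zeroˡ _) ≈refl) (x-x≈0 0#)

    ℘-1 : ℘ 1# ≈ 0#
    ℘-1 = ≈trans (minus-cong (1^ p) ≈refl) (x-x≈0 1#)

    0≢1 : ¬ (0# ≡ᴹ 1#)
    0≢1 h = nonunit-resp (neg-swap 0# 1#) (nonunit-neg h) (Unit-resp (solve 0 (con (+ 1) := con (+ 1) :- con (+ 0)) ≈refl) Unit-1)

    residue-classes : Σ ℕ λ k → Σ (Fin k → C) λ r → Apart _≡ᴹ_ r × (∀ x → ∃ λ i → r i ≡ᴹ x)
    residue-classes = let (k , _ , r , apart , cover) = representatives _≡ᴹ_ ≡ᴹ-sym em (proj₁ finite) bounded in k , r , apart , cover
      where
      f = proj₁ (proj₂ finite)
      cover = proj₂ (proj₂ finite)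
      bounded : ∀ (g : Fin (suc (proj₁ finite)) → C) → ¬ Apart _≡ᴹ_ g
      bounded g apart = let (i , j , i<j , eq) = Finₚ.pigeonhole ℕₚ.≤-refl (λ i → proj₁ (cover (g i))) in
        apart i j (Finₚ.<⇒≢ i<j) (≡ᴹ-trans (≡ᴹ-sym (proj₂ (cover (g i)))) (≡.subst (λ k → f k ≡ᴹ g j) (≡.sym eq) (proj₂ (cover (g j)))))

    -- ℘ takes the value 0 at both 0 and 1, so it is not injective on the finite residue field.
    not-surjective : Σ C λ a → ∀ x → ¬ (℘ x ≡ᴹ a)
    not-surjective = stable em λ none → contra none residue-classes
      where
      contra : ¬ (Σ C λ a → ∀ x → ¬ (℘ x ≡ᴹ a)) → ¬ (Σ ℕ λ k → Σ (Fin k → C) λ r → Apart _≡ᴹ_ r × (∀ x → ∃ λ i → r i ≡ᴹ x))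
      contra none (k , r , apart , cover) = choose em
        where
        x : Fin k → C
        x i = proj₁ (stable em (λ h → none (r i , λ x e → h (x , e))))
        x-℘ : ∀ i → ℘ (x i) ≡ᴹ r i
        x-℘ i = proj₂ (stable em (λ h → none (r i , λ x e → h (x , e))))
        same : ∀ {i j} → r i ≡ᴹ r j → i ≡ j
        same {i} {j} h with i Fin.≟ j
        ... | yes eq = eq
        ... | no ne = contradiction h (apart i j ne)
        i₀ = proj₁ (cover 0#)
        r-i₀ = proj₂ (cover 0#)
        hits-root : ∀ {z} → ℘ z ≈ 0# → ∀ i → z ≡ᴹ x i → i ≡ i₀
        hits-root e i h = same (≡ᴹ-trans (≡ᴹ-sym (x-℘ i)) (≡ᴹ-trans (℘-≡ᴹ (≡ᴹ-sym h)) (≡ᴹ-trans (≈⇒≡ᴹ e) (≡ᴹ-sym r-i₀))))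
        missed : ∀ z → ℘ z ≈ 0# → ¬ (z ≡ᴹ x i₀) → ⊥
        missed z e nz = go (Finₚ.pigeonhole ℕₚ.≤-refl (λ i → proj₁ (cover (X i))))
          where
          X : Fin (suc k) → C
          X = z ∷ᵥ x
          X-apart : ∀ i j → i Fin.< j → ¬ (X i ≡ᴹ X j)
          X-apart zero (suc j) _ h = nz (≡.subst (λ i → z ≡ᴹ x i) (hits-root e j h) h)
          X-apart (suc i) (suc j) (s≤s lt) h = Finₚ.<⇒≢ lt (same (≡ᴹ-trans (≡ᴹ-sym (x-℘ i)) (≡ᴹ-trans (℘-≡ᴹ h) (x-℘ j))))
          go : ¬ (∃ λ i → ∃ λ j → i Fin.< j × proj₁ (cover (X i)) ≡ proj₁ (cover (X j)))
          go (i , j , i<j , eq) = X-apart i j i<j (≡ᴹ-trans (≡ᴹ-sym (proj₂ (cover (X i)))) (≡.subst (λ k → r k ≡ᴹ X j) (≡.sym eq) (proj₂ (cover (X j)))))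
        choose : Dec (0# ≡ᴹ x i₀) → ⊥
        choose (no n) = missed 0# ℘-0 n
        choose (yes h) = missed 1# ℘-1 (λ g → 0≢1 (≡ᴹ-trans h (≡ᴹ-sym g)))

  mixed-contradiction : ⊥
  mixed-contradiction = go not-surjective common
    where
    go : (Σ C λ a → ∀ x → ¬ (℘ x ≡ᴹ a)) → ¬ (Σ C λ τ → τ ≺ κ × (∀ b → b ∣ κ → (H [ b ∷ [] ]) τ))
    go (a , avoid) (τ , (t , tM , e) , h) = go₁ (stable em (λ aM → avoid 0# (≡ᴹ-trans (≈⇒≡ᴹ ℘-0) (nonunit-resp (≈sym (+-identityˡ _)) (nonunit-neg aM)))))
      where
      τ≉0 : τ ≉ 0#
      τ≉0 = ∣-≉0 (t , e) κ≉0
      go₁ : ¬ Unit a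
      -- The element b = τ / a divides κ because τ does and a is a unit. Cancelling b leaves a ρ^p =
      -- value m + ρ^p n.
      go₁ (a⁻¹ , inv) = go₂ (A-elim (h b (a * t , ≈trans e (lin₁ inv (- (τ * t)) (solve 4 (λ τ t a b → τ :* t :+ (:- (τ :* t)) :* con (+ 1) := (τ :* b) :* (a :* t) :+ (:- (τ :* t)) :* (a :* b)) ≈refl τ t a a⁻¹)))))
        where
        b = τ * a⁻¹
        b≉0 : b ≉ 0#
        b≉0 z = τ≉0 (lin₂ inv (- τ) z a (solve 3 (λ τ a b → τ :+ ((:- τ) :* con (+ 1) :+ a :* con (+ 0)) := con (+ 0) :+ ((:- τ) :* (a :* b) :+ a :* (τ :* b))) ≈refl τ a a⁻¹))
        go₂ : ¬ AS b (τ * ρ ^ p)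
        go₂ (m , n , mM , nM , f) = go₃ em
          where
          equation : a * ρ ^ p ≈ value m + ρ ^ p * n
          equation = *-cancelˡ b≉0 (lin₂ f 1# inv (τ * ρ ^ p) (solve 5 (λ τ a b P V → (τ :* b) :* (a :* P) :+ (con (+ 1) :* ((τ :* b) :* V) :+ (τ :* P) :* con (+ 1)) := (τ :* b) :* V :+ (con (+ 1) :* (τ :* P) :+ (τ :* P) :* (a :* b))) ≈refl τ a a⁻¹ (ρ ^ p) (value m + ρ ^ p * n)))
          go₃ : Dec (ρ ∣ m) → ⊥
          -- Here x = m / ρ satisfies ℘ x = a - n, so it is a preimage of a modulo 𝔐.
          go₃ (yes (x , g)) = avoid x (nonunit-resp (≈sym key) (nonunit-neg nM))
            where
            key : ℘ x - a ≈ - n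
            key = *-cancelˡ ρᵖ≉0 (lin₂ equation (- 1#) (≈trans (minus-cong (≈trans (^-cong p g) (^-*-distrib ρ x p)) (*-congʳ g)) ≈refl) (- 1#)
              (solve 7 (λ r Rq x X a n V → (r :* Rq) :* ((X :- x) :- a) :+ ((:- con (+ 1)) :* (V :+ (r :* Rq) :* n) :+ (:- con (+ 1)) :* ((r :* Rq) :* X :- (r :* x) :* Rq))
                 := (r :* Rq) :* (:- n) :+ ((:- con (+ 1)) :* (a :* (r :* Rq)) :+ (:- con (+ 1)) :* V)) ≈refl ρ (ρ ^ q) x (x ^ p) a n (value m)))
          -- Now ρ = m s with s in 𝔐. Dividing the equation by m^p makes s a divisor of 1.
          go₃ (no ρ∤m) = go₄ (∤⇒≺ ρ∤m)
            where
            go₄ : ¬ (m ≺ ρ)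
            go₄ (s , sM , g) = nonunit-∤1 sM (s ^ p′ * ((1# + a * s) - s * n) , *-cancelˡ (^-≉0 p m≉0)
                (≈trans (lin₁ equation (- 1#) (solve 6 (λ m Mq a r Rq n → (m :* Mq) :* con (+ 1) :+ (:- con (+ 1)) :* ((m :* Mq :- m :* Rq) :+ (r :* Rq) :* n)
                     := ((a :* (r :* Rq) :+ m :* Rq) :- (r :* Rq) :* n) :+ (:- con (+ 1)) :* (a :* (r :* Rq))) ≈refl m (m ^ q) a ρ (ρ ^ q) n))
                  (≈trans (minus-cong (+-cong (*-congˡ (*-cong g ρq)) (*-congˡ ρq)) (*-congʳ (*-cong g ρq)))
                    (solve 6 (λ m Mq a s S n → (a :* ((m :* s) :* (Mq :* (s :* S))) :+ m :* (Mq :* (s :* S))) :- ((m :* s) :* (Mq :* (s :* S))) :* n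
                       := (m :* Mq) :* (s :* (S :* ((con (+ 1) :+ a :* s) :- s :* n)))) ≈refl m (m ^ q) a s (s ^ p′) n))))
              where
              m≉0 : m ≉ 0#
              m≉0 = ∣-≉0 (s , g) ρ≉0
              ρq : ρ ^ q ≈ m ^ q * s ^ q
              ρq = ≈trans (^-cong q g) (^-*-distrib m s q)

-- Assembly of the equivalences

module Equivalences {c ℓ} (R : CommutativeRing c ℓ) (em : ExcludedMiddle (c ⊔ ℓ)) (dom : IntegralDomain R) (dp : DPMinimal R) (infinite : InfiniteRing R) where
  open Divisibility R
  open Domain em dom
  open Integers R
  open ValuationCriteria R em dom dp
  open Closures R em dom

  private
    residueChar⇒prime : ∀ {p} → p ≢ 0 → ResidueHasChar R p → EuclidPrime p
    residueChar⇒prime {p} p≢0 char = record { 2≤p = two p p≢0 char ; euclid = euclid }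
      where
      two : ∀ p → p ≢ 0 → ResidueHasChar R p → 2 ℕ.≤ p
      two zero p≢0 char = contradiction ≡.refl p≢0
      two (suc zero) p≢0 char = contradiction (Unit-resp (≈sym ι-1) Unit-1) (Equivalence.from (char 1) ℕD.∣-refl)
      two (suc (suc p)) p≢0 char = s≤s (s≤s z≤n)
      euclid : ∀ m n → p ℕD.∣ m ℕ.* n → p ℕD.∣ m ⊎ p ℕD.∣ n
      euclid m n d = go em
        where
        go : Dec (Unit (ι′ m)) → p ℕD.∣ m ⊎ p ℕD.∣ n
        go (no nu) = inj₁ (Equivalence.to (char m) nu)
        go (yes u) = inj₂ (Equivalence.to (char n) (λ u′ → Equivalence.from (char (m ℕ.* n)) d (Unit-resp (≈sym (ι-* m n)) (Unit-* u u′))))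

    field-subfield : (∀ x → x ≉ 0# → Unit x) → HasInfiniteSubfield R
    field-subfield inverses = (λ _ → ⊤) , record
      { resp = λ _ _ → tt ; has0 = tt ; has1 = tt ; close+ = λ _ _ → tt ; close- = λ _ → tt ; close* = λ _ _ → tt
      ; inv = λ {x} _ x≉0 → let (y , e) = inverses x x≉0 in y , tt , e } ,
      λ { (n , f , cover) → infinite (n , f , λ x → cover x tt) }

  henselianValuationRing : UnitDifferences → HenselianValuationRing R
  henselianValuationRing many = val , valuation⇒henselian R em dom dp val
    where val = unitDifferences⇒valuation many

  rootClosed⇒infiniteSubfield : ∀ p → HasChar R p → ResidueHasChar R p → RootClosed R → HasInfiniteSubfield R
  rootClosed⇒infiniteSubfield zero char residueChar rc = CharacteristicZero.hasInfiniteSubfield R em dom char residueChar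
  rootClosed⇒infiniteSubfield p@(suc _) char residueChar rc = go p (residueChar⇒prime (λ ()) residueChar) (Equivalence.from (char p) ℕD.∣-refl)
    where
    go : ∀ p → EuclidPrime p → ι′ p ≈ 0# → HasInfiniteSubfield R
    go zero pr _ = contradiction (EuclidPrime.2≤p pr) λ ()
    go (suc zero) pr _ = contradiction (EuclidPrime.2≤p pr) λ { (s≤s ()) }
    go (suc (suc p′)) pr ιp≈0 = cases em
      where
      cases : Dec (Σ C λ w → w ≉ 0# × ¬ Unit w) → HasInfiniteSubfield R
      cases (yes (w , w≉0 , w-nonunit)) = Frobenius.periodic-infinite R em dom p′ pr ιp≈0 rc
        (ArtinSchreier.artinSchreierRoots R em dom dp p′ pr ιp≈0 w w≉0 w-nonunit)
      -- Without a nonzero non-unit `R` is a field and, being infinite, its own infinite subfield.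
      cases (no none) = field-subfield (λ x x≉0 → stable em (λ nu → none (x , x≉0 , nu)))

  mixed-principal : ∀ p → p ≢ 0 → HasChar R 0 → ResidueHasChar R p → ValuationRing R → FiniteResidueField R → MaximalIdealPrincipal R
  mixed-principal p p≢0 char residueChar val finite = stable em (go p p≢0 residueChar (residueChar⇒prime p≢0 residueChar))
    where
    go : ∀ p → p ≢ 0 → ResidueHasChar R p → EuclidPrime p → ¬ ¬ MaximalIdealPrincipal R
    go zero p≢0 _ _ _ = p≢0 ≡.refl
    go (suc zero) _ _ pr _ = contradiction (EuclidPrime.2≤p pr) λ { (s≤s ()) }
    go (suc (suc p′)) _ residueChar pr nonprincipal = MixedCharacteristic.mixed-contradiction R em dom dp val p′ pr
      (λ e → contradiction (ℕD.0∣⇒≡0 (Equivalence.to (char (suc (suc p′))) e)) λ ()) (Equivalence.from (residueChar (suc (suc p′))) ℕD.∣-refl) finite nonprincipal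

theorem4p1 : ∀ {c ℓ} → ExcludedMiddle (lsuc (c ⊔ ℓ)) →
    (R : CommutativeRing c ℓ) →
    IntegralDomain R → DPMinimal R → InfiniteRing R →
    (∀ (p : ℕ) → HasChar R p → ResidueHasChar R p →
    (HenselianValuationRing R ⇔ IntegrallyClosed R)
    × (HenselianValuationRing R ⇔ RootClosed R)
    × (HenselianValuationRing R ⇔ InfiniteResidueField R)
    × (HenselianValuationRing R ⇔ HasInfiniteSubfield R))
    × (∀ (p : ℕ) → p ≢ 0 → HasChar R 0 → ResidueHasChar R p →
    (HenselianValuationRing R ⇔
    (InfiniteResidueField R ⊎ (MaximalIdealPrincipal R × FiniteResidueField R))))
theorem4p1 {c} {ℓ} lem R dom dp infinite = equicharacteristic , mixed
  where
  em : ExcludedMiddle (c ⊔ ℓ)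
  em = em-lower {p = c ⊔ ℓ} {x = lsuc (c ⊔ ℓ)} lem
  open ValuationCriteria R em dom dp
  open Closures R em dom
  open Equivalences R em dom dp infinite

  equicharacteristic : ∀ p → HasChar R p → ResidueHasChar R p → _
  equicharacteristic p char residueChar =
      -- The cycle is a → b → c → e → a; condition d follows from e and returns to a, both times
      -- through `UnitDifferences`.
      mk⇔ a⇒b (c⇒a ∘ integrallyClosed⇒rootClosed)
    , mk⇔ a⇒c c⇒a
    , mk⇔ (unitDifferences⇒infiniteResidue ∘ infiniteSubfield⇒unitDifferences ∘ c⇒e ∘ a⇒c) (henselianValuationRing ∘ infiniteResidue⇒unitDifferences)
    , mk⇔ (c⇒e ∘ a⇒c) (henselianValuationRing ∘ infiniteSubfield⇒unitDifferences)
    where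
    a⇒b : HenselianValuationRing R → IntegrallyClosed R
    a⇒b = valuation⇒integrallyClosed ∘ proj₁
    a⇒c : HenselianValuationRing R → RootClosed R
    a⇒c = integrallyClosed⇒rootClosed ∘ a⇒b
    c⇒e : RootClosed R → HasInfiniteSubfield R
    c⇒e = rootClosed⇒infiniteSubfield p char residueChar
    c⇒a : RootClosed R → HenselianValuationRing R
    c⇒a = henselianValuationRing ∘ infiniteSubfield⇒unitDifferences ∘ c⇒e

  mixed : ∀ p → p ≢ 0 → HasChar R 0 → ResidueHasChar R p → _
  mixed p p≢0 char residueChar = mk⇔ (λ hv → residue hv em)
      [ henselianValuationRing ∘ infiniteResidue⇒unitDifferences
      , (λ h → let val = principal⇒valuation (proj₁ h) in val , valuation⇒henselian R em dom dp val) ]′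
    where
    residue : HenselianValuationRing R → Dec (FiniteResidueField R) → InfiniteResidueField R ⊎ (MaximalIdealPrincipal R × FiniteResidueField R)
    residue hv (no inf) = inj₁ inf
    residue hv (yes fin) = inj₂ (mixed-principal p p≢0 char residueChar (proj₁ hv) fin , fin)
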